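{- A bipartite graft $(G,T)$ is primal with respect to $r\in V(G)$ if and only if it is a synthesis of a skeleton comb $(G',T';A,B)$ that is primal with respect to $r\in A$ and a set of tooth grafts.
   Context: All graphs are finite (parallel edges allowed). A graft is a pair $(G,T)$ with $T\subseteq V(G)$; a join is $F\subseteq E(G)$ such that each vertex is incident to an odd number of edges of $F$ iff it lies in $T$; a minimum join is one of minimum size. $\delta_G(Y)$: edges with exactly one end in $Y$; $E_G[Y,Z]$: edges joining $Y$ and $Z$. For $F\subseteq E$ and a subgraph $Q$, $w_F(Q)=|E(Q)\setminus F|-|E(Q)\cap F|$; $\lambda_{(G,T),F}(x,y)$ is the minimum of $w_F(P)$ over paths between $x$ and $y$ ($0$ if $x=y$); for a minimum join it does not depend on the choice of $F$. A graft $(H,S)$ is primal with respect to $r\in V(H)$ if $\lambda_{(H,S),F'}(r,x)\le0$ for all $x\in V(H)$ ($F'$ a minimum join); then $A_{(H,S)}(r):=\{x:\lambda_{(H,S),F'}(r,x)=0\}$. A comb $(G',T';A,B)$ is a bipartite graft with color classes $A$ (spine set) and $B$ (tooth set) such that every minimum join $F$ satisfies $|\delta_{G'}(v)\cap F|=1$ for all $v\in B$. Graft contraction: identify a vertex set $Y$ into one vertex (deleting edges inside $Y$), the new vertex being terminal iff $|Y\cap S|$ is odd. Synthesis: given a comb $(G',T';A,B)$ and, for each $v\in B$, a bipartite graft $(G_v,T_v)$ (a tooth graft) with color classes $A_v,B_v$, primal with respect to some $r_v\in A_v$ (all pairwise disjoint and disjoint from $G'$), a bipartite graft $(\hat G,\hat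 T)$ is a synthesis if (1) each $G_v$ is a subgraph of $\hat G$ with the edges of $\hat G$ inside $V(G_v)$ exactly $E(G_v)$ and $\hat T\cap V(G_v)=T_v\Delta\{r_v\}$; (2) contracting each $V(G_v)$ into $v$ yields exactly $(G',T')$; (3) $\delta_{\hat G}(V(G_v))=E_{\hat G}[A,A_{(G_v,T_v)}(r_v)]$. -}

module Defs where

open import Data.Nat using (ℕ; zero; suc; _%_; _≤_)
open import Data.Fin using (Fin; zero; suc; fromℕ; inject₁; _≟_)
open import Data.Fin.Subset using (Subset; _∈_; _∉_; _⊆_; ∣_∣; _∩_; ⊤; ⁅_⁆)
open import Data.Vec using (tabulate; lookup)
open import Data.Bool using (Bool; true; false; _∧_; _∨_; _xor_; not; if_then_else_)
open import Data.Integer as ℤ using (ℤ; +_; -[1+_])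
open import Data.Product using (Σ; _×_; ∃; _,_)
open import Data.Sum using (_⊎_)
open import Relation.Nullary.Decidable using (⌊_⌋)
open import Relation.Binary.PropositionalEquality using (_≡_)
open import Function using (_∘_)
open import Function.Bundles using (_⇔_)

-- Finite multigraphs.  Vertices live in a universe Fin nV and edges in
-- a universe Fin nE; the actual graph is given by the masks Vp (vertex
-- set) and Ep (edge set).  This lets induced subgraphs and contractions
-- be expressed as graphs over the same universes.

record Graph : Set where
  constructor graph
  field
    nV nE : ℕ
    src tgt : Fin nE → Fin nV
    Vp : Subset nV
    Ep : Subset nE
open Graph public

mkGraph : (n m : ℕ) → (Fin m → Fin n) → (Fin m → Fin n) → Graph
mkGraph n m s t = graph n m s t ⊤ ⊤

incident : (G : Graph) → Fin (nV G) → Subset (nE G)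
incident G v = tabulate λ e → ⌊ src G e ≟ v ⌋ ∨ ⌊ tgt G e ≟ v ⌋

δ : (G : Graph) → Subset (nV G) → Subset (nE G)
δ G Y = tabulate λ e → lookup (Ep G) e ∧ (lookup Y (src G e) xor lookup Y (tgt G e))

IsOdd : ℕ → Set
IsOdd k = k % 2 ≡ 1

IsJoin : (G : Graph) → Subset (nV G) → Subset (nE G) → Set
IsJoin G T F = F ⊆ Ep G × (∀ v → v ∈ Vp G → (IsOdd ∣ F ∩ incident G v ∣ ⇔ v ∈ T))

IsMinJoin : (G : Graph) → Subset (nV G) → Subset (nE G) → Set
IsMinJoin G T F = IsJoin G T F × (∀ F' → IsJoin G T F' → ∣ F ∣ ≤ ∣ F' ∣)

record Path (G : Graph) (x y : Fin (nV G)) : Set where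
  field
    len : ℕ
    vs : Fin (suc len) → Fin (nV G)
    es : Fin len → Fin (nE G)
    start : vs zero ≡ x
    end : vs (fromℕ len) ≡ y
    vIn : ∀ i → vs i ∈ Vp G
    eIn : ∀ i → es i ∈ Ep G
    link : ∀ i → (src G (es i) ≡ vs (inject₁ i) × tgt G (es i) ≡ vs (suc i))
                 ⊎ (src G (es i) ≡ vs (suc i) × tgt G (es i) ≡ vs (inject₁ i))
    distinct : ∀ i j → vs i ≡ vs j → i ≡ j
open Path public

sumFin : ∀ {k} → (Fin k → ℤ) → ℤ
sumFin {zero} f = + 0
sumFin {suc k} f = f zero ℤ.+ sumFin (f ∘ suc)

-- w_F(P) = |E(P) \ F| - |E(P) ∩ F|  (the edges of a path are distinct)
weight : {G : Graph} {x y : Fin (nV G)} → Subset (nE G) → Path G x y → ℤ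
weight F P = sumFin λ i → if lookup F (es P i) then -[1+ 0 ] else + 1

IsLambda : (G : Graph) → Subset (nE G) → Fin (nV G) → Fin (nV G) → ℤ → Set
IsLambda G F x y k = (Σ (Path G x y) λ P → weight F P ≡ k) × ((P : Path G x y) → k ℤ.≤ weight F P)

Primal : (G : Graph) → Subset (nV G) → Fin (nV G) → Set
Primal G T r = r ∈ Vp G × Σ (Subset (nE G)) λ F → IsMinJoin G T F ×
  (∀ x → x ∈ Vp G → Σ ℤ λ k → IsLambda G F r x k × k ℤ.≤ + 0)

InA : (G : Graph) → Subset (nV G) → Fin (nV G) → Fin (nV G) → Set
InA G T r x = x ∈ Vp G × Σ (Subset (nE G)) λ F → IsMinJoin G T F × IsLambda G F r x (+ 0)

IsBipartition : (G : Graph) → Subset (nV G) → Subset (nV G) → Set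
IsBipartition G A B = A ⊆ Vp G × B ⊆ Vp G
  × (∀ x → x ∈ Vp G → (x ∈ A × x ∉ B) ⊎ (x ∉ A × x ∈ B))
  × (∀ e → e ∈ Ep G → (src G e ∈ A × tgt G e ∈ B) ⊎ (src G e ∈ B × tgt G e ∈ A))

IsBipartite : Graph → Set
IsBipartite G = Σ (Subset (nV G)) λ A → Σ (Subset (nV G)) λ B → IsBipartition G A B

IsComb : (G : Graph) → Subset (nV G) → Subset (nV G) → Subset (nV G) → Set
IsComb G T A B = IsBipartition G A B ×
  (∀ F → IsMinJoin G T F → ∀ v → v ∈ B → ∣ F ∩ δ G ⁅ v ⁆ ∣ ≡ 1)

module _ {n m : ℕ} (s t : Fin m → Fin n) (T : Subset n) {k : ℕ} (φ : Fin n → Fin k) where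

  fibre : Fin k → Subset n
  fibre v = tabulate λ x → ⌊ φ x ≟ v ⌋

  contractG : Graph
  contractG = graph k m (φ ∘ s) (φ ∘ t) ⊤
    (tabulate λ e → not ⌊ φ (s e) ≟ φ (t e) ⌋)

  contractT : Subset k
  contractT = tabulate λ v → ⌊ ∣ T ∩ fibre v ∣ % 2 Data.Nat.≟ 1 ⌋

  toothG : Fin k → Graph
  toothG v = graph n m s t (fibre v)
    (tabulate λ e → lookup (fibre v) (s e) ∧ lookup (fibre v) (t e))

  -- T_v such that T ∩ V(G_v) = T_v Δ {r_v}
  toothT : Fin k → Fin n → Subset n
  toothT v rv = tabulate λ x → (lookup T x ∧ lookup (fibre v) x) xor ⌊ x ≟ rv ⌋

-- (mkGraph n m s t , T) is a synthesis of the comb (contractG , contractT ; A , B)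
-- and the tooth grafts (toothG v , toothT v (root v)) , v ∈ B
record Synthesis (n m : ℕ) (s t : Fin m → Fin n) (T : Subset n) : Set where
  field
    k : ℕ
    φ : Fin n → Fin k
    φ-surj : ∀ v → ∃ λ x → φ x ≡ v
    A B : Subset k
    comb : IsComb (contractG s t T φ) (contractT s t T φ) A B
    spine-single : ∀ a → a ∈ A → ∀ x y → φ x ≡ a → φ y ≡ a → x ≡ y
    root : Fin k → Fin n
    Av Bv : Fin k → Subset n
    root-in : ∀ v → v ∈ B → φ (root v) ≡ v
    tooth-bip : ∀ v → v ∈ B → IsBipartition (toothG s t T φ v) (Av v) (Bv v)
    root-A : ∀ v → v ∈ B → root v ∈ Av v
    tooth-primal : ∀ v → v ∈ B → Primal (toothG s t T φ v) (toothT s t T φ v (root v)) (root v)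
    boundary : ∀ v → v ∈ B → ∀ e →
      (e ∈ δ (mkGraph n m s t) (fibre s t T φ v)
        ⇔ ((φ (s e) ∈ A × InA (toothG s t T φ v) (toothT s t T φ v (root v)) (root v) (t e))
          ⊎ (φ (t e) ∈ A × InA (toothG s t T φ v) (toothT s t T φ v (root v)) (root v) (s e))))
open Synthesis public

{-# OPTIONS --safe #-}

module Submission where

open import Defs hiding (k; φ; φ-surj; A; B; comb; spine-single; root; Av; Bv; root-in; tooth-bip; root-A; tooth-primal; boundary)
open import Algebra.Bundles using (CommutativeRing)
import Algebra.Properties.Semiring.Sum as SemiringSum
open import Data.Bool using (Bool; true; false; _∧_; _∨_; _xor_; not; if_then_else_)
import Data.Bool as Bool
import Data.Bool.Properties as Boolₚ
open import Data.Empty using (⊥)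
open import Data.Fin using (Fin; zero; suc; _≟_; punchOut; punchIn; inject₁; fromℕ; toℕ)
import Data.Fin.Properties as Finₚ
open import Data.Fin.Subset using (Subset; _∈_; _∉_; _⊆_; ∣_∣; _∩_; ⊤; ⁅_⁆)
open import Data.Fin.Subset.Properties using (anySubset?; ∈⊤; x∈p∩q⁺; x∈p∩q⁻; x∈⁅x⁆; x∈⁅y⁆⇒x≡y)
open import Data.Integer as ℤ using (ℤ; -[1+_])
import Data.Integer.Properties as ℤₚ
open import Data.List using (List; []; _∷_; allFin)
open import Data.List.Membership.Propositional using () renaming (_∈_ to _∈ˡ_)
open import Data.List.Membership.Propositional.Properties using (∈-allFin)
open import Data.List.Relation.Unary.All as All using (All; []; _∷_)
open import Data.List.Relation.Unary.Any using (here; there)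
open import Data.Nat using (ℕ; zero; suc; _+_; _%_; _≤_; _<_; z≤n; s≤s; s≤s⁻¹)
import Data.Nat as ℕ
import Data.Nat.Properties as ℕₚ
open import Data.Product using (Σ; _×_; ∃; _,_; proj₁; proj₂)
open import Data.Sum using (_⊎_; inj₁; inj₂; [_,_]′)
open import Data.Vec using ([]; _∷_; tabulate; lookup)
open import Data.Vec.Properties using (lookup∘tabulate; lookup⇒[]=; []=⇒lookup; lookup-zipWith)
open import Function using (_∘_; id)
open import Function.Bundles using (_⇔_; mk⇔; Equivalence)
open import Relation.Binary.Construct.Closure.ReflexiveTransitive as Star using (Star; ε; _◅_; _◅◅_)
open import Relation.Binary.Definitions using (tri<; tri≈; tri>)
open import Relation.Binary.PropositionalEquality
  using (_≡_; _≢_; _≗_; refl; sym; trans; cong; cong₂; subst; subst₂; module ≡-Reasoning)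
open import Relation.Nullary using (Dec; yes; no; ¬_; contradiction)
open import Relation.Nullary.Decidable using (⌊_⌋; _×-dec_; _→-dec_)

-- Put S = T △ {r} and let p x be the least size of a join of S △ {x}.  Up to a constant p x is λ(r, x), so
-- (G, T) is primal with respect to r iff r maximises p, and p changes by exactly 1 along every edge.
-- The engine is an exchange argument: for an even vertex set Y, if some join of S △ Y △ {x} is smaller than p x,
-- then the same holds at every neighbour of x, unless a small pair of joins of S △ Y △ {b} and S △ {b} with b ∈ Y
-- turns up (Move.low-step).  Hence no join of S △ X with X an odd set of maximisers is smaller than p r
-- (Top.odd-top).
-- Given a primal graft, let the teeth be the components of {p < p r}.  Applying the exchange argument to the ends
-- of boundary edges, a minimum join of S △ {x} leaves the tooth of x by no edge and every other tooth by one
-- edge, which makes the contraction a primal comb and the teeth primal grafts.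
-- Conversely, a join of (G, T) meets every tooth boundary oddly, so by odd-top inside the teeth it has at least
-- as many edges as a minimum join of the skeleton glued to minimum joins of the teeth; gluing is possible for
-- every x.

-- The potential `p` compares only joins whose terminal sets differ from S in one vertex, whereas
-- cutting a join at tooth boundaries creates several extra terminals. Two levels occur. At level M
-- = p r all walks are allowed, and connectedness gives the statement about odd sets of maximisers.
-- At level M - 1 the walks stay inside one tooth, and the statement at level M supplies the pair
-- bounds. Since `p` changes by exactly 1 along an edge, every edge leaving a tooth runs from level
-- M - 1 to level M. The boundary ends therefore maximise `p` within the tooth and can serve as
-- roots. On a tooth, `p` is the tooth's own potential plus a constant, so A(r_v) is the set of its
-- vertices of level M - 1. For the skeleton the number of teeth is a lower bound by parity alone;
-- attaining it is the comb condition.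

module ⊕ = SemiringSum (CommutativeRing.semiring Boolₚ.xor-∧-commutativeRing)
module Nat = SemiringSum ℕₚ.+-*-semiring

-- Boolean identities by evaluation

BoolFun : ℕ → Set
BoolFun zero = Bool
BoolFun (suc k) = Bool → BoolFun k

_≗[_]_ : ∀ {k} → BoolFun k → (l : ℕ) → BoolFun k → Set
_≗[_]_ {zero} f l g = f ≡ g
_≗[_]_ {suc k} f l g = ∀ b → f b ≗[ l ] g b

agree : ∀ k → BoolFun k → BoolFun k → Bool
agree zero f g = not (f xor g)
agree (suc k) f g = agree k (f true) (g true) ∧ agree k (f false) (g false)

truthTable : ∀ k (f g : BoolFun k) → agree k f g ≡ true → f ≗[ k ] g
truthTable zero true true eq = refl
truthTable zero false false eq = refl
truthTable (suc k) f g eq true with agree k (f true) (g true) in eq₁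
... | true = truthTable k (f true) (g true) eq₁
truthTable (suc k) f g eq false with agree k (f true) (g true)
... | true = truthTable k (f false) (g false) eq

-- Vertex and edge sets as Boolean masks

Mask : ℕ → Set
Mask k = Fin k → Bool

private
  variable
    κ : ℕ

true≢false : ∀ {b} → b ≡ true → b ≢ false
true≢false refl ()

¬true⇒false : ∀ {b} → b ≢ true → b ≡ false
¬true⇒false {true} b≢t = contradiction refl b≢t
¬true⇒false {false} _ = refl

∧-true : ∀ {a b} → a ∧ b ≡ true → a ≡ true × b ≡ true
∧-true {true} {true} _ = refl , refl

xor-true : ∀ {a b} → a xor b ≡ true → (a ≡ true × b ≡ false) ⊎ (a ≡ false × b ≡ true)
xor-true {true} {false} _ = inj₁ (refl , refl)
xor-true {false} {true} _ = inj₂ (refl , refl)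

⌊⌋-true : ∀ {P : Set} (P? : Dec P) → ⌊ P? ⌋ ≡ true → P
⌊⌋-true (yes p) _ = p

dec⇒⌊⌋ : ∀ {P : Set} (P? : Dec P) → P → ⌊ P? ⌋ ≡ true
dec⇒⌊⌋ (yes _) _ = refl
dec⇒⌊⌋ (no ¬p) p = contradiction p ¬p

¬⇒⌊⌋ : ∀ {P : Set} (P? : Dec P) → ¬ P → ⌊ P? ⌋ ≡ false
¬⇒⌊⌋ (yes p) ¬p = contradiction p ¬p
¬⇒⌊⌋ (no _) _ = refl

infixl 6 _△_
infixl 7 _⊓_

_△_ _⊓_ : Mask κ → Mask κ → Mask κ
(f △ g) i = f i xor g i
(f ⊓ g) i = f i ∧ g i

at : Fin κ → Mask κ
at i j = ⌊ i ≟ j ⌋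

at-refl : (i : Fin κ) → at i i ≡ true
at-refl i = dec⇒⌊⌋ (i ≟ i) refl

at-≢ : {i j : Fin κ} → i ≢ j → at i j ≡ false
at-≢ {i = i} {j} i≢j = ¬⇒⌊⌋ (i ≟ j) i≢j

at-true : {i j : Fin κ} → at i j ≡ true → i ≡ j
at-true {i = i} {j} = ⌊⌋-true (i ≟ j)

at-suc : (i j : Fin κ) → at (suc i) (suc j) ≡ at i j
at-suc i j with i ≟ j
... | yes _ = refl
... | no _ = refl

△-at-true : (f : Mask κ) (z : Fin κ) {i : Fin κ} → f i xor at z i ≡ true → f i ≡ true ⊎ z ≡ i
△-at-true f z {i} eq with f i | at z i in zi
... | true | _ = inj₁ refl
... | false | true = inj₂ (at-true zi)

at-sym : (i j : Fin κ) → at i j ≡ at j i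
at-sym i j with i ≟ j
... | yes refl = sym (at-refl i)
... | no i≢j = sym (at-≢ (i≢j ∘ sym))

_⊑_ : Mask κ → Mask κ → Set
f ⊑ g = ∀ i → f i ≡ true → g i ≡ true

-- Cardinality and parity of masks

infix 8 #_

b2n : Bool → ℕ
b2n b = if b then 1 else 0

odd : ℕ → Bool
odd zero = false
odd (suc j) = not (odd j)

odd-%2 : ∀ j → odd j ≡ ⌊ j % 2 ℕ.≟ 1 ⌋
odd-%2 zero = refl
odd-%2 (suc zero) = refl
odd-%2 (suc (suc j)) = trans (Boolₚ.not-involutive (odd j)) (odd-%2 j)

IsOdd⇔odd : ∀ j → IsOdd j ⇔ odd j ≡ true
IsOdd⇔odd j = mk⇔ (λ p → trans (odd-%2 j) (dec⇒⌊⌋ (j % 2 ℕ.≟ 1) p)) (λ p → ⌊⌋-true (j % 2 ℕ.≟ 1) (trans (sym (odd-%2 j)) p))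

odd-+ : ∀ i j → odd (i + j) ≡ odd i xor odd j
odd-+ zero j = refl
odd-+ (suc i) j = trans (cong not (odd-+ i j)) (Boolₚ.not-distribˡ-xor (odd i) (odd j))

opaque

  -- Sum over the two-element field: parity statements become linear algebra, with additivity,
  -- scalars and interchange of sums inherited from the ring.
  ⨁ : Mask κ → Bool
  ⨁ = ⊕.sum

  ∑ : (Fin κ → ℕ) → ℕ
  ∑ = Nat.sum

  #_ : Mask κ → ℕ
  # f = ∑ (b2n ∘ f)

  ⨁-zero : (f : Mask 0) → ⨁ f ≡ false
  ⨁-zero f = refl

  ⨁-suc : (f : Mask (suc κ)) → ⨁ f ≡ f zero xor ⨁ (f ∘ suc)
  ⨁-suc f = refl

  ⨁-cong : {f g : Mask κ} → f ≗ g → ⨁ f ≡ ⨁ g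
  ⨁-cong = ⊕.sum-cong-≗

  ⨁-xor : (f g : Mask κ) → ⨁ (f △ g) ≡ ⨁ f xor ⨁ g
  ⨁-xor = ⊕.∑-distrib-+

  ⨁-∧ : ∀ b (f : Mask κ) → b ∧ ⨁ f ≡ ⨁ (λ i → b ∧ f i)
  ⨁-∧ = ⊕.*-distribˡ-sum

  ⨁-comm : ∀ {κ′} (f : Fin κ → Fin κ′ → Bool) → ⨁ (λ i → ⨁ (f i)) ≡ ⨁ (λ j → ⨁ (λ i → f i j))
  ⨁-comm f = ⊕.∑-comm f

  ∑-cong : {f g : Fin κ → ℕ} → f ≗ g → ∑ f ≡ ∑ g
  ∑-cong = Nat.sum-cong-≗

  ∑-# : ∀ {κ′} (f : Fin κ → Mask κ′) → ∑ (λ i → # (f i)) ≡ ∑ (λ j → # (λ i → f i j))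
  ∑-# f = Nat.∑-comm (λ i j → b2n (f i j))

  #-def : (f : Mask κ) → # f ≡ ∑ (b2n ∘ f)
  #-def f = refl

  #-cong : {f g : Mask κ} → f ≗ g → # f ≡ # g
  #-cong f≗g = Nat.sum-cong-≗ (cong b2n ∘ f≗g)

  odd-# : (f : Mask κ) → odd (# f) ≡ ⨁ f
  odd-# {zero} f = refl
  odd-# {suc k} f = trans (odd-+ (b2n (f zero)) _) (cong₂ _xor_ (lemma (f zero)) (odd-# (f ∘ suc)))
    where
    lemma : ∀ b → odd (b2n b) ≡ b
    lemma true = refl
    lemma false = refl

  ∣∣≡# : (p : Subset κ) → ∣ p ∣ ≡ # (lookup p)
  ∣∣≡# [] = refl
  ∣∣≡# (true ∷ p) = cong suc (∣∣≡# p)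
  ∣∣≡# (false ∷ p) = ∣∣≡# p

  ⊕-at : (x : Fin κ) (f : Mask κ) → ⨁ (at x ⊓ f) ≡ f x
  ⊕-at {suc k} zero f = trans (cong (f zero xor_) (⊕.sum-replicate-zero k)) (Boolₚ.xor-identityʳ _)
  ⊕-at (suc x) f = trans (⊕.sum-cong-≗ (λ i → cong (_∧ f (suc i)) (at-suc x i))) (⊕-at x (f ∘ suc))

  #-at : (x : Fin κ) (f : Mask κ) → # (at x ⊓ f) ≡ b2n (f x)
  #-at {suc k} zero f = trans (cong (b2n (f zero) +_) (Nat.sum-replicate-zero k)) (ℕₚ.+-identityʳ _)
  #-at (suc x) f = trans (#-cong (λ i → cong (_∧ f (suc i)) (at-suc x i))) (#-at x (f ∘ suc))

  #-remove : (f : Mask κ) (x : Fin κ) → f x ≡ true → # f ≡ suc (# (f △ at x))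
  #-remove f zero fx rewrite fx = cong suc (#-cong (λ i → sym (Boolₚ.xor-identityʳ (f (suc i)))))
  #-remove f (suc x) fx = trans (cong (b2n (f zero) +_) (#-remove (f ∘ suc) x fx))
    (trans (ℕₚ.+-suc _ _) (cong suc (cong₂ _+_ (cong b2n (sym (Boolₚ.xor-identityʳ (f zero))))
      (#-cong (λ i → cong (f (suc i) xor_) (sym (at-suc x i)))))))

  #-add : (f : Mask κ) (x : Fin κ) → f x ≡ false → # (f △ at x) ≡ suc (# f)
  #-add f x fx = trans (#-remove (f △ at x) x (cong₂ _xor_ fx (at-refl x)))
    (cong suc (#-cong (λ i → truthTable 2 (λ a b → (a xor b) xor b) (λ a b → a) refl (f i) (at x i))))

  #-toggle-≤ : (f : Mask κ) (x : Fin κ) → # (f △ at x) ≤ suc (# f)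
  #-toggle-≤ f x with f x in fx
  ... | true = ℕₚ.≤-trans (ℕₚ.≤-trans (ℕₚ.n≤1+n _) (ℕₚ.≤-reflexive (sym (#-remove f x fx)))) (ℕₚ.n≤1+n _)
  ... | false = ℕₚ.≤-reflexive (#-add f x fx)

  #-mono : {f g : Mask κ} → f ⊑ g → # f ≤ # g
  #-mono {zero} f⊑g = z≤n
  #-mono {suc k} {f} {g} f⊑g = ℕₚ.+-mono-≤ (lemma (f zero) (g zero) (f⊑g zero)) (#-mono (f⊑g ∘ suc))
    where
    lemma : ∀ a b → (a ≡ true → b ≡ true) → b2n a ≤ b2n b
    lemma false b _ = z≤n
    lemma true b h rewrite h refl = s≤s z≤n

  -- Each element of `h` lies in exactly one of `f` and `g`, and toggling moves it to the other. A
  -- swap of two joins conserves the sum of their sizes, not either size.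
  #-exchange : (f g h : Mask κ) → h ⊑ (f △ g) → # (f △ h) + # (g △ h) ≡ # f + # g
  #-exchange f g h h⊑ = trans (sym (Nat.∑-distrib-+ (b2n ∘ (f △ h)) (b2n ∘ (g △ h))))
    (trans (Nat.sum-cong-≗ (λ i → lemma (f i) (g i) (h i) (h⊑ i))) (Nat.∑-distrib-+ (b2n ∘ f) (b2n ∘ g)))
    where
    lemma : ∀ a b c → (c ≡ true → a xor b ≡ true) → b2n (a xor c) + b2n (b xor c) ≡ b2n a + b2n b
    lemma a b false _ = cong₂ _+_ (cong b2n (Boolₚ.xor-identityʳ a)) (cong b2n (Boolₚ.xor-identityʳ b))
    lemma true false true _ = refl
    lemma false true true _ = refl
    lemma true true true h with () ← h refl
    lemma false false true h with () ← h refl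

  #-split : (f g : Mask κ) → # f ≡ # (f ⊓ g) + # (f ⊓ (not ∘ g))
  #-split f g = trans (Nat.sum-cong-≗ (λ i → lemma (f i) (g i))) (Nat.∑-distrib-+ (b2n ∘ (f ⊓ g)) _)
    where
    lemma : ∀ a b → b2n a ≡ b2n (a ∧ b) + b2n (a ∧ not b)
    lemma true true = refl
    lemma true false = refl
    lemma false b = refl

  ⊕-true⇒∃ : (f : Mask κ) → ⨁ f ≡ true → ∃ λ i → f i ≡ true
  ⊕-true⇒∃ {suc k} f odd-f with f zero in f0
  ... | true = zero , f0
  ... | false with ⊕-true⇒∃ (f ∘ suc) odd-f
  ...   | i , fi = suc i , fi

  ⊕-false : (f : Mask κ) → (∀ i → f i ≡ false) → ⨁ f ≡ false
  ⊕-false {k} f f≗false = trans (⊕.sum-cong-≗ f≗false) (⊕.sum-replicate-zero k)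

  #-zero : (f : Mask κ) → (∀ i → f i ≡ false) → # f ≡ 0
  #-zero {k} f f≗false = trans (#-cong f≗false) (Nat.sum-replicate-zero k)

  #-zero⁻¹ : (f : Mask κ) → # f ≡ 0 → ∀ i → f i ≡ false
  #-zero⁻¹ f #f≡0 i with f i in fi
  ... | false = refl
  ... | true with () ← trans (sym #f≡0) (#-remove f i fi)

  #-odd⇒1≤ : (f : Mask κ) → ⨁ f ≡ true → 1 ≤ # f
  #-odd⇒1≤ f odd-f with # f in eq
  ... | suc _ = s≤s z≤n
  ... | zero with () ← trans (sym odd-f) (trans (sym (odd-# f)) (cong odd eq))

  #-unique : (f : Mask κ) → ⨁ f ≡ true → (∀ i j → f i ≡ true → f j ≡ true → i ≡ j) → # f ≡ 1
  #-unique f odd-f unique with ⊕-true⇒∃ f odd-f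
  ... | i , fi = trans (#-remove f i fi) (cong suc (#-zero (f △ at i) other))
    where
    other : ∀ j → (f △ at i) j ≡ false
    other j with i ≟ j
    ... | yes refl = cong (_xor true) fi
    ... | no i≢j with f j in fj
    ...   | true = contradiction (unique i j fi fj) i≢j
    ...   | false = refl

  #-1⇒unique : (f : Mask κ) → # f ≡ 1 → ∀ i j → f i ≡ true → f j ≡ true → i ≡ j
  #-1⇒unique f #f≡1 i j fi fj with i ≟ j
  ... | yes i≡j = i≡j
  ... | no i≢j = contradiction
    (#-zero⁻¹ (f △ at i) (ℕₚ.suc-injective (trans (sym (#-remove f i fi)) #f≡1)) j)
    (true≢false (cong₂ _xor_ fj (at-≢ i≢j)))

  ∑-mono : (f g : Fin κ → ℕ) → (∀ i → f i ≤ g i) → ∑ f ≤ ∑ g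
  ∑-mono {zero} f g f≤g = z≤n
  ∑-mono {suc k} f g f≤g = ℕₚ.+-mono-≤ (f≤g zero) (∑-mono (f ∘ suc) (g ∘ suc) (f≤g ∘ suc))

  ∑-mono-< : (f g : Fin κ → ℕ) → (∀ i → f i ≤ g i) → ∀ i → f i < g i → ∑ f < ∑ g
  ∑-mono-< f g f≤g zero f<g = ℕₚ.+-mono-<-≤ f<g (∑-mono (f ∘ suc) (g ∘ suc) (f≤g ∘ suc))
  ∑-mono-< f g f≤g (suc i) f<g = ℕₚ.+-mono-≤-< (f≤g zero) (∑-mono-< (f ∘ suc) (g ∘ suc) (f≤g ∘ suc) i f<g)

  ∑-tight : (f g : Fin κ → ℕ) → (∀ i → f i ≤ g i) → ∑ g ≤ ∑ f → ∀ i → f i ≡ g i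
  ∑-tight f g f≤g ∑g≤∑f i with ℕₚ.m≤n⇒m<n∨m≡n (f≤g i)
  ... | inj₁ f<g = contradiction (∑-mono-< f g f≤g i f<g) (ℕₚ.≤⇒≯ ∑g≤∑f)
  ... | inj₂ f≡g = f≡g

-- Boundaries and joins

-- The boundary map over the two-element field. A loop contributes nothing here although `incident`
-- contains it once, so the agreement with degrees in `odd-incident` rests on `loopless`.
∂ : (G : Graph) → Mask (nE G) → Mask (nV G)
∂ G F v = ⨁ λ e → F e ∧ (at (src G e) v xor at (tgt G e) v)

module _ (G : Graph) where

  ∂-cong : ∀ {F F'} → F ≗ F' → ∂ G F ≗ ∂ G F'
  ∂-cong F≗F' v = ⨁-cong λ e → cong (_∧ (at (src G e) v xor at (tgt G e) v)) (F≗F' e)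

  ∂-△ : ∀ F F' → ∂ G (F △ F') ≗ ∂ G F △ ∂ G F'
  ∂-△ F F' v = trans (⨁-cong λ e → Boolₚ.∧-distribʳ-xor (at (src G e) v xor at (tgt G e) v) (F e) (F' e))
    (⨁-xor (λ e → F e ∧ (at (src G e) v xor at (tgt G e) v)) _)

  ∂-at : ∀ e → ∂ G (at e) ≗ at (src G e) △ at (tgt G e)
  ∂-at e v = ⊕-at e (λ e → at (src G e) v xor at (tgt G e) v)

  -- Handshake count over `U`: an edge with both ends in `U` is counted twice and cancels, so only
  -- the edges leaving `U` survive.
  ∂-cut : ∀ U F → ⨁ (U ⊓ ∂ G F) ≡ ⨁ λ e → F e ∧ (U (src G e) xor U (tgt G e))
  ∂-cut U F = begin
    ⨁ (λ v → U v ∧ ∂ G F v)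
      ≡⟨ ⨁-cong (λ v → ⨁-∧ (U v) _) ⟩
    ⨁ (λ v → ⨁ λ e → U v ∧ (F e ∧ (at (src G e) v xor at (tgt G e) v)))
      ≡⟨ ⨁-comm _ ⟩
    ⨁ (λ e → ⨁ λ v → U v ∧ (F e ∧ (at (src G e) v xor at (tgt G e) v)))
      ≡⟨ ⨁-cong edge ⟩
    ⨁ (λ e → F e ∧ (U (src G e) xor U (tgt G e))) ∎
    where
    open ≡-Reasoning
    edge : ∀ e → ⨁ (λ v → U v ∧ (F e ∧ (at (src G e) v xor at (tgt G e) v)))
           ≡ F e ∧ (U (src G e) xor U (tgt G e))
    edge e = begin
      ⨁ (λ v → U v ∧ (F e ∧ (at (src G e) v xor at (tgt G e) v)))
        ≡⟨ ⨁-cong (λ v → truthTable 4 (λ u f a b → u ∧ (f ∧ (a xor b)))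
             (λ u f a b → f ∧ ((a ∧ u) xor (b ∧ u))) refl (U v) (F e) (at (src G e) v) (at (tgt G e) v)) ⟩
      ⨁ (λ v → F e ∧ ((at (src G e) v ∧ U v) xor (at (tgt G e) v ∧ U v)))
        ≡⟨ ⨁-∧ (F e) _ ⟨
      F e ∧ ⨁ (λ v → (at (src G e) v ∧ U v) xor (at (tgt G e) v ∧ U v))
        ≡⟨ cong (F e ∧_) (trans (⨁-xor (at (src G e) ⊓ U) (at (tgt G e) ⊓ U)) (cong₂ _xor_ (⊕-at (src G e) U) (⊕-at (tgt G e) U))) ⟩
      F e ∧ (U (src G e) xor U (tgt G e)) ∎

  -- The equation is imposed on the whole vertex universe, not only on `Vp`, so joins add under
  -- `_△_` without side conditions. For properly coloured graphs and terminals inside `Vp` it agrees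
  -- with `IsJoin`.
  Join : Mask (nV G) → Mask (nE G) → Set
  Join D F = F ⊑ lookup (Ep G) × ∂ G F ≗ D

  Min : Mask (nV G) → Mask (nE G) → Set
  Min D F = Join D F × ∀ F' → Join D F' → # F ≤ # F'

  join-△ : ∀ {D D' F F'} → Join D F → Join D' F' → Join (D △ D') (F △ F')
  join-△ {F = F} {F'} (F⊑ , ∂F) (F'⊑ , ∂F') = ⊑ , λ v → trans (∂-△ F F' v) (cong₂ _xor_ (∂F v) (∂F' v))
    where
    ⊑ : (F △ F') ⊑ lookup (Ep G)
    ⊑ e eq with xor-true {F e} eq
    ... | inj₁ (Fe , _) = F⊑ e Fe
    ... | inj₂ (_ , F'e) = F'⊑ e F'e

  join-at : ∀ e → lookup (Ep G) e ≡ true → Join (at (src G e) △ at (tgt G e)) (at e)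
  join-at e Ee = (λ i ei → subst (λ i → lookup (Ep G) i ≡ true) (at-true ei) Ee) , ∂-at e

  join-≗ : ∀ {D D' F} → D ≗ D' → Join D F → Join D' F
  join-≗ D≗D' (F⊑ , ∂F) = F⊑ , λ v → trans (∂F v) (D≗D' v)

  min-≗ : ∀ {D D' F} → D ≗ D' → Min D F → Min D' F
  min-≗ D≗D' (j , min) = join-≗ D≗D' j , λ F' j' → min F' (join-≗ (sym ∘ D≗D') j')

  min-size : ∀ {D F F'} → Min D F → Min D F' → # F ≡ # F'
  min-size (j , min) (j' , min') = ℕₚ.≤-antisym (min _ j') (min' _ j)

  join? : ∀ D F → Dec (Join D F)
  join? D F = Finₚ.all? (λ e → (F e Bool.≟ true) →-dec (lookup (Ep G) e Bool.≟ true))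
    ×-dec Finₚ.all? (λ v → ∂ G F v Bool.≟ D v)

  join-tabulate : ∀ {D F} → Join D F → Join D (lookup (tabulate F))
  join-tabulate {F = F} (F⊑ , ∂F) = (λ e eq → F⊑ e (trans (sym (lookup∘tabulate F e)) eq))
    , λ v → trans (∂-cong (lookup∘tabulate F) v) (∂F v)

  -- Descent on the size, bounded by `b`. The search for a smaller join runs over `Subset`, whence
  -- the passage through `tabulate`.
  minimize : ∀ {D F} → Join D F → ∃ (Min D)
  minimize {D} {F} j = go (# F) F ℕₚ.≤-refl j
    where
    go : ∀ b F → # F ≤ b → Join D F → ∃ (Min D)
    go b F F≤b j with anySubset? (λ F' → join? D (lookup F') ×-dec (# (lookup F') ℕ.<? # F))
    go b F F≤b j | no ¬smaller = F , j , λ F' j' → ℕₚ.≮⇒≥ λ F'<F →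
      ¬smaller (tabulate F' , join-tabulate j' ,
        subst (ℕ._< # F) (#-cong (λ i → sym (lookup∘tabulate F' i))) F'<F)
    go zero F F≤b j | yes (F' , j' , F'<F) with () ← ℕₚ.≤-trans F'<F F≤b
    go (suc b) F F≤b j | yes (F' , j' , F'<F) =
      go b (lookup F') (s≤s⁻¹ (ℕₚ.≤-trans F'<F F≤b)) j'

  -- Paths and their edge sets

  Link : Fin (nE G) → Fin (nV G) → Fin (nV G) → Set
  Link e x y = (src G e ≡ x × tgt G e ≡ y) ⊎ (src G e ≡ y × tgt G e ≡ x)

  link-sym : ∀ {e x y} → Link e x y → Link e y x
  link-sym (inj₁ (p , q)) = inj₂ (p , q)
  link-sym (inj₂ (p , q)) = inj₁ (p , q)

  link-at : ∀ {e x y} → Link e x y → at (src G e) △ at (tgt G e) ≗ at x △ at y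
  link-at (inj₁ (refl , refl)) v = refl
  link-at (inj₂ (refl , refl)) v = Boolₚ.xor-comm (at (src G _) v) (at (tgt G _) v)

  join-link : ∀ {e x y} → lookup (Ep G) e ≡ true → Link e x y → Join (at x △ at y) (at e)
  join-link {e} Ee link = join-≗ (link-at link) (join-at e Ee)

  -- A sum of indicators, so that its boundary telescopes along a path. A repeated edge would
  -- cancel; `es-injective` excludes this where sizes matter.
  maskOf : ∀ {l} → (Fin l → Fin (nE G)) → Mask (nE G)
  maskOf es e = ⨁ λ i → at (es i) e

  maskOf-true : ∀ {l} (es : Fin l → Fin (nE G)) e → maskOf es e ≡ true → ∃ λ i → es i ≡ e
  maskOf-true es e eq with ⊕-true⇒∃ (λ i → at (es i) e) eq
  ... | i , ati = i , at-true ati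

  ∂-maskOf : ∀ {l} (es : Fin l → Fin (nE G)) v
    → ∂ G (maskOf es) v ≡ ⨁ λ i → at (src G (es i)) v xor at (tgt G (es i)) v
  ∂-maskOf es v = begin
    ⨁ (λ e → ⨁ (λ i → at (es i) e) ∧ c e)        ≡⟨ ⨁-cong (λ e → Boolₚ.∧-comm (maskOf es e) (c e)) ⟩
    ⨁ (λ e → c e ∧ ⨁ (λ i → at (es i) e))        ≡⟨ ⨁-cong (λ e → ⨁-∧ (c e) (λ i → at (es i) e)) ⟩
    ⨁ (λ e → ⨁ (λ i → c e ∧ at (es i) e))        ≡⟨ ⨁-comm (λ e i → c e ∧ at (es i) e) ⟩
    ⨁ (λ i → ⨁ (λ e → c e ∧ at (es i) e))        ≡⟨ ⨁-cong (λ i → ⨁-cong (λ e → Boolₚ.∧-comm (c e) (at (es i) e))) ⟩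
    ⨁ (λ i → ⨁ (at (es i) ⊓ c))                  ≡⟨ ⨁-cong (λ i → ⊕-at (es i) c) ⟩
    ⨁ (c ∘ es)                                   ∎
    where
    open ≡-Reasoning
    c : Mask (nE G)
    c e = at (src G e) v xor at (tgt G e) v

  telescope : ∀ l (vs : Fin (suc l) → Fin (nV G)) v
    → ⨁ (λ i → at (vs (inject₁ i)) v xor at (vs (suc i)) v) ≡ at (vs zero) v xor at (vs (fromℕ l)) v
  telescope zero vs v = trans (⨁-zero _) (sym (Boolₚ.xor-same (at (vs zero) v)))
  telescope (suc l) vs v = trans (⨁-suc _) (trans
    (cong ((at (vs zero) v xor at (vs (suc zero)) v) xor_) (telescope l (vs ∘ suc) v))
    (truthTable 3 (λ a b c → (a xor b) xor (b xor c)) (λ a b c → a xor c) refl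
      (at (vs zero) v) (at (vs (suc zero)) v) (at (vs (fromℕ (suc l))) v)))

  sign : Bool → ℤ
  sign b = if b then -[1+ 0 ] else ℤ.+ 1

  #-maskOf : ∀ {l} F (es : Fin l → Fin (nE G)) → (∀ i j → es i ≡ es j → i ≡ j)
    → ℤ.+ (# (F △ maskOf es)) ≡ ℤ.+ (# F) ℤ.+ sumFin (λ i → sign (F (es i)))
  #-maskOf {zero} F es inj = trans (cong ℤ.+_ (#-cong (λ e → trans (cong (F e xor_) (⨁-zero _)) (Boolₚ.xor-identityʳ (F e))))) (sym (ℤₚ.+-identityʳ _))
  #-maskOf {suc l} F es inj = begin
    ℤ.+ (# (F △ maskOf es))
      ≡⟨ cong ℤ.+_ (#-cong (λ e → trans (cong (F e xor_) (⨁-suc (λ i → at (es i) e)))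
          (truthTable 3 (λ f a b → f xor (a xor b)) (λ f a b → (f xor b) xor a) refl
            (F e) (at (es zero) e) (maskOf (es ∘ suc) e)))) ⟩
    ℤ.+ (# (F' △ at (es zero)))
      ≡⟨ toggle (F (es zero)) F'0 ⟩
    ℤ.+ (# F') ℤ.+ sign (F (es zero))
      ≡⟨ cong (ℤ._+ _) (#-maskOf F (es ∘ suc) (λ i j eq → Finₚ.suc-injective (inj _ _ eq))) ⟩
    (ℤ.+ (# F) ℤ.+ rest) ℤ.+ sign (F (es zero))
      ≡⟨ trans (ℤₚ.+-assoc (ℤ.+ (# F)) rest _) (cong (ℤ._+_ (ℤ.+ (# F))) (ℤₚ.+-comm rest _)) ⟩
    ℤ.+ (# F) ℤ.+ (sign (F (es zero)) ℤ.+ rest) ∎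
    where
    open ≡-Reasoning
    F' = F △ maskOf (es ∘ suc)
    rest = sumFin (λ i → sign (F (es (suc i))))
    F'0 : F' (es zero) ≡ F (es zero)
    F'0 = trans (cong (F (es zero) xor_) (⊕-false (λ i → at (es (suc i)) (es zero)) (λ i → at-≢ λ eq → Finₚ.0≢1+n (sym (inj _ _ eq)))))
      (Boolₚ.xor-identityʳ _)
    toggle : ∀ b → F' (es zero) ≡ b → ℤ.+ (# (F' △ at (es zero))) ≡ ℤ.+ (# F') ℤ.+ sign b
    toggle true eq rewrite #-remove F' (es zero) eq = refl
    toggle false eq rewrite #-add F' (es zero) eq = cong ℤ.+_ (ℕₚ.+-comm 1 (# F'))

  es-injective : ∀ {x y} (P : Path G x y) → ∀ i j → es P i ≡ es P j → i ≡ j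
  es-injective P i j eq = go (link P i) (subst (λ e → Link e _ _) (sym eq) (link P j))
    where
    same : ∀ {i j} → vs P (inject₁ i) ≡ vs P (inject₁ j) → i ≡ j
    same eq = Finₚ.inject₁-injective (distinct P _ _ eq)
    -- The same edge traversed in opposite directions would force both `i` = `j` + 1 and `j` = `i` +
    -- 1.
    cross : ∀ {i j} → vs P (inject₁ i) ≡ vs P (suc j) → vs P (suc i) ≡ vs P (inject₁ j) → i ≡ j
    cross {i} {j} p q = contradiction
      (trans (sym (trans (cong toℕ (distinct P _ _ q)) (Finₚ.toℕ-inject₁ j)))
             (cong suc (trans (sym (Finₚ.toℕ-inject₁ i)) (cong toℕ (distinct P _ _ p)))))
      (ℕₚ.<⇒≢ (ℕₚ.m≤n⇒m≤1+n (ℕₚ.n<1+n (toℕ j))))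
    go : ∀ {e} → Link e (vs P (inject₁ i)) (vs P (suc i)) → Link e (vs P (inject₁ j)) (vs P (suc j)) → i ≡ j
    go (inj₁ (p , q)) (inj₁ (p' , q')) = same (trans (sym p) p')
    go (inj₁ (p , q)) (inj₂ (p' , q')) = cross (trans (sym p) p') (trans (sym q) q')
    go (inj₂ (p , q)) (inj₁ (p' , q')) = cross (trans (sym q) q') (trans (sym p) p')
    go (inj₂ (p , q)) (inj₂ (p' , q')) = same (trans (sym q) q')

  pathMask : ∀ {x y} → Path G x y → Mask (nE G)
  pathMask P = maskOf (es P)

  join-path : ∀ {x y} (P : Path G x y) → Join (at x △ at y) (pathMask P)
  join-path {x} {y} P = ⊑ , boundary'
    where
    ⊑ : pathMask P ⊑ lookup (Ep G)
    ⊑ e eq with maskOf-true (es P) e eq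
    ... | i , refl = []=⇒lookup (eIn P i)
    boundary' : ∂ G (pathMask P) ≗ at x △ at y
    boundary' v = trans (∂-maskOf (es P) v) (trans (⨁-cong (λ i → link-at (link P i) v))
      (trans (telescope (len P) (vs P) v) (cong₂ (λ a b → at a v xor at b v) (start P) (end P))))

  -- Toggling an edge of `F` lowers the size by 1 and toggling any other edge raises it by 1, which
  -- is the weight of that edge. This turns λ into a comparison of join sizes.
  #-path : ∀ {x y} F (P : Path G x y)
    → ℤ.+ (# (lookup F △ pathMask P)) ≡ ℤ.+ (# (lookup F)) ℤ.+ weight F P
  #-path F P = #-maskOf (lookup F) (es P) (es-injective P)

  PathIn : Mask (nE G) → Fin (nV G) → Fin (nV G) → Set
  PathIn F x y = Σ (Path G x y) λ P → ∀ i → F (es P i) ≡ true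

  trivialPath : ∀ F {x} → lookup (Vp G) x ≡ true → PathIn F x x
  trivialPath F {x} Vx = record
    { len = 0 ; vs = λ _ → x ; es = λ () ; start = refl ; end = refl
    ; vIn = λ _ → lookup⇒[]= x (Vp G) Vx ; eIn = λ () ; link = λ ()
    ; distinct = λ { zero zero _ → refl } } , λ ()

  pathSuffix : ∀ F {x y} (P : PathIn F x y) i → PathIn F (vs (proj₁ P) i) y
  pathSuffix F (P , P⊑) zero = record
    { len = len P ; vs = vs P ; es = es P ; start = refl ; end = end P ; vIn = vIn P
    ; eIn = eIn P ; link = link P ; distinct = distinct P } , P⊑
  pathSuffix F (record { len = suc l ; vs = vs ; es = es ; end = end ; vIn = vIn ; eIn = eIn
    ; link = link ; distinct = distinct } , P⊑) (suc i) = pathSuffix F (record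
    { len = l ; vs = vs ∘ suc ; es = es ∘ suc ; start = refl ; end = end ; vIn = vIn ∘ suc
    ; eIn = eIn ∘ suc ; link = link ∘ suc
    ; distinct = λ i j eq → Finₚ.suc-injective (distinct (suc i) (suc j) eq) } , P⊑ ∘ suc) i

  -- If `x` already lies on the path, its suffix from `x` is taken and `e` is dropped; this keeps
  -- the path simple.
  pathCons : ∀ F {x z y e} → lookup (Vp G) x ≡ true → lookup (Ep G) e ≡ true → F e ≡ true → Link e x z
    → PathIn F z y → PathIn F x y
  pathCons F {x} {z} {y} {e} Vx Ee Fe e-link (P , P⊑) with Finₚ.any? (λ i → vs P i ≟ x)
  ... | yes (i , refl) = pathSuffix F (P , P⊑) i
  ... | no x∉P = record
    { len = suc (len P) ; vs = vs' ; es = es' ; start = refl ; end = end P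
    ; vIn = λ { zero → lookup⇒[]= x (Vp G) Vx ; (suc i) → vIn P i }
    ; eIn = λ { zero → lookup⇒[]= e (Ep G) Ee ; (suc i) → eIn P i }
    ; link = λ { zero → subst (Link e x) (sym (start P)) e-link ; (suc i) → link P i }
    ; distinct = distinct' } , λ { zero → Fe ; (suc i) → P⊑ i }
    where
    vs' : Fin (suc (suc (len P))) → Fin (nV G)
    vs' zero = x
    vs' (suc i) = vs P i
    es' : Fin (suc (len P)) → Fin (nE G)
    es' zero = e
    es' (suc i) = es P i
    distinct' : ∀ i j → vs' i ≡ vs' j → i ≡ j
    distinct' zero zero _ = refl
    distinct' zero (suc j) eq = contradiction (j , sym eq) x∉P
    distinct' (suc i) zero eq = contradiction (i , eq) x∉P
    distinct' (suc i) (suc j) eq = cong suc (distinct P i j eq)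

  pathIn-mono : ∀ {F F' x y} → F ⊑ F' → PathIn F x y → PathIn F' x y
  pathIn-mono F⊑F' (P , P⊑) = P , λ i → F⊑F' _ (P⊑ i)

-- Properly coloured graphs: path extraction, and λ as a difference of join sizes

-- What the exchange arguments use of a bipartition: a colouring that changes along every edge,
-- which excludes loops and fixes the parity of join sizes, and edges that stay inside the masked
-- vertex set.
record Proper (G : Graph) : Set where
  field
    colour : Mask (nV G)
    bichromatic : ∀ e → lookup (Ep G) e ≡ true → colour (src G e) xor colour (tgt G e) ≡ true
    ends : ∀ e → lookup (Ep G) e ≡ true → lookup (Vp G) (src G e) ≡ true × lookup (Vp G) (tgt G e) ≡ true

module _ (G : Graph) (proper : Proper G) where
  open Proper proper

  loopless : ∀ e → lookup (Ep G) e ≡ true → src G e ≢ tgt G e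
  loopless e Ee eq with () ← trans (sym (bichromatic e Ee)) (trans (cong (λ x → colour x xor colour (tgt G e)) eq) (Boolₚ.xor-same (colour (tgt G e))))

  link-V : ∀ {e x y} → lookup (Ep G) e ≡ true → Link G e x y → lookup (Vp G) x ≡ true × lookup (Vp G) y ≡ true
  link-V {e} Ee (inj₁ (refl , refl)) = ends e Ee
  link-V {e} Ee (inj₂ (refl , refl)) = proj₂ (ends e Ee) , proj₁ (ends e Ee)

  link-≢ : ∀ {e x y} → lookup (Ep G) e ≡ true → Link G e x y → x ≢ y
  link-≢ {e} Ee (inj₁ (refl , refl)) = loopless e Ee
  link-≢ {e} Ee (inj₂ (refl , refl)) = loopless e Ee ∘ sym

  ∂-true⇒link : ∀ F x → ∂ G F x ≡ true → ∃ λ e → F e ≡ true × ∃ (Link G e x)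
  ∂-true⇒link F x eq with ⊕-true⇒∃ (λ e → F e ∧ (at (src G e) x xor at (tgt G e) x)) eq
  ... | e , eq' with ∧-true {F e} eq'
  ...   | Fe , inc with xor-true {at (src G e) x} inc
  ...     | inj₁ (s≡x , _) = e , Fe , tgt G e , inj₁ (at-true s≡x , refl)
  ...     | inj₂ (_ , t≡x) = e , Fe , src G e , inj₂ (refl , at-true t≡x)

  -- Leave `x` along an edge of `F` and delete it. If its other end `z` is in `D`, the path is
  -- complete; otherwise the smaller mask has odd degree at `z` and the search continues there. Its
  -- boundary differs from `D` only at `x`, now even, and at `z`, so the vertex found later is in
  -- `D` and is not `x`.
  extractPath : ∀ F D x → F ⊑ lookup (Ep G) → ∂ G F ≗ D → D x ≡ true
    → ∃ λ y → y ≢ x × D y ≡ true × PathIn G F x y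
  extractPath F D x F⊑E ∂F Dx = go (# F) F D x ℕₚ.≤-refl F⊑E ∂F Dx
    where
    go : ∀ b F D x → # F ≤ b → F ⊑ lookup (Ep G) → ∂ G F ≗ D → D x ≡ true
      → ∃ λ y → y ≢ x × D y ≡ true × PathIn G F x y
    go b F D x F≤b F⊑E ∂F Dx with ∂-true⇒link F x (trans (∂F x) Dx)
    ... | e , Fe , z , e-link with D z in Dz
    ...   | true = z , link-≢ (F⊑E e Fe) e-link ∘ sym , Dz
          , pathCons G F (proj₁ V) (F⊑E e Fe) Fe e-link (trivialPath G F (proj₂ V))
      where V = link-V (F⊑E e Fe) e-link
    go zero F D x F≤b F⊑E ∂F Dx | e , Fe , z , e-link | false
      with () ← ℕₚ.≤-trans (ℕₚ.≤-reflexive (sym (#-remove F e Fe))) F≤b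
    go (suc b) F D x F≤b F⊑E ∂F Dx | e , Fe , z , e-link | false = extend
      (go b F' D' z (s≤s⁻¹ (ℕₚ.≤-trans (ℕₚ.≤-reflexive (sym (#-remove F e Fe))) F≤b)) (λ i eq → F⊑E i (F'⊑F i eq)) ∂F' D'z)
      where
      x≢z : x ≢ z
      x≢z = link-≢ (F⊑E e Fe) e-link
      F' = F △ at e
      D' = D △ (at x △ at z)
      F'⊑F : F' ⊑ F
      F'⊑F i eq with xor-true {F i} eq
      ... | inj₁ (Fi , _) = Fi
      ... | inj₂ (_ , e≡i) = subst (λ i → F i ≡ true) (at-true e≡i) Fe
      ∂F' : ∂ G F' ≗ D'
      ∂F' v = trans (∂-△ G F (at e) v) (cong₂ _xor_ (∂F v) (trans (∂-at G e v) (link-at G e-link v)))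
      D'z : D' z ≡ true
      D'z = cong₂ _xor_ Dz (cong₂ _xor_ (at-≢ x≢z) (at-refl z))
      extend : (∃ λ y → y ≢ z × D' y ≡ true × PathIn G F' z y) → ∃ λ y → y ≢ x × D y ≡ true × PathIn G F x y
      extend (y , y≢z , D'y , P) = y , y≢x , Dy
        , pathCons G F (proj₁ (link-V (F⊑E e Fe) e-link)) (F⊑E e Fe) Fe e-link (pathIn-mono G F'⊑F P)
        where
        D'y' : D y xor at x y ≡ true
        D'y' = trans (cong (D y xor_) (trans (sym (Boolₚ.xor-identityʳ (at x y)))
          (cong (at x y xor_) (sym (at-≢ (y≢z ∘ sym)))))) D'y
        y≢x : y ≢ x
        y≢x refl with () ← trans (sym D'y') (cong₂ _xor_ Dx (at-refl x))
        Dy : D y ≡ true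
        Dy = trans (trans (sym (Boolₚ.xor-identityʳ (D y))) (cong (D y xor_) (sym (at-≢ (y≢x ∘ sym))))) D'y'

  pathBetween : ∀ F x y → F ⊑ lookup (Ep G) → ∂ G F ≗ at x △ at y → lookup (Vp G) x ≡ true → PathIn G F x y
  pathBetween F x y F⊑E ∂F Vx with x ≟ y
  ... | yes refl = trivialPath G F Vx
  ... | no x≢y with extractPath F (at x △ at y) x F⊑E ∂F (cong₂ _xor_ (at-refl x) (at-≢ (x≢y ∘ sym)))
  ...   | z , z≢x , Dz , P = subst (PathIn G F x)
    (sym (at-true (trans (cong (_xor at y z) (sym (at-≢ (z≢x ∘ sym)))) Dz))) P

  odd-incident : ∀ F v → F ⊆ Ep G → odd ∣ F ∩ incident G v ∣ ≡ ∂ G (lookup F) v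
  odd-incident F v F⊆E = trans (cong odd (∣∣≡# (F ∩ incident G v)))
    (trans (odd-# (lookup (F ∩ incident G v))) (⨁-cong edge))
    where
    edge : ∀ e → lookup (F ∩ incident G v) e ≡ lookup F e ∧ (at (src G e) v xor at (tgt G e) v)
    edge e rewrite lookup-zipWith _∧_ e F (incident G v) | lookup∘tabulate (λ e → ⌊ src G e ≟ v ⌋ ∨ ⌊ tgt G e ≟ v ⌋) e
      with lookup F e in Fe
    ... | false = refl
    ... | true with src G e ≟ v | tgt G e ≟ v
    ...   | yes refl | yes eq = contradiction (sym eq) (loopless e ([]=⇒lookup (F⊆E (lookup⇒[]= e F Fe))))
    ...   | yes _ | no _ = refl
    ...   | no _ | yes _ = refl
    ...   | no _ | no _ = refl

  ∂-outside : ∀ F v → F ⊑ lookup (Ep G) → lookup (Vp G) v ≡ false → ∂ G F v ≡ false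
  ∂-outside F v F⊑E ¬Vv = ¬true⇒false λ ∂v → case (∂-true⇒link F v ∂v)
    where
    case : (∃ λ e → F e ≡ true × ∃ (Link G e v)) → ⊥
    case (e , Fe , _ , e-link) = true≢false (proj₁ (link-V (F⊑E e Fe) e-link)) ¬Vv

  isJoin⇒join : ∀ T F → T ⊆ Vp G → IsJoin G T F → Join G (lookup T) (lookup F)
  isJoin⇒join T F T⊆V (F⊆E , iff) = (λ e Fe → []=⇒lookup (F⊆E (lookup⇒[]= e F Fe))) , boundary'
    where
    boundary' : ∂ G (lookup F) ≗ lookup T
    boundary' v with lookup (Vp G) v in Vv | lookup T v in Tv
    ... | true | true = trans (sym (odd-incident F v F⊆E))
      (Equivalence.to (IsOdd⇔odd ∣ F ∩ incident G v ∣) (Equivalence.from (iff v (lookup⇒[]= v (Vp G) Vv)) (lookup⇒[]= v T Tv)))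
    ... | true | false = ¬true⇒false λ ∂v → true≢false
      ([]=⇒lookup (Equivalence.to (iff v (lookup⇒[]= v (Vp G) Vv))
        (Equivalence.from (IsOdd⇔odd ∣ F ∩ incident G v ∣) (trans (odd-incident F v F⊆E) ∂v)))) Tv
    ... | false | true = contradiction Vv (true≢false ([]=⇒lookup (T⊆V (lookup⇒[]= v T Tv))))
    ... | false | false = ∂-outside (lookup F) v (λ e Fe → []=⇒lookup (F⊆E (lookup⇒[]= e F Fe))) Vv

  join⇒isJoin : ∀ T F → Join G (lookup T) (lookup F) → IsJoin G T F
  join⇒isJoin T F (F⊑E , ∂F) = F⊆E , λ v _ → mk⇔
    (λ p → lookup⇒[]= v T (trans (sym (∂F v)) (trans (sym (odd-incident F v F⊆E)) (Equivalence.to (IsOdd⇔odd ∣ F ∩ incident G v ∣) p))))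
    (λ p → Equivalence.from (IsOdd⇔odd ∣ F ∩ incident G v ∣) (trans (odd-incident F v F⊆E) (trans (∂F v) ([]=⇒lookup p))))
    where
    F⊆E : F ⊆ Ep G
    F⊆E {e} p = lookup⇒[]= e (Ep G) (F⊑E e ([]=⇒lookup p))

  isMinJoin⇒min : ∀ T F → T ⊆ Vp G → IsMinJoin G T F → Min G (lookup T) (lookup F)
  isMinJoin⇒min T F T⊆V (j , min) = isJoin⇒join T F T⊆V j , λ F' j' → subst₂ _≤_ (∣∣≡# F)
    (trans (∣∣≡# (tabulate F')) (#-cong (lookup∘tabulate F')))
    (min (tabulate F') (join⇒isJoin T (tabulate F') (join-tabulate G j')))

  min⇒isMinJoin : ∀ T F → T ⊆ Vp G → Min G (lookup T) (lookup F) → IsMinJoin G T F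
  min⇒isMinJoin T F T⊆V (j , min) = join⇒isJoin T F j , λ F' j' → subst₂ _≤_ (sym (∣∣≡# F)) (sym (∣∣≡# F'))
    (min (lookup F') (isJoin⇒join T F' T⊆V j'))

  -- F △ F' contains an r-x path Q for any join F' of T △ {r, x}; swapping F and F' along Q compares their sizes.
  swap-≤ : ∀ {T r x} F {F'} → Min G T (lookup F) → Join G ((T △ at r) △ at x) F' → lookup (Vp G) r ≡ true
    → Σ (Path G r x) λ Q → # (lookup F △ pathMask G Q) ≤ # F'
  swap-≤ {T} {r} {x} F {F'} (j , min) j' Vr = Q , ℕₚ.+-cancelʳ-≤ _ _ _ (begin
    # (f △ pathMask G Q) + # (F' △ pathMask G Q)  ≡⟨ #-exchange f F' (pathMask G Q) Q⊑ ⟩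
    # f + # F'                                    ≡⟨ ℕₚ.+-comm (# f) (# F') ⟩
    # F' + # f                                    ≤⟨ ℕₚ.+-monoʳ-≤ (# F') (min _ j'') ⟩
    # F' + # (F' △ pathMask G Q)                  ∎)
    where
    open ℕₚ.≤-Reasoning
    f = lookup F
    j△ : Join G (at r △ at x) (f △ F')
    j△ = join-≗ G (λ v → truthTable 3 (λ t a b → t xor ((t xor a) xor b)) (λ t a b → a xor b) refl (T v) (at r v) (at x v))
      (join-△ G j j')
    Q×Q⊑ = pathBetween (f △ F') r x (proj₁ j△) (proj₂ j△) Vr
    Q = proj₁ Q×Q⊑
    Q⊑ : pathMask G Q ⊑ (f △ F')
    Q⊑ e eq with maskOf-true G (es Q) e eq
    ... | i , refl = proj₂ Q×Q⊑ i
    j'' : Join G T (F' △ pathMask G Q)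
    j'' = join-≗ G (λ v → truthTable 3 (λ t a b → ((t xor a) xor b) xor (a xor b)) (λ t a b → t) refl (T v) (at r v) (at x v))
      (join-△ G j' (join-path G Q))

  join-△path : ∀ {T F r x} → Join G T F → (P : Path G r x) → Join G ((T △ at r) △ at x) (F △ pathMask G P)
  join-△path {T} {r = r} {x} j P = join-≗ G (λ v → sym (Boolₚ.xor-assoc (T v) (at r v) (at x v))) (join-△ G j (join-path G P))

  -- A minimum join need not be `F` toggled along a path, but `swap-≤` finds a path doing at least
  -- as well as any given join. Minimising over paths and over joins therefore agree.
  lambda⇒min : ∀ {T} F {r x κ} → Min G T (lookup F) → lookup (Vp G) r ≡ true → IsLambda G F r x κ
    → ∃ λ J → Min G ((T △ at r) △ at x) J × ℤ.+ (# J) ≡ ℤ.+ (# (lookup F)) ℤ.+ κ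
  lambda⇒min F {r} {x} {κ} Fmin Vr ((P , wP) , P-min) = lookup F △ pathMask G P
    , (join-△path (proj₁ Fmin) P , lower) , size
    where
    size : ℤ.+ (# (lookup F △ pathMask G P)) ≡ ℤ.+ (# (lookup F)) ℤ.+ κ
    size = trans (#-path G F P) (cong (ℤ._+_ (ℤ.+ (# (lookup F)))) wP)
    lower : ∀ F' → Join G _ F' → # (lookup F △ pathMask G P) ≤ # F'
    lower F' j' with swap-≤ F Fmin j' Vr
    ... | Q , Q≤ = ℕₚ.≤-trans (ℤₚ.drop‿+≤+ (subst₂ ℤ._≤_ (sym size) (sym (#-path G F Q))
      (ℤₚ.+-monoʳ-≤ (ℤ.+ (# (lookup F))) (P-min Q)))) Q≤

  min⇒lambda : ∀ {T} F {r x J} → Min G T (lookup F) → lookup (Vp G) r ≡ true → Min G ((T △ at r) △ at x) J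
    → IsLambda G F r x (ℤ.+ (# J) ℤ.- ℤ.+ (# (lookup F)))
  min⇒lambda F {r} {x} {J} Fmin Vr (Jjoin , Jmin) = (Q , trans (weight≡ Q) (cong (λ c → ℤ.+ c ℤ.- ℤ.+ (# f)) #Q))
    , λ P → ℤₚ.≤-trans (ℤₚ.+-monoˡ-≤ (ℤ.- ℤ.+ (# f)) (ℤ.+≤+ (Jmin _ (join-△path (proj₁ Fmin) P))))
        (ℤₚ.≤-reflexive (sym (weight≡ P)))
    where
    f = lookup F
    Q = proj₁ (swap-≤ F Fmin Jjoin Vr)
    #Q : # (f △ pathMask G Q) ≡ # J
    #Q = ℕₚ.≤-antisym (proj₂ (swap-≤ F Fmin Jjoin Vr)) (Jmin _ (join-△path (proj₁ Fmin) Q))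
    weight≡ : ∀ P → weight F P ≡ ℤ.+ (# (f △ pathMask G P)) ℤ.- ℤ.+ (# f)
    weight≡ P = begin
      weight F P                                         ≡⟨ ℤₚ.+-identityʳ _ ⟨
      weight F P ℤ.+ ℤ.0ℤ                                ≡⟨ cong (ℤ._+_ (weight F P)) (ℤₚ.+-inverseʳ (ℤ.+ (# f))) ⟨
      weight F P ℤ.+ (ℤ.+ (# f) ℤ.- ℤ.+ (# f))           ≡⟨ ℤₚ.+-assoc (weight F P) _ _ ⟨
      (weight F P ℤ.+ ℤ.+ (# f)) ℤ.- ℤ.+ (# f)           ≡⟨ cong (ℤ._- ℤ.+ (# f)) (ℤₚ.+-comm (weight F P) _) ⟩
      (ℤ.+ (# f) ℤ.+ weight F P) ℤ.- ℤ.+ (# f)           ≡⟨ cong (ℤ._- ℤ.+ (# f)) (#-path G F P) ⟨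
      ℤ.+ (# (f △ pathMask G P)) ℤ.- ℤ.+ (# f)           ∎
      where open ≡-Reasoning

-- Potentials and primality

_∈V_ : {κ : ℕ} → Fin κ → Subset κ → Set
x ∈V V = lookup V x ≡ true

Adj : (G : Graph) → Fin (nV G) → Fin (nV G) → Set
Adj G x y = ∃ λ e → lookup (Ep G) e ≡ true × Link G e x y

adj-sym : ∀ G {x y} → Adj G x y → Adj G y x
adj-sym G (e , Ee , e-link) = e , Ee , link-sym G e-link

-- S stands for T △ {r}, so that J x realises λ(r, x) up to a constant; r enters only as a maximiser of #_ ∘ J.
record Potential (G : Graph) (S : Mask (nV G)) : Set where
  field
    J : Fin (nV G) → Mask (nE G)
    J-min : ∀ {x} → x ∈V Vp G → Min G (S △ at x) (J x)

  p : Fin (nV G) → ℕ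
  p x = # (J x)

-- For S = T △ {r}, `p r` is the size of a minimum join of T, and `p x` ≤ `p r` says λ(r, x) ≤ 0.
-- Connectedness comes from the paths realising λ and supplies the walks of the exchange argument.
record Peak (G : Graph) (S : Mask (nV G)) (r : Fin (nV G)) : Set where
  field
    potential : Potential G S
  open Potential potential public
  field
    r∈V : r ∈V Vp G
    p≤ : ∀ {x} → x ∈V Vp G → p x ≤ p r
    connected : ∀ {x} → x ∈V Vp G → Star (Adj G) r x

star-path : ∀ {κ} {R : Fin κ → Fin κ → Set} l (vs : Fin (suc l) → Fin κ)
  → (∀ i → R (vs (inject₁ i)) (vs (suc i))) → Star R (vs zero) (vs (fromℕ l))
star-path zero vs R-vs = ε
star-path (suc l) vs R-vs = R-vs zero ◅ star-path l (vs ∘ suc) (R-vs ∘ suc)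

xor-cancel : ∀ {κ} (f g : Mask κ) → f ≗ (f △ g) △ g
xor-cancel f g v = truthTable 2 (λ a b → a) (λ a b → (a xor b) xor b) refl (f v) (g v)

module _ (G : Graph) (proper : Proper G) (T : Subset (nV G)) (T⊆V : T ⊆ Vp G) (r : Fin (nV G)) where

  -- For each `x` any join of size at most `# F` will do: minimising only lowers it, and
  -- `min⇒lambda` then supplies a path of the corresponding weight.
  mkPrimal : ∀ {F} → r ∈V Vp G → Min G (lookup T) F
    → (∀ x → x ∈V Vp G → ∃ λ J → Join G ((lookup T △ at r) △ at x) J × # J ≤ # F)
    → Primal G T r
  mkPrimal {F} Vr (j , min) joins = lookup⇒[]= r (Vp G) Vr , tabulate F , min⇒isMinJoin G proper T (tabulate F) T⊆V Fmin , λ x Vx → lambda (joins x ([]=⇒lookup Vx))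
    where
    f≗F = lookup∘tabulate F
    Fmin : Min G (lookup T) (lookup (tabulate F))
    Fmin = join-tabulate G j , λ F' j' → subst (_≤ # F') (sym (#-cong f≗F)) (min F' j')
    lambda : ∀ {x} → (∃ λ J → Join G ((lookup T △ at r) △ at x) J × # J ≤ # F) → Σ ℤ λ k → IsLambda G (tabulate F) r x k × k ℤ.≤ ℤ.+ 0
    lambda (J , Jjoin , J≤F) with minimize G Jjoin
    ... | J' , J'min = _ , min⇒lambda G proper (tabulate F) Fmin Vr J'min , ℤₚ.i≤j⇒i-j≤0 (ℤ.+≤+
      (ℕₚ.≤-trans (proj₂ J'min J Jjoin) (ℕₚ.≤-trans J≤F (ℕₚ.≤-reflexive (sym (#-cong f≗F))))))

  primal⇒peak : Primal G T r → Peak G (lookup T △ at r) r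
  primal⇒peak (r∈V , F , isMin , lambda) = record
    { potential = record { J = λ x → proj₁ (pick x) ; J-min = λ {x} Vx → proj₁ (proj₂ (pick x) Vx) }
    ; r∈V = Vr
    ; p≤ = λ {x} Vx → ℕₚ.≤-trans (proj₁ (proj₂ (proj₂ (pick x) Vx))) (ℕₚ.≤-reflexive
        (min-size G Fmin (min-≗ G (λ v → sym (xor-cancel (lookup T) (at r) v)) (proj₁ (proj₂ (pick r) Vr)))))
    ; connected = λ {x} Vx → proj₂ (proj₂ (proj₂ (pick x) Vx))
    }
    where
    Vr = []=⇒lookup r∈V
    Fmin = isMinJoin⇒min G proper T F T⊆V isMin
    pathStar : ∀ {x} → Path G r x → Star (Adj G) r x
    pathStar P = subst₂ (Star (Adj G)) (start P) (end P)
      (star-path (len P) (vs P) (λ i → es P i , []=⇒lookup (eIn P i) , link P i))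
    Good : Fin (nV G) → Mask (nE G) → Set
    Good x J = Min G ((lookup T △ at r) △ at x) J × # J ≤ # (lookup F) × Star (Adj G) r x
    good : ∀ {x} → x ∈V Vp G → ∃ (Good x)
    good {x} Vx with lambda x (lookup⇒[]= x (Vp G) Vx)
    ... | k , isλ@((P , _) , _) , k≤0 with lambda⇒min G proper F Fmin Vr isλ
    ...   | J , Jmin , size = J , Jmin , ℤₚ.drop‿+≤+ (subst₂ ℤ._≤_ (sym size) (ℤₚ.+-identityʳ _)
              (ℤₚ.+-monoʳ-≤ (ℤ.+ (# (lookup F))) k≤0)) , pathStar P
    pick : ∀ x → Σ (Mask (nE G)) λ J → x ∈V Vp G → Good x J
    pick x with lookup (Vp G) x Bool.≟ true
    ... | yes Vx = proj₁ (good Vx) , λ _ → proj₂ (good Vx)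
    ... | no ¬Vx = (λ _ → false) , λ Vx → contradiction Vx ¬Vx

  -- `InA` comes with its own minimum join `F₀`. Minimum joins of one terminal set have equal size,
  -- so λ = 0 can be tested against any `F`.
  inA⇒# : ∀ {x F J} → r ∈V Vp G → InA G T r x → Min G (lookup T) F → Min G ((lookup T △ at r) △ at x) J → # J ≡ # F
  inA⇒# Vr (_ , F₀ , isMin , isλ) Fmin Jmin with isMinJoin⇒min G proper T F₀ T⊆V isMin
  ... | F₀min with lambda⇒min G proper F₀ F₀min Vr isλ
  ...   | J₀ , J₀min , size = trans (min-size G Jmin J₀min)
    (trans (ℤₚ.+-injective (trans size (ℤₚ.+-identityʳ _))) (min-size G F₀min Fmin))

  #⇒inA : ∀ {x F J} → r ∈V Vp G → x ∈V Vp G → Min G (lookup T) F → Min G ((lookup T △ at r) △ at x) J → # J ≡ # F → InA G T r x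
  #⇒inA {x} {F} {J} Vr Vx (j , min) Jmin J≡F = lookup⇒[]= x (Vp G) Vx , tabulate F , min⇒isMinJoin G proper T (tabulate F) T⊆V Fmin
    , subst (IsLambda G (tabulate F) r x) (trans (cong₂ (λ a b → ℤ.+ a ℤ.- ℤ.+ b) J≡F (#-cong f≗F)) (ℤₚ.+-inverseʳ (ℤ.+ (# F))))
        (min⇒lambda G proper (tabulate F) Fmin Vr Jmin)
    where
    f≗F = lookup∘tabulate F
    Fmin : Min G (lookup T) (lookup (tabulate F))
    Fmin = join-tabulate G j , λ F' j' → subst (_≤ # F') (sym (#-cong f≗F)) (min F' j')

-- The exchange argument

module _ (G : Graph) (proper : Proper G) where
  open Proper proper

  -- Each edge has exactly one coloured end, so `# F` has the parity of the sum of the degrees of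
  -- the coloured vertices, which depends only on `D`.
  parity : ∀ {D F} → Join G D F → odd (# F) ≡ ⨁ (colour ⊓ D)
  parity {D} {F} (F⊑E , ∂F) = begin
    odd (# F)                                              ≡⟨ odd-# F ⟩
    ⨁ F                                                    ≡⟨ ⨁-cong edge ⟨
    ⨁ (λ e → F e ∧ (colour (src G e) xor colour (tgt G e))) ≡⟨ ∂-cut G colour F ⟨
    ⨁ (colour ⊓ ∂ G F)                                     ≡⟨ ⨁-cong (λ v → cong (colour v ∧_) (∂F v)) ⟩
    ⨁ (colour ⊓ D)                                         ∎
    where
    open ≡-Reasoning
    edge : ∀ e → F e ∧ (colour (src G e) xor colour (tgt G e)) ≡ F e
    edge e with F e in Fe
    ... | true = bichromatic e (F⊑E e Fe)
    ... | false = refl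

  link-colour : ∀ {e x y} → lookup (Ep G) e ≡ true → Link G e x y → colour x xor colour y ≡ true
  link-colour {e} Ee (inj₁ (refl , refl)) = bichromatic e Ee
  link-colour {e} Ee (inj₂ (refl , refl)) = trans (Boolₚ.xor-comm (colour (tgt G e)) _) (bichromatic e Ee)

module Move (G : Graph) (proper : Proper G) (S : Mask (nV G)) (potential : Potential G S) where
  open Proper proper
  open Potential potential

  adj-V : ∀ {x y} → Adj G x y → x ∈V Vp G × y ∈V Vp G
  adj-V (e , Ee , e-link) = link-V G proper Ee e-link

  ⨁-colour : ∀ x → ⨁ (colour ⊓ (S △ at x)) ≡ ⨁ (colour ⊓ S) xor colour x
  ⨁-colour x = trans (⨁-cong (λ v → trans (Boolₚ.∧-distribˡ-xor (colour v) (S v) (at x v)) (cong ((colour v ∧ S v) xor_) (Boolₚ.∧-comm (colour v) (at x v)))))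
    (trans (⨁-xor (colour ⊓ S) (at x ⊓ colour)) (cong (⨁ (colour ⊓ S) xor_) (⊕-at x colour)))

  p-colour : ∀ {x y} → x ∈V Vp G → y ∈V Vp G → odd (p x) xor odd (p y) ≡ colour x xor colour y
  p-colour {x} {y} Vx Vy = trans
    (cong₂ _xor_ (trans (parity G proper (proj₁ (J-min Vx))) (⨁-colour x)) (trans (parity G proper (proj₁ (J-min Vy))) (⨁-colour y)))
    (truthTable 3 (λ s a b → (s xor a) xor (s xor b)) (λ s a b → a xor b) refl (⨁ (colour ⊓ S)) (colour x) (colour y))

  p-parity : ∀ {x y} → Adj G x y → odd (p x) xor odd (p y) ≡ true
  p-parity adj@(e , Ee , e-link) = trans (p-colour (proj₁ (adj-V adj)) (proj₂ (adj-V adj))) (link-colour G proper Ee e-link)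

  p-suc : ∀ {x y} → Adj G x y → p x ≤ suc (p y)
  p-suc {x} {y} adj@(e , Ee , e-link) = ℕₚ.≤-trans (proj₂ (J-min (proj₁ (adj-V adj))) _
    (join-≗ G (λ v → truthTable 3 (λ s a b → (s xor b) xor (a xor b)) (λ s a b → s xor a) refl (S v) (at x v) (at y v))
      (join-△ G (proj₁ (J-min (proj₂ (adj-V adj)))) (join-link G Ee e-link)))) (#-toggle-≤ (J y) e)

  -- Toggling the connecting edge bounds the change by 1, and bipartiteness excludes equality
  -- through `p-parity`.
  p-adj : ∀ {x y} → Adj G x y → p y ≡ suc (p x) ⊎ p x ≡ suc (p y)
  p-adj {x} {y} adj with ℕₚ.<-cmp (p x) (p y)
  ... | tri< x<y _ _ = inj₁ (ℕₚ.≤-antisym (p-suc (adj-sym G adj)) x<y)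
  ... | tri≈ _ x≡y _ with () ← trans (sym (p-parity adj)) (trans (cong (λ c → odd c xor odd (p y)) x≡y) (Boolₚ.xor-same (odd (p y))))
  ... | tri> _ _ y<x = inj₂ (ℕₚ.≤-antisym (p-suc adj) y<x)

  -- A swap controls only the sum of two join sizes, so the two joins at `b` are bounded jointly.
  -- The value `i + i` is twice the highest level from which a walk may step.
  Bounded : Mask (nV G) → ℕ → Set
  Bounded Y i = ∀ b → Y b ≡ true → b ∈V Vp G × (∀ F → Join G (S △ (Y △ at b)) F → i + i ≤ # F + p b)

  Low : Mask (nV G) → Fin (nV G) → Set
  Low Y x = ∃ λ F → Join G (S △ (Y △ at x)) F × # F < p x

  -- The small join and a minimum join for `x` would be one of the pairs that `Bounded` excludes.
  -- This is the contradiction in which every walk ends.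
  low-Y : ∀ {Y i x} → Bounded Y i → Y x ≡ true → p x ≤ i → ¬ Low Y x
  low-Y bounded Yx px≤i (F , j , F<px) = ℕₚ.<⇒≱
    (ℕₚ.+-mono-<-≤ (ℕₚ.<-≤-trans F<px px≤i) px≤i) (proj₂ (bounded _ Yx) F j)

  -- When p drops along xx', exchanging with a minimum join of S △ {x'} either moves x to x' or
  -- splits Y △ {x, x'} in two, which Bounded excludes.
  low-step : ∀ {Y i x x'} → Bounded Y i → Adj G x x' → p x ≤ i → Low Y x → Low Y x'
  low-step {Y} {i} {x} {x'} bounded adj@(e , Ee , e-link) px≤i low@(F , j , F<px) with p-adj adj
  ... | inj₁ px' = F △ at e
        , join-≗ G (λ v → truthTable 4 (λ s c a b → (s xor (c xor a)) xor (a xor b)) (λ s c a b → s xor (c xor b)) refl (S v) (Y v) (at x v) (at x' v))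
            (join-△ G j (join-link G Ee e-link))
        , ℕₚ.≤-trans (s≤s (#-toggle-≤ F e)) (ℕₚ.≤-trans (s≤s F<px) (ℕₚ.≤-reflexive (sym px')))
  ... | inj₂ px with Y x in Yx
  ...   | true = contradiction low (low-Y bounded Yx px≤i)
  ...   | false with extractPath G proper (F △ J x') (Y △ (at x △ at x')) x (proj₁ j△) (proj₂ j△) D'x
    where
    j△ : Join G (Y △ (at x △ at x')) (F △ J x')
    j△ = join-≗ G (λ v → truthTable 4 (λ s c a b → (s xor (c xor a)) xor (s xor b)) (λ s c a b → c xor (a xor b)) refl (S v) (Y v) (at x v) (at x' v))
      (join-△ G j (proj₁ (J-min (proj₂ (adj-V adj)))))
    D'x : Y x xor (at x x xor at x' x) ≡ true
    D'x = cong₂ _xor_ Yx (cong₂ _xor_ (at-refl x) (at-≢ (link-≢ G proper Ee e-link ∘ sym)))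
  ...     | y , y≢x , D'y , P , P⊑ with x' ≟ y
  ...       | yes refl = F △ Q
            , join-≗ G (λ v → truthTable 4 (λ s c a b → (s xor (c xor a)) xor (a xor b)) (λ s c a b → s xor (c xor b)) refl (S v) (Y v) (at x v) (at x' v))
                (join-△ G j (join-path G P))
            , ℕₚ.+-cancelʳ-< (p x) (# (F △ Q)) (p x') (begin-strict
                # (F △ Q) + p x           ≤⟨ ℕₚ.+-monoʳ-≤ (# (F △ Q)) (proj₂ (J-min (proj₁ (adj-V adj))) (J x' △ Q) jQ) ⟩
                # (F △ Q) + # (J x' △ Q)  ≡⟨ #-exchange F (J x') Q Q⊑ ⟩
                # F + p x'                <⟨ ℕₚ.+-monoˡ-< (p x') F<px ⟩
                p x + p x'                ≡⟨ ℕₚ.+-comm (p x) (p x') ⟩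
                p x' + p x                ∎)
    where
    open ℕₚ.≤-Reasoning
    Q = pathMask G P
    Q⊑ : Q ⊑ (F △ J x')
    Q⊑ i eq with maskOf-true G (es P) i eq
    ... | k , refl = P⊑ k
    jQ : Join G (S △ at x) (J x' △ Q)
    jQ = join-≗ G (λ v → truthTable 3 (λ s a b → (s xor b) xor (a xor b)) (λ s a b → s xor a) refl (S v) (at x v) (at x' v))
      (join-△ G (proj₁ (J-min (proj₂ (adj-V adj)))) (join-path G P))
  ...       | no x'≢y = contradiction (proj₂ (bounded y Yy) (F △ Q) jF) (ℕₚ.<⇒≱ (begin-strict
                # (F △ Q) + p y                 ≤⟨ ℕₚ.+-monoʳ-≤ (# (F △ Q)) (ℕₚ.≤-trans (proj₂ (J-min (proj₁ (bounded y Yy))) _ jJ) (#-toggle-≤ (J x' △ Q) e)) ⟩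
                # (F △ Q) + suc (# (J x' △ Q))  ≡⟨ ℕₚ.+-suc _ _ ⟩
                suc (# (F △ Q) + # (J x' △ Q))  ≡⟨ cong suc (#-exchange F (J x') Q Q⊑) ⟩
                suc (# F + p x')                ≡⟨ ℕₚ.+-suc (# F) (p x') ⟨
                # F + suc (p x')                ≡⟨ cong (# F +_) px ⟨
                # F + p x                       <⟨ ℕₚ.+-mono-<-≤ (ℕₚ.<-≤-trans F<px px≤i) px≤i ⟩
                i + i                           ∎))
    where
    open ℕₚ.≤-Reasoning
    Q = pathMask G P
    Q⊑ : Q ⊑ (F △ J x')
    Q⊑ i eq with maskOf-true G (es P) i eq
    ... | k , refl = P⊑ k
    Yy : Y y ≡ true
    Yy = trans (trans (sym (Boolₚ.xor-identityʳ (Y y))) (cong (Y y xor_) (sym (cong (_xor false) (at-≢ (y≢x ∘ sym)))))) D'y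
    jF : Join G (S △ (Y △ at y)) (F △ Q)
    jF = join-≗ G (λ v → truthTable 4 (λ s c a b → (s xor (c xor a)) xor (a xor b)) (λ s c a b → s xor (c xor b)) refl (S v) (Y v) (at x v) (at y v))
      (join-△ G j (join-path G P))
    jJ : Join G (S △ at y) ((J x' △ Q) △ at e)
    jJ = join-≗ G (λ v → truthTable 4 (λ s a b c → ((s xor b) xor (a xor c)) xor (a xor b)) (λ s a b c → s xor c) refl (S v) (at x v) (at x' v) (at y v))
      (join-△ G (join-△ G (proj₁ (J-min (proj₂ (adj-V adj)))) (join-path G P)) (join-link G Ee e-link))

  Below : ℕ → Fin (nV G) → Fin (nV G) → Set
  Below i x y = Adj G x y × p x ≤ i

  -- A smaller join would make `x` low; `low-step` passes this along the walk, and `low-Y` refutes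
  -- it at `b`. `Below` bounds only the sources of steps, hence the separate bound on `p b`.
  p-lower : ∀ {Y i x b} → Bounded Y i → Star (Below i) x b → Y b ≡ true → p b ≤ i
    → ∀ F → Join G (S △ (Y △ at x)) F → p x ≤ # F
  p-lower {Y} {i} bounded path Yb pb≤i F j = ℕₚ.≮⇒≥ λ F<px → low-Y bounded Yb pb≤i (walk path (F , j , F<px))
    where
    walk : ∀ {x y} → Star (Below i) x y → Low Y x → Low Y y
    walk ε low = low
    walk ((adj , px≤i) ◅ path) low = walk path (low-step bounded adj px≤i low)

-- Odd sets of maximisers

module Top (G : Graph) (proper : Proper G) (S : Mask (nV G)) {r : Fin (nV G)} (peak : Peak G S r) where
  open Proper proper
  open Peak peak
  open Move G proper S potential public

  connected₂ : ∀ {x y} → x ∈V Vp G → y ∈V Vp G → Star (Below (p r)) x y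
  connected₂ Vx Vy = Star.map (λ adj → adj , p≤ (proj₁ (adj-V adj)))
    (Star.reverse (adj-sym G) (connected Vx) ◅◅ connected Vy)

  ⨁-△at : ∀ (X : Mask (nV G)) b → ⨁ (X △ at b) ≡ ⨁ X xor true
  ⨁-△at X b = trans (⨁-xor X (at b)) (cong (⨁ X xor_)
    (trans (⨁-cong (λ v → sym (Boolₚ.∧-identityʳ (at b v)))) (⊕-at b (λ _ → true))))

  -- Induction on the size of `X`. Remove some `b`: for `a` in the rest `Y`, the set `Y △ at a` is
  -- odd with two elements fewer than `X`, so the induction hypothesis yields `Bounded Y (p r)`.
  -- Connectedness gives a walk from `b` into `Y`; if `Y` is empty, `X` is {b}.
  odd-top : ∀ X → (∀ a → X a ≡ true → a ∈V Vp G × p a ≡ p r) → ⨁ X ≡ true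
    → ∀ F → Join G (S △ X) F → p r ≤ # F
  odd-top X X-top X-odd = go (# X) X ℕₚ.≤-refl X-top X-odd
    where
    go : ∀ c X → # X ≤ c → (∀ a → X a ≡ true → a ∈V Vp G × p a ≡ p r) → ⨁ X ≡ true
      → ∀ F → Join G (S △ X) F → p r ≤ # F
    go c X X≤c X-top X-odd F j with ⊕-true⇒∃ X X-odd
    ... | b , Xb with Finₚ.any? (λ v → (X △ at b) v Bool.≟ true)
    ...   | no empty = ℕₚ.≤-trans (ℕₚ.≤-reflexive (sym (proj₂ (X-top b Xb))))
            (proj₂ (J-min (proj₁ (X-top b Xb))) F (join-≗ G (λ v → cong (S v xor_) (X≗b v)) j))
      where
      X≗b : ∀ v → X v ≡ at b v
      X≗b v = trans (xor-cancel X (at b) v) (cong (_xor at b v) (¬true⇒false (λ eq → empty (v , eq))))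
    ...   | yes (b' , Yb') = subst (_≤ # F) (proj₂ (X-top b Xb))
            (p-lower bounded (connected₂ (proj₁ (X-top b Xb)) (proj₁ (X-top b' (Y⊑X b' Yb')))) Yb' (p≤ (proj₁ (X-top b' (Y⊑X b' Yb'))))
              F (join-≗ G (λ v → cong (S v xor_) (xor-cancel X (at b) v)) j))
      where
      Y = X △ at b
      △at-⊑ : ∀ (Z : Mask (nV G)) z → Z z ≡ true → (Z △ at z) ⊑ Z
      △at-⊑ Z z Zz v eq with xor-true {Z v} eq
      ... | inj₁ (Zv , _) = Zv
      ... | inj₂ (_ , z≡v) = subst (λ v → Z v ≡ true) (at-true z≡v) Zz
      Y⊑X : Y ⊑ X
      Y⊑X = △at-⊑ X b Xb
      bounded : Bounded Y (p r)
      bounded a Ya = proj₁ (X-top a (Y⊑X a Ya)) , λ F' j' → subst (λ q → p r + p r ≤ # F' + q) (sym (proj₂ (X-top a (Y⊑X a Ya))))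
        (ℕₚ.+-monoˡ-≤ (p r) (smaller c X≤c F' j'))
        where
        smaller : ∀ c → # X ≤ c → ∀ F' → Join G (S △ (Y △ at a)) F' → p r ≤ # F'
        smaller zero X≤0 with () ← ℕₚ.≤-trans (ℕₚ.≤-reflexive (sym (#-remove X b Xb))) X≤0
        smaller (suc c) X≤c = go c (Y △ at a)
          (ℕₚ.≤-trans (ℕₚ.n≤1+n _) (ℕₚ.≤-trans (ℕₚ.≤-reflexive (sym (#-remove Y a Ya)))
            (s≤s⁻¹ (ℕₚ.≤-trans (ℕₚ.≤-reflexive (sym (#-remove X b Xb))) X≤c))))
          (λ v eq → X-top v (Y⊑X v (△at-⊑ Y a Ya v eq)))
          (trans (⨁-△at Y a) (trans (cong (_xor true) (⨁-△at X b)) (cong (λ o → (o xor true) xor true) X-odd)))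

-- Finite quotients

-- A way to obtain connected components without deciding reachability: with reachability for `_~_`
-- and the edges for `pairs`, `identifies` says that enough is merged and `effective` that nothing
-- more is.
record Quotient {κ : ℕ} (_~_ : Fin κ → Fin κ → Set) (pairs : List (Fin κ × Fin κ)) : Set where
  field
    size : ℕ
    φ : Fin κ → Fin size
    surjective : ∀ v → ∃ λ x → φ x ≡ v
    identifies : All (λ (a , b) → φ a ≡ φ b) pairs
    effective : ∀ {x y} → φ x ≡ φ y → x ~ y

module _ {κ : ℕ} {_~_ : Fin κ → Fin κ → Set} (~-refl : ∀ {x} → x ~ x) (~-sym : ∀ {x y} → x ~ y → y ~ x)
  (~-trans : ∀ {x y z} → x ~ y → y ~ z → x ~ z) where

  quotient : ∀ pairs → All (λ (a , b) → a ~ b) pairs → Quotient _~_ pairs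
  quotient [] [] = record { size = κ ; φ = id ; surjective = λ v → v , refl ; identifies = [] ; effective = λ { refl → ~-refl } }
  quotient ((a , b) ∷ pairs) (a~b ∷ rest) with quotient pairs rest
  ... | record { size = zero ; φ = φ } with () ← φ a
  ... | record { size = suc l ; φ = φ ; surjective = surjective ; identifies = identifies ; effective = effective } with φ a ≟ φ b
  ...   | yes a≡b = record { size = suc l ; φ = φ ; surjective = surjective ; identifies = a≡b ∷ identifies ; effective = effective }
  ...   | no a≢b = record { size = l ; φ = merge ∘ φ ; surjective = surjective′ ; identifies = merge-ab ∷ All.map (cong merge) identifies ; effective = effective′ _ _ }
    where
    -- The class of `a` is sent to that of `b`, and `punchOut` closes the gap left at `φ a`.
    merge : Fin (suc l) → Fin l
    merge w with φ a ≟ w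
    ... | yes _ = punchOut a≢b
    ... | no a≢w = punchOut a≢w
    merge-ab : merge (φ a) ≡ merge (φ b)
    merge-ab with φ a ≟ φ a | φ a ≟ φ b
    ... | no a≢a | _ = contradiction refl a≢a
    ... | yes _ | yes a≡b = contradiction a≡b a≢b
    ... | yes _ | no a≢b′ = Finₚ.punchOut-cong (φ a) refl
    surjective′ : ∀ v → ∃ λ x → merge (φ x) ≡ v
    surjective′ v with surjective (Data.Fin.punchIn (φ a) v)
    ... | x , φx with φ a ≟ φ x
    ...   | yes a≡x = contradiction (sym (trans a≡x φx)) (Finₚ.punchInᵢ≢i (φ a) v)
    ...   | no a≢x = x , merge-x
      where
      merge-x : merge (φ x) ≡ v
      merge-x with φ a ≟ φ x
      ... | yes a≡x = contradiction a≡x a≢x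
      ... | no a≢x′ = trans (Finₚ.punchOut-cong (φ a) {i≢j = a≢x′} {i≢k = Finₚ.punchInᵢ≢i (φ a) v ∘ sym} φx) (Finₚ.punchOut-punchIn (φ a))
    effective′ : ∀ x y → merge (φ x) ≡ merge (φ y) → x ~ y
    effective′ x y eq with φ a ≟ φ x | φ a ≟ φ y
    ... | yes a≡x | yes a≡y = effective (trans (sym a≡x) a≡y)
    ... | yes a≡x | no a≢y = ~-trans (effective (sym a≡x)) (~-trans a~b (effective (Finₚ.punchOut-injective a≢b a≢y eq)))
    ... | no a≢x | yes a≡y = ~-trans (effective (Finₚ.punchOut-injective a≢x a≢b eq)) (~-trans (~-sym a~b) (effective a≡y))
    ... | no a≢x | no a≢y = effective (Finₚ.punchOut-injective a≢x a≢y eq)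

-- Contracted graphs and tooth grafts

bipartition⇒proper : ∀ G A B → IsBipartition G A B → Proper G
bipartition⇒proper G A B (A⊆V , B⊆V , split , edges) = record
  { colour = lookup A
  ; bichromatic = λ e Ee → bichromatic (edges e (lookup⇒[]= e (Ep G) Ee))
  ; ends = λ e Ee → ends (edges e (lookup⇒[]= e (Ep G) Ee))
  }
  where
  inB : ∀ {x} → x ∈ B → lookup A x ≡ false
  inB {x} x∈B with split x (B⊆V x∈B)
  ... | inj₁ (_ , x∉B) = contradiction x∈B x∉B
  ... | inj₂ (x∉A , _) = ¬true⇒false λ eq → x∉A (lookup⇒[]= x A eq)
  bichromatic : ∀ {x y} → (x ∈ A × y ∈ B) ⊎ (x ∈ B × y ∈ A) → lookup A x xor lookup A y ≡ true
  bichromatic (inj₁ (x∈A , y∈B)) = cong₂ _xor_ ([]=⇒lookup x∈A) (inB y∈B)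
  bichromatic (inj₂ (x∈B , y∈A)) = cong₂ _xor_ (inB x∈B) ([]=⇒lookup y∈A)
  ends : ∀ {x y} → (x ∈ A × y ∈ B) ⊎ (x ∈ B × y ∈ A) → lookup (Vp G) x ≡ true × lookup (Vp G) y ≡ true
  ends (inj₁ (x∈A , y∈B)) = []=⇒lookup (A⊆V x∈A) , []=⇒lookup (B⊆V y∈B)
  ends (inj₂ (x∈B , y∈A)) = []=⇒lookup (B⊆V x∈B) , []=⇒lookup (A⊆V y∈A)

lookup-⊤ : ∀ {κ} (x : Fin κ) → lookup ⊤ x ≡ true
lookup-⊤ x = []=⇒lookup (∈⊤ {x = x})

module Contraction {n m : ℕ} (s t : Fin m → Fin n) (T : Subset n) {k : ℕ} (φ : Fin n → Fin k) where

  G = mkGraph n m s t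
  H = contractG s t T φ

  class : Fin k → Mask n
  class v x = at (φ x) v

  -- These masks live on the edge universe of `G`, which `H` and the tooth grafts share, so a join
  -- of any of them is directly a mask of edges of `G`.
  cross : Mask m
  cross e = not (at (φ (s e)) (φ (t e)))

  inner cut : Fin k → Mask m
  inner v e = class v (s e) ∧ class v (t e)
  cut v e = class v (s e) xor class v (t e)

  lookup-fibre : ∀ v x → lookup (fibre s t T φ v) x ≡ class v x
  lookup-fibre v x = lookup∘tabulate (class v) x

  lookup-cross : ∀ e → lookup (Ep H) e ≡ cross e
  lookup-cross e = lookup∘tabulate cross e

  lookup-inner : ∀ v e → lookup (Ep (toothG s t T φ v)) e ≡ inner v e
  lookup-inner v e = trans (lookup∘tabulate (λ e → lookup (fibre s t T φ v) (s e) ∧ lookup (fibre s t T φ v) (t e)) e)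
    (cong₂ _∧_ (lookup-fibre v (s e)) (lookup-fibre v (t e)))

  project : Mask n → Mask k
  project D v = ⨁ (class v ⊓ D)

  lookup-contractT : ∀ v → lookup (contractT s t T φ) v ≡ project (lookup T) v
  lookup-contractT v = begin
    lookup (contractT s t T φ) v           ≡⟨ lookup∘tabulate (λ v → ⌊ ∣ T ∩ fibre s t T φ v ∣ % 2 ℕ.≟ 1 ⌋) v ⟩
    ⌊ ∣ T ∩ fibre s t T φ v ∣ % 2 ℕ.≟ 1 ⌋  ≡⟨ odd-%2 ∣ T ∩ fibre s t T φ v ∣ ⟨
    odd ∣ T ∩ fibre s t T φ v ∣            ≡⟨ cong odd (∣∣≡# (T ∩ fibre s t T φ v)) ⟩
    odd (# (lookup (T ∩ fibre s t T φ v))) ≡⟨ odd-# (lookup (T ∩ fibre s t T φ v)) ⟩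
    ⨁ (lookup (T ∩ fibre s t T φ v))       ≡⟨ ⨁-cong (λ x → trans (lookup-zipWith _∧_ x T (fibre s t T φ v))
                                                (trans (cong (lookup T x ∧_) (lookup-fibre v x)) (Boolₚ.∧-comm (lookup T x) (class v x)))) ⟩
    project (lookup T) v                   ∎
    where open ≡-Reasoning

  project-△at : ∀ D x → project (D △ at x) ≗ project D △ at (φ x)
  project-△at D x v = begin
    ⨁ (λ y → class v y ∧ (D y xor at x y))
      ≡⟨ ⨁-cong (λ y → trans (Boolₚ.∧-distribˡ-xor (class v y) (D y) (at x y)) (cong ((class v y ∧ D y) xor_) (Boolₚ.∧-comm (class v y) (at x y)))) ⟩
    ⨁ ((class v ⊓ D) △ (at x ⊓ class v))
      ≡⟨ ⨁-xor (class v ⊓ D) (at x ⊓ class v) ⟩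
    project D v xor ⨁ (at x ⊓ class v)
      ≡⟨ cong (project D v xor_) (⊕-at x (class v)) ⟩
    project D v xor at (φ x) v ∎
    where open ≡-Reasoning

  cut-project : ∀ F v → ⨁ (F ⊓ cut v) ≡ project (∂ G F) v
  cut-project F v = sym (∂-cut G (class v) F)

  cut⇒cross : ∀ v e → cut v e ≡ true → cross e ≡ true
  cut⇒cross v e eq with φ (s e) ≟ φ (t e)
  ... | no _ = refl
  ... | yes φs≡φt with () ← trans (sym eq) (trans (cong (λ w → at w v xor class v (t e)) φs≡φt) (Boolₚ.xor-same (class v (t e))))

  ∂-cross : ∀ F v → ∂ H (F ⊓ cross) v ≡ ⨁ (F ⊓ cut v)
  ∂-cross F v = ⨁-cong edge
    where
    edge : ∀ e → (F e ∧ cross e) ∧ cut v e ≡ F e ∧ cut v e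
    edge e with cut v e in cut-e
    ... | false = trans (Boolₚ.∧-zeroʳ (F e ∧ cross e)) (sym (Boolₚ.∧-zeroʳ (F e)))
    ... | true rewrite cut⇒cross v e cut-e = cong (_∧ true) (Boolₚ.∧-identityʳ (F e))

  join-project : ∀ {D F} → ∂ G F ≗ D → Join H (project D) (F ⊓ cross)
  join-project {D} {F} ∂F = (λ e eq → trans (lookup-cross e) (proj₂ (∧-true {F e} eq)))
    , λ v → trans (∂-cross F v) (trans (cut-project F v) (⨁-cong (λ x → cong (class v x ∧_) (∂F x))))

  -- An edge of `F` that avoids the cut has both ends in the class or none, so restricting `F`
  -- restricts its boundary.
  ∂-inner : ∀ F v → (∀ e → F e ≡ true → cut v e ≡ false) → ∂ G (F ⊓ inner v) ≗ class v ⊓ ∂ G F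
  ∂-inner F v uncut y = trans (⨁-cong edge) (sym (⨁-∧ (class v y) (λ e → F e ∧ (at (s e) y xor at (t e) y))))
    where
    same : ∀ {a b} → a xor b ≡ false → a ≡ b
    same {true} {true} _ = refl
    same {false} {false} _ = refl
    edge : ∀ e → (F e ∧ inner v e) ∧ (at (s e) y xor at (t e) y) ≡ class v y ∧ (F e ∧ (at (s e) y xor at (t e) y))
    edge e with F e in Fe
    ... | false = sym (Boolₚ.∧-zeroʳ (class v y))
    ... | true with same (uncut e Fe)
    ...   | s≡t with s e ≟ y | t e ≟ y
    ...     | yes refl | yes _ = trans (Boolₚ.∧-zeroʳ (inner v e)) (sym (Boolₚ.∧-zeroʳ (class v (s e))))
    ...     | yes refl | no _ = cong (_∧ true) (trans (cong (class v (s e) ∧_) (sym s≡t)) (Boolₚ.∧-idem (class v (s e))))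
    ...     | no _ | yes refl = cong (_∧ true) (trans (cong (_∧ class v (t e)) s≡t) (Boolₚ.∧-idem (class v (t e))))
    ...     | no _ | no _ = trans (Boolₚ.∧-zeroʳ (inner v e)) (sym (Boolₚ.∧-zeroʳ (class v y)))

  project-T : ∀ r x → project ((lookup T △ at r) △ at x) ≗ (lookup (contractT s t T φ) △ at (φ r)) △ at (φ x)
  project-T r x v = trans (project-△at (lookup T △ at r) x v) (cong (_xor at (φ x) v)
    (trans (project-△at (lookup T) r v) (cong (_xor at (φ r) v) (sym (lookup-contractT v)))))

  lookup-δ : ∀ v e → lookup (δ G (fibre s t T φ v)) e ≡ cut v e
  lookup-δ v e = trans (lookup∘tabulate _ e) (cong₂ _∧_ (lookup-⊤ e) (cong₂ _xor_ (lookup-fibre v (s e)) (lookup-fibre v (t e))))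

  lookup-δ⁅⁆ : ∀ v e → lookup (Ep H) e ≡ true → lookup (δ H ⁅ v ⁆) e ≡ cut v e
  lookup-δ⁅⁆ v e Ee = trans (lookup∘tabulate _ e) (cong₂ _∧_ Ee (cong₂ _xor_ (lookup-⁅⁆ (φ (s e))) (lookup-⁅⁆ (φ (t e)))))
    where
    lookup-⁅⁆ : ∀ w → lookup ⁅ v ⁆ w ≡ at w v
    lookup-⁅⁆ w with w ≟ v
    ... | yes refl = []=⇒lookup (x∈⁅x⁆ w)
    ... | no w≢v = ¬true⇒false λ eq → w≢v (x∈⁅y⁆⇒x≡y v (lookup⇒[]= w ⁅ v ⁆ eq))

  ∣∩δ∣ : ∀ F v → lookup F ⊑ lookup (Ep H) → ∣ F ∩ δ H ⁅ v ⁆ ∣ ≡ # (lookup F ⊓ cut v)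
  ∣∩δ∣ F v F⊑ = trans (∣∣≡# (F ∩ δ H ⁅ v ⁆)) (#-cong λ e → trans (lookup-zipWith _∧_ e F (δ H ⁅ v ⁆)) (edge e))
    where
    edge : ∀ e → lookup F e ∧ lookup (δ H ⁅ v ⁆) e ≡ lookup F e ∧ cut v e
    edge e with lookup F e in Fe
    ... | false = refl
    ... | true = lookup-δ⁅⁆ v e (F⊑ e Fe)

  cut-ends : ∀ {v e} → cut v e ≡ true → ∃ λ u → ∃ λ w → Link G e u w × φ u ≡ v × φ w ≢ v
  cut-ends {v} {e} eq with xor-true {class v (s e)} eq
  ... | inj₁ (s∈ , t∉) = s e , t e , inj₁ (refl , refl) , at-true s∈ , λ φt → true≢false (trans (cong (at (φ (t e))) (sym φt)) (at-refl (φ (t e)))) t∉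
  ... | inj₂ (s∉ , t∈) = t e , s e , inj₂ (refl , refl) , at-true t∈ , λ φs → true≢false (trans (cong (at (φ (s e))) (sym φs)) (at-refl (φ (s e)))) s∉

  class-refl : ∀ {v x} → φ x ≡ v → class v x ≡ true
  class-refl {x = x} refl = at-refl (φ x)

  module ToothGraft (v : Fin k) (ρ : Fin n) (φρ : φ ρ ≡ v) where

    K = toothG s t T φ v
    Tv = toothT s t T φ v ρ

    lookup-Tv : lookup Tv ≗ (class v ⊓ lookup T) △ at ρ
    lookup-Tv x = trans (lookup∘tabulate _ x) (cong₂ _xor_
      (trans (cong (lookup T x ∧_) (lookup-fibre v x)) (Boolₚ.∧-comm (lookup T x) (class v x))) (at-sym x ρ))

    -- The root toggled in `toothT` cancels against the root toggled in the potential. The potential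
    -- of a tooth thus has terminal set T ∩ V(G_v), whichever root is chosen.
    Sv≗ : lookup Tv △ at ρ ≗ class v ⊓ lookup T
    Sv≗ x = trans (cong (_xor at ρ x) (lookup-Tv x)) (sym (xor-cancel (class v ⊓ lookup T) (at ρ) x))

    ∈K : ∀ {x} → x ∈V Vp K ⇔ φ x ≡ v
    ∈K {x} = mk⇔ (λ eq → at-true (trans (sym (lookup-fibre v x)) eq)) (λ φx → trans (lookup-fibre v x) (class-refl φx))

    Tv⊆ : Tv ⊆ Vp K
    Tv⊆ {x} x∈ = lookup⇒[]= x (Vp K) (trans (lookup-fibre v x)
      ([ (λ eq → proj₁ (∧-true {class v x} eq)) , (λ { refl → class-refl φρ }) ]′
        (△-at-true (class v ⊓ lookup T) ρ (trans (sym (lookup-Tv x)) ([]=⇒lookup x∈)))))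

    root∈K : ρ ∈V Vp K
    root∈K = Equivalence.from ∈K φρ

  -- Every contracted edge is counted at its unique end in B.
  module Count (B : Mask k) (cross-B : ∀ e → cross e ≡ true → B (φ (s e)) xor B (φ (t e)) ≡ true) where

    #-cuts : ∀ F → F ⊑ cross → # F ≡ ∑ (λ v → # (λ e → B v ∧ (F e ∧ cut v e)))
    #-cuts F F⊑ = trans (trans (#-def F) (∑-cong edge)) (sym (∑-# (λ v e → B v ∧ (F e ∧ cut v e))))
      where
      edge : ∀ e → b2n (F e) ≡ # (λ v → B v ∧ (F e ∧ cut v e))
      edge e with F e in Fe
      ... | false = sym (#-zero _ (λ v → Boolₚ.∧-zeroʳ (B v)))
      ... | true with xor-true {B (φ (s e))} (cross-B e (F⊑ e Fe))
      ...   | inj₁ (Bs , Bt) = sym (trans (#-cong at-s) (trans (#-at (φ (s e)) B) (cong b2n Bs)))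
        where
        at-s : ∀ v → B v ∧ cut v e ≡ at (φ (s e)) v ∧ B v
        at-s v with φ (t e) ≟ v
        ... | yes refl rewrite Bt = sym (Boolₚ.∧-zeroʳ (at (φ (s e)) v))
        ... | no _ = trans (cong (B v ∧_) (Boolₚ.xor-identityʳ (at (φ (s e)) v))) (Boolₚ.∧-comm (B v) (at (φ (s e)) v))
      ...   | inj₂ (Bs , Bt) = sym (trans (#-cong at-t) (trans (#-at (φ (t e)) B) (cong b2n Bt)))
        where
        at-t : ∀ v → B v ∧ cut v e ≡ at (φ (t e)) v ∧ B v
        at-t v with φ (s e) ≟ v
        ... | yes refl rewrite Bs = sym (Boolₚ.∧-zeroʳ (at (φ (t e)) v))
        ... | no _ = Boolₚ.∧-comm (B v) (at (φ (t e)) v)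

    cuts-lower : ∀ F → (∀ v → B v ≡ true → ⨁ (F ⊓ cut v) ≡ true) → ∀ v → b2n (B v) ≤ # (λ e → B v ∧ (F e ∧ cut v e))
    cuts-lower F odd-cut v with B v in Bv
    ... | false = z≤n
    ... | true = #-odd⇒1≤ (F ⊓ cut v) (odd-cut v Bv)

    -- An odd cut is nonempty, and each crossed edge lies in the cut of exactly one class of `B`.
    cross-lower : ∀ F → F ⊑ cross → (∀ v → B v ≡ true → ⨁ (F ⊓ cut v) ≡ true) → # B ≤ # F
    cross-lower F F⊑ odd-cut = subst₂ _≤_ (sym (#-def B)) (sym (#-cuts F F⊑)) (∑-mono _ _ (cuts-lower F odd-cut))

    -- Equal totals force equality in every summand; the comb condition is obtained from this.
    cross-tight : ∀ F → F ⊑ cross → (∀ v → B v ≡ true → ⨁ (F ⊓ cut v) ≡ true) → # F ≤ # B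
      → ∀ v → B v ≡ true → # (F ⊓ cut v) ≡ 1
    cross-tight F F⊑ odd-cut F≤B v Bv = sym (trans (cong b2n (sym Bv)) (trans
      (∑-tight _ _ (cuts-lower F odd-cut) (subst₂ _≤_ (#-cuts F F⊑) (#-def B) F≤B) v)
      (#-cong (λ e → cong (_∧ (F e ∧ cut v e)) Bv))))

    cross-exact : ∀ F → F ⊑ cross → (∀ v → B v ≡ true → # (F ⊓ cut v) ≡ 1) → # F ≡ # B
    cross-exact F F⊑ once = trans (#-cuts F F⊑) (trans (∑-cong at-v) (sym (#-def B)))
      where
      at-v : ∀ v → # (λ e → B v ∧ (F e ∧ cut v e)) ≡ b2n (B v)
      at-v v with B v in Bv
      ... | true = once v Bv
      ... | false = #-zero _ (λ _ → refl)

    #-total : (∀ e → cross e ≡ false → B (φ (s e)) ≡ true)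
      → ∀ F → # F ≡ # (F ⊓ cross) + ∑ (λ v → # (λ e → B v ∧ (F e ∧ inner v e)))
    #-total inner-B F = trans (#-split F cross) (cong (# (F ⊓ cross) +_)
      (trans (#-def _) (trans (∑-cong edge) (sym (∑-# (λ v e → B v ∧ (F e ∧ inner v e)))))))
      where
      edge : ∀ e → b2n (F e ∧ not (cross e)) ≡ # (λ v → B v ∧ (F e ∧ inner v e))
      edge e with φ (s e) ≟ φ (t e) in eq
      ... | yes φs≡φt = sym (trans (#-cong pointwise) (trans (#-at (φ (s e)) (λ v → B v ∧ F e)) (cong b2n
              (trans (cong (_∧ F e) (inner-B e (cong (λ d → not ⌊ d ⌋) eq))) (sym (Boolₚ.∧-identityʳ (F e)))))))
        where
        pointwise : ∀ v → B v ∧ (F e ∧ inner v e) ≡ at (φ (s e)) v ∧ (B v ∧ F e)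
        pointwise v = trans (cong (λ w → B v ∧ (F e ∧ (at (φ (s e)) v ∧ at w v))) (sym φs≡φt))
          (truthTable 3 (λ b f a → b ∧ (f ∧ (a ∧ a))) (λ b f a → a ∧ (b ∧ f)) refl (B v) (F e) (at (φ (s e)) v))
      ... | no φs≢φt = trans (cong b2n (Boolₚ.∧-zeroʳ (F e))) (sym (#-zero _ none))
        where
        none : ∀ v → B v ∧ (F e ∧ inner v e) ≡ false
        none v = ¬true⇒false λ eq → case (∧-true {class v (s e)} (proj₂ (∧-true {F e} (proj₂ (∧-true {B v} eq)))))
          where
          case : class v (s e) ≡ true × class v (t e) ≡ true → ⊥
          case (s∈ , t∈) = φs≢φt (trans (at-true s∈) (sym (at-true t∈)))

-- From a primal graft to a synthesis: the teeth

module Forward {n m : ℕ} (s t : Fin m → Fin n) (T : Subset n) (r : Fin n)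
  (A₀ B₀ : Subset n) (bip : IsBipartition (mkGraph n m s t) A₀ B₀)
  (primal : Primal (mkGraph n m s t) T r) where

  private
    G₀ = mkGraph n m s t
    T⊆V : T ⊆ ⊤
    T⊆V _ = ∈⊤

  S : Mask n
  S = lookup T △ at r

  opaque

    proper₀ : Proper G₀
    proper₀ = bipartition⇒proper G₀ A₀ B₀ bip

    peak : Peak G₀ S r
    peak = primal⇒peak G₀ proper₀ T T⊆V r primal

  open Peak peak
  open Top G₀ proper₀ S peak

  M : ℕ
  M = p r

  Jmin : ∀ x → Min G₀ (S △ at x) (J x)
  Jmin x = J-min (lookup-⊤ x)

  p≤M : ∀ x → p x ≤ M
  p≤M x = p≤ (lookup-⊤ x)

  link-adj : ∀ {e x y} → Link G₀ e x y → Adj G₀ x y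
  link-adj {e} e-link = e , lookup-⊤ e , e-link

  Deep : Fin n → Fin n → Set
  Deep x y = Adj G₀ x y × p x < M × p y < M

  deep-edges : List (Fin m) → List (Fin n × Fin n)
  deep-edges [] = []
  deep-edges (e ∷ es) with p (s e) ℕ.<? M | p (t e) ℕ.<? M
  ... | yes _ | yes _ = (s e , t e) ∷ deep-edges es
  ... | _ | _ = deep-edges es

  deep-edges-deep : ∀ es → All (λ (a , b) → Star Deep a b) (deep-edges es)
  deep-edges-deep [] = []
  deep-edges-deep (e ∷ es) with p (s e) ℕ.<? M | p (t e) ℕ.<? M
  ... | yes ps | yes pt = ((link-adj (inj₁ (refl , refl)) , ps , pt) ◅ ε) ∷ deep-edges-deep es
  ... | yes _ | no _ = deep-edges-deep es
  ... | no _ | _ = deep-edges-deep es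

  deep-edges-complete : ∀ {P : Fin n × Fin n → Set} {e es} → e ∈ˡ es → p (s e) < M → p (t e) < M → All P (deep-edges es) → P (s e , t e)
  deep-edges-complete {e = e} (here refl) ps pt all with p (s e) ℕ.<? M | p (t e) ℕ.<? M
  deep-edges-complete (here refl) ps pt (Pe ∷ _) | yes _ | yes _ = Pe
  ... | no ¬ps | _ = contradiction ps ¬ps
  ... | yes _ | no ¬pt = contradiction pt ¬pt
  deep-edges-complete {es = e′ ∷ es} (there e∈) ps pt all with p (s e′) ℕ.<? M | p (t e′) ℕ.<? M
  deep-edges-complete (there e∈) ps pt (_ ∷ all) | yes _ | yes _ = deep-edges-complete e∈ ps pt all
  ... | yes _ | no _ = deep-edges-complete e∈ ps pt all
  ... | no _ | _ = deep-edges-complete e∈ ps pt all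

  opaque

    teeth : Quotient (Star Deep) (deep-edges (allFin m))
    teeth = quotient ε (Star.reverse (λ (adj , px , py) → adj-sym G₀ adj , py , px)) _◅◅_ (deep-edges (allFin m)) (deep-edges-deep (allFin m))

  open Quotient teeth renaming (size to k)
  open Contraction s t T φ

  rep : Fin k → Fin n
  rep v = proj₁ (surjective v)

  φ-rep : ∀ v → φ (rep v) ≡ v
  φ-rep v = proj₂ (surjective v)

  φ-edge : ∀ {e x y} → Link G e x y → p x < M → p y < M → φ x ≡ φ y
  φ-edge (inj₁ (refl , refl)) px py = deep-edges-complete (∈-allFin _) px py identifies
  φ-edge (inj₂ (refl , refl)) px py = sym (deep-edges-complete (∈-allFin _) py px identifies)

  deep-star : ∀ {x y} → Star Deep x y → x ≡ y ⊎ (p x < M × p y < M)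
  deep-star ε = inj₁ refl
  deep-star ((_ , px , py) ◅ path) with deep-star path
  ... | inj₁ refl = inj₂ (px , py)
  ... | inj₂ (_ , pz) = inj₂ (px , pz)

  class-deep : ∀ {x y} → φ x ≡ φ y → p y < M → p x < M
  class-deep φx≡φy py with deep-star (effective φx≡φy)
  ... | inj₁ refl = py
  ... | inj₂ (px , _) = px

  -- A deep step never touches level `M`, so a top vertex is alone in its class. This is the source
  -- of `spine-single`.
  class-top : ∀ {x y} → φ x ≡ φ y → p y ≡ M → x ≡ y
  class-top φx≡φy py with deep-star (effective φx≡φy)
  ... | inj₁ x≡y = x≡y
  ... | inj₂ (_ , py<M) = contradiction py (ℕₚ.<⇒≢ py<M)

  spine tooth : Mask k
  spine v = ⌊ p (rep v) ℕ.≟ M ⌋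
  tooth v = not (spine v)

  spine⇒p : ∀ x → spine (φ x) ≡ true → p x ≡ M
  spine⇒p x eq = trans (cong p (class-top (sym (φ-rep (φ x))) rep-top)) rep-top
    where
    rep-top = ⌊⌋-true (p (rep (φ x)) ℕ.≟ M) eq

  p⇒spine : ∀ x → p x ≡ M → spine (φ x) ≡ true
  p⇒spine x px = dec⇒⌊⌋ (p (rep (φ x)) ℕ.≟ M) (trans (cong p (class-top (φ-rep (φ x)) px)) px)

  tooth⇒p : ∀ x → tooth (φ x) ≡ true → p x < M
  tooth⇒p x eq = ℕₚ.≤∧≢⇒< (p≤M x) λ px → true≢false eq (cong not (p⇒spine x px))

  -- Below `M`, `w` would be joined to `u` by a deep step and share its class. So `w` is at level
  -- `M` and, by `p-adj`, `u` is one lower, which is the highest level possible in a tooth.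
  boundary-levels : ∀ {e u w} → Link G e u w → p u < M → φ w ≢ φ u → M ≡ suc (p u) × p w ≡ M
  boundary-levels {e} {u} {w} e-link pu φw≢φu with p w ℕ.<? M
  ... | yes pw = contradiction (sym (φ-edge e-link pu pw)) φw≢φu
  ... | no ¬pw = go (p-adj (link-adj e-link))
    where
    pw : p w ≡ M
    pw = ℕₚ.≤-antisym (p≤M w) (ℕₚ.≮⇒≥ ¬pw)
    go : p w ≡ suc (p u) ⊎ p u ≡ suc (p w) → M ≡ suc (p u) × p w ≡ M
    go (inj₁ eq) = trans (sym pw) eq , pw
    go (inj₂ eq) = contradiction (ℕₚ.<-trans (ℕₚ.≤-reflexive (sym (trans eq (cong suc pw)))) pu) (ℕₚ.<-irrefl refl)

  below-star : ∀ {i x y} → M ≡ suc i → Star Deep x y → Star (Below i) x y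
  below-star M≡ = Star.map λ (adj , px , _) → adj , s≤s⁻¹ (ℕₚ.≤-trans px (ℕₚ.≤-reflexive M≡))

  -- How minimum joins meet tooth boundaries

  -- If `F` used `e`, deleting it would leave a join of S △ {u, w} △ {x} of size `p x` - 1. The set
  -- {u, w} is bounded at level `p u` = `M` - 1 with one unit to spare, and the tooth contains a
  -- walk from `x` to `u` at or below that level, so `p-lower` refutes this.
  even-cut : ∀ {x F} → p x < M → Min G (S △ at x) F → ∀ {e u w} → Link G e u w → φ u ≡ φ x → φ w ≢ φ u → F e ≡ false
  even-cut {x} {F} px Fmin {e} {u} {w} e-link φu φw≢φu = ¬true⇒false λ Fe → ℕₚ.<-irrefl refl (begin-strict
    # (F △ at e)  <⟨ ℕₚ.≤-reflexive (sym (#-remove F e Fe)) ⟩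
    # F           ≡⟨ min-size G Fmin (Jmin x) ⟩
    p x           ≤⟨ p-lower bounded (below-star M≡ (effective (sym φu))) Yu ℕₚ.≤-refl (F △ at e) j ⟩
    # (F △ at e)  ∎)
    where
    open ℕₚ.≤-Reasoning
    levels = boundary-levels e-link (class-deep φu px) φw≢φu
    M≡ = proj₁ levels
    pw : p w ≡ suc (p u)
    pw = trans (proj₂ levels) M≡
    Y = at u △ at w
    Yu : Y u ≡ true
    Yu = cong₂ _xor_ (at-refl u) (at-≢ λ w≡u → φw≢φu (cong φ w≡u))
    j : Join G (S △ (Y △ at x)) (F △ at e)
    j = join-≗ G (λ y → truthTable 4 (λ s a b c → (s xor c) xor (a xor b)) (λ s a b c → s xor ((a xor b) xor c)) refl (S y) (at u y) (at w y) (at x y))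
      (join-△ G (proj₁ Fmin) (join-link G (lookup-⊤ e) e-link))
    bounded : Bounded Y (p u)
    bounded b Yb = lookup-⊤ b , bound (xor-true {at u b} Yb)
      where
      bound : (at u b ≡ true × at w b ≡ false) ⊎ (at u b ≡ false × at w b ≡ true) → ∀ F′ → Join G (S △ (Y △ at b)) F′ → p u + p u ≤ # F′ + p b
      bound (inj₁ (u≡b , _)) F′ j′ with at-true u≡b
      ... | refl = ℕₚ.+-monoˡ-≤ (p u) (ℕₚ.≤-trans (ℕₚ.n≤1+n (p u)) (subst (_≤ # F′) pw (proj₂ (Jmin w) F′
          (join-≗ G (λ y → truthTable 3 (λ s a b → s xor ((a xor b) xor a)) (λ s a b → s xor b) refl (S y) (at u y) (at w y)) j′))))
      bound (inj₂ (_ , w≡b)) F′ j′ with at-true w≡b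
      ... | refl = ℕₚ.+-mono-≤ (proj₂ (Jmin u) F′
          (join-≗ G (λ y → truthTable 3 (λ s a b → s xor ((a xor b) xor b)) (λ s a b → s xor a) refl (S y) (at u y) (at w y)) j′))
          (ℕₚ.≤-trans (ℕₚ.n≤1+n (p u)) (ℕₚ.≤-reflexive (sym pw)))

  uncut : ∀ {x F} → p x < M → Min G (S △ at x) F → ∀ e → F e ≡ true → cut (φ x) e ≡ false
  uncut {x} px Fmin e Fe = ¬true⇒false λ cut-e → case (cut-ends cut-e)
    where
    case : (∃ λ u → ∃ λ w → Link G e u w × φ u ≡ φ x × φ w ≢ φ x) → ⊥
    case (u , w , e-link , φu , φw≢) = true≢false Fe (even-cut px Fmin e-link φu (λ eq → φw≢ (trans eq φu)))

  -- A minimum join for a vertex `x` of the tooth avoids its cut, so S △ {x} meets the tooth evenly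
  -- and S meets it oddly.
  project-S-tooth : ∀ v → tooth v ≡ true → project S v ≡ true
  project-S-tooth v Bv = begin
    project S v                                  ≡⟨ xor-cancel (project S) (at (φ x)) v ⟩
    (project S v xor at (φ x) v) xor at (φ x) v  ≡⟨ cong₂ _xor_ even-x (subst (λ w → at w v ≡ true) (sym (φ-rep v)) (at-refl v)) ⟩
    true                                         ∎
    where
    open ≡-Reasoning
    x = rep v
    px : p x < M
    px = tooth⇒p x (subst (λ w → tooth w ≡ true) (sym (φ-rep v)) Bv)
    even-x : project S v xor at (φ x) v ≡ false
    even-x = begin
      project S v xor at (φ x) v   ≡⟨ project-△at S x v ⟨
      project (S △ at x) v         ≡⟨ ⨁-cong (λ y → cong (class v y ∧_) (proj₂ (proj₁ (Jmin x)) y)) ⟨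
      project (∂ G (J x)) v        ≡⟨ cut-project (J x) v ⟨
      ⨁ (J x ⊓ cut v)              ≡⟨ ⊕-false (J x ⊓ cut v) zero-edge ⟩
      false                        ∎
      where
      zero-edge : ∀ e → J x e ∧ cut v e ≡ false
      zero-edge e with J x e in Je
      ... | false = refl
      ... | true = subst (λ w → cut w e ≡ false) (φ-rep v) (uncut px (Jmin x) e Je)

  tooth≢ : ∀ {v a} → tooth v ≡ true → p a ≡ M → at (φ a) v ≡ false
  tooth≢ {v} {a} Bv pa = at-≢ λ φa → contradiction pa (ℕₚ.<⇒≢ (tooth⇒p a (trans (cong tooth φa) Bv)))

  odd-cut : ∀ {a F} → p a ≡ M → Join G (S △ at a) F → ∀ v → tooth v ≡ true → ⨁ (F ⊓ cut v) ≡ true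
  odd-cut {a} {F} pa (_ , ∂F) v Bv = begin
    ⨁ (F ⊓ cut v)                ≡⟨ cut-project F v ⟩
    project (∂ G F) v            ≡⟨ ⨁-cong (λ y → cong (class v y ∧_) (∂F y)) ⟩
    project (S △ at a) v         ≡⟨ project-△at S a v ⟩
    project S v xor at (φ a) v   ≡⟨ cong₂ _xor_ (project-S-tooth v Bv) (tooth≢ Bv pa) ⟩
    true                         ∎
    where open ≡-Reasoning

  -- Two edges u₁w₁, u₂w₂ of F in one cut would leave a too small join after deleting both: odd-top at level M
  -- makes Y = {a, w₁, u₂, w₂} admissible at level M − 1, and u₂ is reached from u₁ inside the tooth.
  cut-unique : ∀ {a F} → p a ≡ M → Min G (S △ at a) F → ∀ v → tooth v ≡ true
    → ∀ e₁ e₂ → (F ⊓ cut v) e₁ ≡ true → (F ⊓ cut v) e₂ ≡ true → e₁ ≡ e₂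
  cut-unique {a} {F} pa Fmin v Bv e₁ e₂ eq₁ eq₂ with e₁ ≟ e₂
  ... | yes e₁≡e₂ = e₁≡e₂
  ... | no e₁≢e₂ with cut-ends {v} {e₁} (proj₂ (∧-true {F e₁} eq₁)) | cut-ends {v} {e₂} (proj₂ (∧-true {F e₂} eq₂))
  ...   | u₁ , w₁ , link₁ , φu₁ , φw₁ | u₂ , w₂ , link₂ , φu₂ , φw₂ = contradiction
          (p-lower bounded (below-star M≡ (effective (trans φu₁ (sym φu₂)))) Yu₂ (ℕₚ.≤-reflexive pu₂) ((F △ at e₁) △ at e₂) j)
          -- `# F` = `M` = `i` + 1, so two deletions leave `i` - 1 edges, below `p u₁` = `i`.
          (ℕₚ.<⇒≱ (s≤s⁻¹ (ℕₚ.≤-reflexive (trans (sym #F) (trans (min-size G Fmin (Jmin a)) (trans pa M≡))))))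
    where
    deep : ∀ {u} → φ u ≡ v → p u < M
    deep {u} φu = tooth⇒p u (trans (cong tooth φu) Bv)
    levels₁ = boundary-levels link₁ (deep φu₁) (λ eq → φw₁ (trans eq φu₁))
    levels₂ = boundary-levels link₂ (deep φu₂) (λ eq → φw₂ (trans eq φu₂))
    i = p u₁
    M≡ : M ≡ suc i
    M≡ = proj₁ levels₁
    pu₂ : p u₂ ≡ i
    pu₂ = ℕₚ.suc-injective (trans (sym (proj₁ levels₂)) M≡)
    pw₁ = proj₂ levels₁
    pw₂ = proj₂ levels₂
    Y = ((at a △ at w₁) △ at u₂) △ at w₂
    #F : # F ≡ suc (suc (# ((F △ at e₁) △ at e₂)))
    #F = trans (#-remove F e₁ (proj₁ (∧-true {F e₁} eq₁))) (cong suc (#-remove (F △ at e₁) e₂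
      (cong₂ _xor_ (proj₁ (∧-true {F e₂} eq₂)) (at-≢ e₁≢e₂))))
    top≢u₂ : ∀ {c} → p c ≡ M → at c u₂ ≡ false
    top≢u₂ pc = at-≢ λ { refl → ℕₚ.<⇒≢ (deep φu₂) pc }
    Yu₂ : Y u₂ ≡ true
    Yu₂ = cong₂ _xor_ (cong₂ _xor_ (cong₂ _xor_ (top≢u₂ pa) (top≢u₂ pw₁)) (at-refl u₂)) (top≢u₂ pw₂)
    j : Join G (S △ (Y △ at u₁)) ((F △ at e₁) △ at e₂)
    j = join-≗ G (λ y → truthTable 6 (λ s a u w u′ w′ → ((s xor a) xor (u xor w)) xor (u′ xor w′))
          (λ s a u w u′ w′ → s xor ((((a xor w) xor u′) xor w′) xor u)) refl (S y) (at a y) (at u₁ y) (at w₁ y) (at u₂ y) (at w₂ y))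
      (join-△ G (join-△ G (proj₁ Fmin) (join-link G (lookup-⊤ e₁) link₁)) (join-link G (lookup-⊤ e₂) link₂))
    enough : ∀ {b F′} → M ≤ suc (# F′) → i ≤ p b → i + i ≤ # F′ + p b
    enough M≤ i≤ = ℕₚ.+-mono-≤ (s≤s⁻¹ (ℕₚ.≤-trans (ℕₚ.≤-reflexive (sym M≡)) M≤)) i≤
    i≤top : ∀ {b} → p b ≡ M → i ≤ p b
    i≤top pb = ℕₚ.≤-trans (ℕₚ.n≤1+n i) (ℕₚ.≤-reflexive (trans (sym M≡) (sym pb)))
    toggle₂ : ∀ {D F′} → Join G D F′ → Join G (D △ (at u₂ △ at w₂)) (F′ △ at e₂)
    toggle₂ j′ = join-△ G j′ (join-link G (lookup-⊤ e₂) link₂)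
    -- Toggling `e₂` leaves a single top vertex as extra terminal. The toggle may cost one edge,
    -- which the level `i` = `M` - 1 tolerates.
    single : ∀ {c D F′} → p c ≡ M → Join G D F′ → D △ (at u₂ △ at w₂) ≗ S △ at c → M ≤ suc (# F′)
    single {c} {F′ = F′} pc j′ D≗ = ℕₚ.≤-trans (subst (_≤ # (F′ △ at e₂)) pc (proj₂ (Jmin c) _ (join-≗ G D≗ (toggle₂ j′)))) (#-toggle-≤ F′ e₂)
    -- The vertices `a`, `w₁`, `w₂` may coincide; their symmetric difference is still an odd set of
    -- top vertices, as `odd-top` requires.
    X = (at a △ at w₁) △ at w₂
    triple : ∀ F′ → Join G (S △ X) F′ → M ≤ # F′
    triple = odd-top X X-top (trans (⨁-△at (at a △ at w₁) w₂) (cong (_xor true) (trans (⨁-△at (at a) w₁) (cong (_xor true) ⨁-at))))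
      where
      ⨁-at : ⨁ (at a) ≡ true
      ⨁-at = trans (⨁-cong (λ y → sym (Boolₚ.∧-identityʳ (at a y)))) (⊕-at a (λ _ → true))
      X-top : ∀ b → X b ≡ true → b ∈V ⊤ × p b ≡ M
      X-top b Xb = case (△-at-true (at a △ at w₁) w₂ Xb)
        where
        top : ∀ {c} → p c ≡ M → c ≡ b → b ∈V ⊤ × p b ≡ M
        top pc refl = lookup-⊤ b , pc
        case : (at a △ at w₁) b ≡ true ⊎ w₂ ≡ b → b ∈V ⊤ × p b ≡ M
        case (inj₂ w₂≡b) = top pw₂ w₂≡b
        case (inj₁ eq) = [ (λ a≡b → top pa (at-true a≡b)) , top pw₁ ]′ (△-at-true (at a) w₁ eq)
    Bound : Fin n → Set
    Bound b = ∀ F′ → Join G (S △ (Y △ at b)) F′ → i + i ≤ # F′ + p b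
    bound-a : Bound a
    bound-a F′ j′ = enough {F′ = F′} (single pw₁ j′ λ y → truthTable 5
      (λ s a w u′ w′ → (s xor ((((a xor w) xor u′) xor w′) xor a)) xor (u′ xor w′)) (λ s a w u′ w′ → s xor w) refl
      (S y) (at a y) (at w₁ y) (at u₂ y) (at w₂ y)) (i≤top pa)
    bound-w₁ : Bound w₁
    bound-w₁ F′ j′ = enough {F′ = F′} (single pa j′ λ y → truthTable 5
      (λ s a w u′ w′ → (s xor ((((a xor w) xor u′) xor w′) xor w)) xor (u′ xor w′)) (λ s a w u′ w′ → s xor a) refl
      (S y) (at a y) (at w₁ y) (at u₂ y) (at w₂ y)) (i≤top pw₁)
    bound-u₂ : Bound u₂
    bound-u₂ F′ j′ = enough {F′ = F′} (ℕₚ.≤-trans (triple F′ (join-≗ G (λ y → truthTable 5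
      (λ s a w u′ w′ → s xor ((((a xor w) xor u′) xor w′) xor u′)) (λ s a w u′ w′ → s xor ((a xor w) xor w′)) refl
      (S y) (at a y) (at w₁ y) (at u₂ y) (at w₂ y)) j′)) (ℕₚ.n≤1+n _)) (ℕₚ.≤-reflexive (sym pu₂))
    bound-w₂ : Bound w₂
    bound-w₂ F′ j′ = enough {F′ = F′} (ℕₚ.≤-trans (triple (F′ △ at e₂) (join-≗ G (λ y → truthTable 5
      (λ s a w u′ w′ → (s xor ((((a xor w) xor u′) xor w′) xor w′)) xor (u′ xor w′)) (λ s a w u′ w′ → s xor ((a xor w) xor w′)) refl
      (S y) (at a y) (at w₁ y) (at u₂ y) (at w₂ y)) (toggle₂ j′))) (#-toggle-≤ F′ e₂)) (i≤top pw₂)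
    bounded : Bounded Y i
    bounded b Yb = lookup-⊤ b , case₁ (△-at-true ((at a △ at w₁) △ at u₂) w₂ Yb)
      where
      case₃ : (at a △ at w₁) b ≡ true → Bound b
      case₃ eq = [ (λ a≡b → subst Bound (at-true a≡b) bound-a) , (λ w₁≡b → subst Bound w₁≡b bound-w₁) ]′ (△-at-true (at a) w₁ eq)
      case₂ : ((at a △ at w₁) △ at u₂) b ≡ true → Bound b
      case₂ eq = [ case₃ , (λ u₂≡b → subst Bound u₂≡b bound-u₂) ]′ (△-at-true (at a △ at w₁) u₂ eq)
      case₁ : ((at a △ at w₁) △ at u₂) b ≡ true ⊎ w₂ ≡ b → Bound b
      case₁ = [ case₂ , (λ w₂≡b → subst Bound w₂≡b bound-w₂) ]′

  one-cut : ∀ {a F} → p a ≡ M → Min G (S △ at a) F → ∀ v → tooth v ≡ true → # (F ⊓ cut v) ≡ 1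
  one-cut {F = F} pa Fmin v Bv = #-unique (F ⊓ cut v) (odd-cut pa (proj₁ Fmin) v Bv) (cut-unique pa Fmin v Bv)

  -- Roots and tooth grafts

  -- The root is taken as the inner end of an edge leaving the tooth, hence at level `M` - 1, the
  -- maximum of `p` there. The outer end is kept because primality of the skeleton needs a top
  -- neighbour.
  record Root (v : Fin k) : Set where
    field
      vertex outside : Fin n
      edge : Fin m
      edge-link : Link G edge vertex outside
      vertex-in : φ vertex ≡ v
      outside-out : φ outside ≢ v

  rootOf : ∀ v → tooth v ≡ true → Root v
  rootOf v Bv with ⊕-true⇒∃ (J r ⊓ cut v) (odd-cut refl (proj₁ (Jmin r)) v Bv)
  ... | e , eq with cut-ends {v} {e} (proj₂ (∧-true {J r e} eq))
  ...   | u , w , e-link , φu , φw = record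
    { vertex = u ; outside = w ; edge = e ; edge-link = e-link ; vertex-in = φu ; outside-out = φw }

  root : Fin k → Fin n
  root v with tooth v Bool.≟ true
  ... | yes Bv = Root.vertex (rootOf v Bv)
  ... | no _ = rep v

  root-spec : ∀ v → tooth v ≡ true → Σ (Root v) λ R → root v ≡ Root.vertex R
  root-spec v Bv with tooth v Bool.≟ true
  ... | yes Bv′ = rootOf v Bv′ , refl
  ... | no ¬Bv = contradiction Bv ¬Bv

  root-class : ∀ v → tooth v ≡ true → φ (root v) ≡ v
  root-class v Bv with root-spec v Bv
  ... | R , eq = trans (cong φ eq) (Root.vertex-in R)

  root-level : ∀ v → tooth v ≡ true → M ≡ suc (p (root v))
  root-level v Bv with root-spec v Bv
  ... | R , eq = trans (proj₁ (boundary-levels (Root.edge-link R) (tooth⇒p _ (trans (cong tooth (Root.vertex-in R)) Bv))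
    (λ φ≡ → Root.outside-out R (trans φ≡ (Root.vertex-in R))))) (cong (suc ∘ p) (sym eq))

  class-p : ∀ {v x} → tooth v ≡ true → φ x ≡ v → p x < M
  class-p {x = x} Bv φx = tooth⇒p x (trans (cong tooth φx) Bv)

  root-max : ∀ v → tooth v ≡ true → ∀ {x} → φ x ≡ v → p x ≤ p (root v)
  root-max v Bv φx = s≤s⁻¹ (ℕₚ.≤-trans (class-p Bv φx) (ℕₚ.≤-reflexive (root-level v Bv)))

  Asub Bsub : Subset k
  Asub = tabulate spine
  Bsub = tabulate tooth

  ∈A : ∀ {v} → v ∈ Asub ⇔ spine v ≡ true
  ∈A {v} = mk⇔ (λ v∈ → trans (sym (lookup∘tabulate spine v)) ([]=⇒lookup v∈)) (λ eq → lookup⇒[]= v Asub (trans (lookup∘tabulate spine v) eq))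

  ∈B : ∀ {v} → v ∈ Bsub ⇔ tooth v ≡ true
  ∈B {v} = mk⇔ (λ v∈ → trans (sym (lookup∘tabulate tooth v)) ([]=⇒lookup v∈)) (λ eq → lookup⇒[]= v Bsub (trans (lookup∘tabulate tooth v) eq))

  ∈A′ : ∀ {x} → p x ≡ M → φ x ∈ Asub
  ∈A′ px = Equivalence.from ∈A (p⇒spine _ px)

  module Tooth (v : Fin k) (Bv : tooth v ≡ true) where

    open ToothGraft v (root v) (root-class v Bv) renaming (Sv≗ to Sv≗T)

    Sv = lookup Tv △ at (root v)

    -- The global root `r` has level `M` and so lies outside the tooth; inside it, S and T agree.
    Sv≗ : Sv ≗ class v ⊓ S
    Sv≗ x with class v x in φx
    ... | true = trans (Sv≗T x) (trans (cong (_∧ lookup T x) φx) (trans (sym (Boolₚ.xor-identityʳ (lookup T x)))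
      (cong (lookup T x xor_) (sym (at-≢ λ { refl → ℕₚ.<-irrefl refl (class-p Bv (at-true φx)) })))))
    ... | false = trans (Sv≗T x) (cong (_∧ lookup T x) φx)

    Jv outer : Fin n → Mask m
    Jv x = J x ⊓ inner v
    outer x = J x ⊓ (not ∘ inner v)

    Jv-join : ∀ {x} → φ x ≡ v → Join K (Sv △ at x) (Jv x)
    Jv-join {x} φx = (λ e eq → trans (lookup-inner v e) (proj₂ (∧-true {J x e} eq))) , λ y → begin
      ∂ G (J x ⊓ inner v) y                     ≡⟨ ∂-inner (J x) v uncut-v y ⟩
      class v y ∧ ∂ G (J x) y                   ≡⟨ cong (class v y ∧_) (proj₂ (proj₁ (Jmin x)) y) ⟩
      class v y ∧ (S y xor at x y)              ≡⟨ Boolₚ.∧-distribˡ-xor (class v y) (S y) (at x y) ⟩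
      (class v y ∧ S y) xor (class v y ∧ at x y) ≡⟨ cong₂ _xor_ (sym (Sv≗ y)) (only y) ⟩
      Sv y xor at x y                           ∎
      where
      open ≡-Reasoning
      uncut-v : ∀ e → J x e ≡ true → cut v e ≡ false
      uncut-v e Je = subst (λ w → cut w e ≡ false) φx (uncut (class-p Bv φx) (Jmin x) e Je)
      only : ∀ y → class v y ∧ at x y ≡ at x y
      only y with x ≟ y
      ... | yes refl = trans (Boolₚ.∧-identityʳ (class v x)) (subst (λ w → at w v ≡ true) (sym φx) (at-refl v))
      ... | no _ = Boolₚ.∧-zeroʳ (class v y)

    -- `J x` avoids the cut of the tooth and therefore splits there: its inner part can be traded
    -- for any join of the tooth serving `y`, with the outer part left alone.
    replace-inner : ∀ {x y F} → φ x ≡ v → Join K (Sv △ at y) F → p y ≤ # F + # (outer x)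
    replace-inner {x} {y} {F} φx (F⊑ , ∂F) = ℕₚ.≤-trans (proj₂ (Jmin y) F″ j) (ℕₚ.≤-reflexive size)
      where
      F″ = (J x △ Jv x) △ F
      j : Join G (S △ at y) F″
      j = (λ e _ → lookup-⊤ e) , λ z → trans (∂-△ G (J x △ Jv x) F z) (trans (cong₂ _xor_
            (trans (∂-△ G (J x) (Jv x) z) (cong₂ _xor_ (proj₂ (proj₁ (Jmin x)) z) (proj₂ (Jv-join φx) z))) (∂F z))
            (truthTable 4 (λ s s′ a b → ((s xor a) xor (s′ xor a)) xor (s′ xor b)) (λ s s′ a b → s xor b) refl (S z) (Sv z) (at x z) (at y z)))
      F⊑inner : F ⊑ inner v
      F⊑inner e Fe = trans (sym (lookup-inner v e)) (F⊑ e Fe)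
      inner-part : ∀ e → F″ e ∧ inner v e ≡ F e
      inner-part e with inner v e in ie
      ... | true = trans (Boolₚ.∧-identityʳ _) (truthTable 2 (λ a b → (a xor (a ∧ true)) xor b) (λ a b → b) refl (J x e) (F e))
      ... | false = trans (Boolₚ.∧-zeroʳ _) (sym (¬true⇒false λ Fe → true≢false (F⊑inner e Fe) ie))
      outer-part : ∀ e → F″ e ∧ not (inner v e) ≡ outer x e
      outer-part e with inner v e in ie
      ... | true = trans (Boolₚ.∧-zeroʳ _) (sym (Boolₚ.∧-zeroʳ (J x e)))
      ... | false = cong (_∧ true) (trans (cong ((J x e xor (J x e ∧ false)) xor_) (¬true⇒false λ Fe → true≢false (F⊑inner e Fe) ie))
              (truthTable 1 (λ a → (a xor (a ∧ false)) xor false) (λ a → a) refl (J x e)))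
      size : # F″ ≡ # F + # (outer x)
      size = trans (#-split F″ (inner v)) (cong₂ _+_ (#-cong inner-part) (#-cong outer-part))

    p-split : ∀ x → p x ≡ # (Jv x) + # (outer x)
    p-split x = #-split (J x) (inner v)

    Jv-min : ∀ {x} → φ x ≡ v → Min K (Sv △ at x) (Jv x)
    Jv-min {x} φx = Jv-join φx , λ F j → ℕₚ.+-cancelʳ-≤ (# (outer x)) _ _ (ℕₚ.≤-trans (ℕₚ.≤-reflexive (sym (p-split x))) (replace-inner φx j))

    outer-≤ : ∀ {x y} → φ x ≡ v → φ y ≡ v → # (outer y) ≤ # (outer x)
    outer-≤ {x} {y} φx φy = ℕₚ.+-cancelˡ-≤ (# (Jv y)) _ _ (ℕₚ.≤-trans (ℕₚ.≤-reflexive (sym (p-split y))) (replace-inner φx (Jv-join φy)))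

    -- Trading inner parts in both directions shows that the outer part has the same size for all
    -- vertices of the tooth. So on a tooth `p` is the tooth's own potential plus a constant, with
    -- the same maximisers.
    p-split-root : ∀ {x} → φ x ≡ v → p x ≡ # (Jv x) + # (outer (root v))
    p-split-root φx = trans (p-split _) (cong (# (Jv _) +_) (ℕₚ.≤-antisym (outer-≤ (root-class v Bv) φx) (outer-≤ φx (root-class v Bv))))

    side : Subset n → Subset n
    side X = X ∩ Vp K

    proper-side : ∀ X Y → IsBipartition G X Y → IsBipartition K (side X) (side Y)
    proper-side X Y (_ , _ , split , edges) = (λ x∈ → proj₂ (x∈p∩q⁻ X _ x∈)) , (λ x∈ → proj₂ (x∈p∩q⁻ Y _ x∈)) , split′ , edges′
      where
      split′ : ∀ x → x ∈ Vp K → (x ∈ side X × x ∉ side Y) ⊎ (x ∉ side X × x ∈ side Y)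
      split′ x x∈K with split x ∈⊤
      ... | inj₁ (x∈X , x∉Y) = inj₁ (x∈p∩q⁺ (x∈X , x∈K) , λ x∈ → x∉Y (proj₁ (x∈p∩q⁻ Y _ x∈)))
      ... | inj₂ (x∉X , x∈Y) = inj₂ ((λ x∈ → x∉X (proj₁ (x∈p∩q⁻ X _ x∈))) , x∈p∩q⁺ (x∈Y , x∈K))
      edges′ : ∀ e → e ∈ Ep K → (s e ∈ side X × t e ∈ side Y) ⊎ (s e ∈ side Y × t e ∈ side X)
      edges′ e e∈ with ∧-true {class v (s e)} (trans (sym (lookup-inner v e)) ([]=⇒lookup e∈)) | edges e ∈⊤
      ... | φs , φt | inj₁ (a , b) = inj₁ (x∈p∩q⁺ (a , sK) , x∈p∩q⁺ (b , tK))
        where sK = lookup⇒[]= (s e) (Vp K) (trans (lookup-fibre v (s e)) φs)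
              tK = lookup⇒[]= (t e) (Vp K) (trans (lookup-fibre v (t e)) φt)
      ... | φs , φt | inj₂ (a , b) = inj₂ (x∈p∩q⁺ (a , sK) , x∈p∩q⁺ (b , tK))
        where sK = lookup⇒[]= (s e) (Vp K) (trans (lookup-fibre v (s e)) φs)
              tK = lookup⇒[]= (t e) (Vp K) (trans (lookup-fibre v (t e)) φt)

    proper-K : Proper K
    proper-K = bipartition⇒proper K (side A₀) (side B₀) (proper-side A₀ B₀ bip)

    Tv-min : Min K (lookup Tv) (Jv (root v))
    Tv-min = min-≗ K (λ x → sym (xor-cancel (lookup Tv) (at (root v)) x)) (Jv-min (root-class v Bv))

    primal-K : Primal K Tv (root v)
    primal-K = mkPrimal K proper-K Tv Tv⊆ (root v) root∈K Tv-min λ x x∈K → let φx = Equivalence.to ∈K x∈K in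
      Jv x , Jv-join φx , ℕₚ.+-cancelʳ-≤ (# (outer (root v))) _ _
        (subst₂ _≤_ (p-split-root φx) (p-split-root (root-class v Bv)) (root-max v Bv φx))

    inA⇒p : ∀ {x} → InA K Tv (root v) x → φ x ≡ v × p x ≡ p (root v)
    inA⇒p {x} x∈A@(x∈K , _) = φx , trans (p-split-root φx) (trans (cong (_+ # (outer (root v)))
      (inA⇒# K proper-K Tv Tv⊆ (root v) root∈K x∈A Tv-min (Jv-min φx))) (sym (p-split-root (root-class v Bv))))
      where φx = Equivalence.to ∈K ([]=⇒lookup x∈K)

    p⇒inA : ∀ {x} → φ x ≡ v → p x ≡ p (root v) → InA K Tv (root v) x
    p⇒inA {x} φx px = #⇒inA K proper-K Tv Tv⊆ (root v) root∈K (Equivalence.from ∈K φx) Tv-min (Jv-min φx)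
      (ℕₚ.+-cancelʳ-≡ (# (outer (root v))) _ _ (trans (sym (p-split-root φx)) (trans px (p-split-root (root-class v Bv)))))

    -- An edge leaving the tooth runs from level `M` - 1, which inside the tooth is A(root), to
    -- level `M`, the spine. Conversely a spine vertex is never in the tooth, so such an edge leaves
    -- it.
    boundary : ∀ e → e ∈ δ G (fibre s t T φ v)
      ⇔ ((φ (s e) ∈ Asub × InA K Tv (root v) (t e)) ⊎ (φ (t e) ∈ Asub × InA K Tv (root v) (s e)))
    boundary e = mk⇔ to from
      where
      cut-end : ∀ {u w} → Link G e u w → class v u ≡ true → class v w ≡ false → φ w ∈ Asub × InA K Tv (root v) u
      cut-end {u} {w} e-link u∈ w∉ = ∈A′ (proj₂ levels) , p⇒inA φu (ℕₚ.suc-injective (trans (sym (proj₁ levels)) (root-level v Bv)))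
        where
        φu = at-true u∈
        levels = boundary-levels e-link (class-p Bv φu) λ φw → true≢false (trans (cong (λ c → at c v) φw) u∈) w∉
      to : e ∈ δ G (fibre s t T φ v) → (φ (s e) ∈ Asub × InA K Tv (root v) (t e)) ⊎ (φ (t e) ∈ Asub × InA K Tv (root v) (s e))
      to e∈ with xor-true {class v (s e)} (trans (sym (lookup-δ v e)) ([]=⇒lookup e∈))
      ... | inj₁ (s∈ , t∉) = inj₂ (cut-end (inj₁ (refl , refl)) s∈ t∉)
      ... | inj₂ (s∉ , t∈) = inj₁ (cut-end (inj₂ (refl , refl)) t∈ s∉)
      top∉ : ∀ {x} → φ x ∈ Asub → class v x ≡ false
      top∉ {x} x∈A = tooth≢ Bv (spine⇒p x (Equivalence.to ∈A x∈A))
      inA∈ : ∀ {x} → InA K Tv (root v) x → class v x ≡ true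
      inA∈ x∈ = subst (λ w → at w v ≡ true) (sym (proj₁ (inA⇒p x∈))) (at-refl v)
      from : (φ (s e) ∈ Asub × InA K Tv (root v) (t e)) ⊎ (φ (t e) ∈ Asub × InA K Tv (root v) (s e)) → e ∈ δ G (fibre s t T φ v)
      from (inj₁ (s∈A , t∈)) = lookup⇒[]= e (δ G (fibre s t T φ v)) (trans (lookup-δ v e) (cong₂ _xor_ (top∉ s∈A) (inA∈ t∈)))
      from (inj₂ (t∈A , s∈)) = lookup⇒[]= e (δ G (fibre s t T φ v)) (trans (lookup-δ v e) (cong₂ _xor_ (inA∈ s∈) (top∉ t∈A)))

  -- The skeleton comb

  -- Top vertices are never adjacent since `p` changes along an edge, and adjacent vertices below
  -- the top share a class.
  cross-tooth : ∀ e → cross e ≡ true → tooth (φ (s e)) xor tooth (φ (t e)) ≡ true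
  cross-tooth e eq with spine (φ (s e)) in As | spine (φ (t e)) in At
  ... | true | false = refl
  ... | false | true = refl
  ... | true | true with p-adj (link-adj {e} (inj₁ (refl , refl)))
  ...   | inj₁ pt = contradiction (trans (sym (spine⇒p (t e) At)) (trans pt (cong suc (spine⇒p (s e) As)))) (ℕₚ.<⇒≢ (ℕₚ.n<1+n M))
  ...   | inj₂ ps = contradiction (trans (sym (spine⇒p (s e) As)) (trans ps (cong suc (spine⇒p (t e) At)))) (ℕₚ.<⇒≢ (ℕₚ.n<1+n M))
  cross-tooth e eq | false | false = contradiction
    (trans (cong (at (φ (s e))) (sym (φ-edge {e} (inj₁ (refl , refl)) (tooth⇒p (s e) (cong not As)) (tooth⇒p (t e) (cong not At))))) (at-refl (φ (s e))))
    (λ same → true≢false eq (cong not same))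

  open Count tooth cross-tooth

  bip-H : IsBipartition H Asub Bsub
  bip-H = (λ _ → ∈⊤) , (λ _ → ∈⊤) , split , edges
    where
    split : ∀ v → v ∈ ⊤ → (v ∈ Asub × v ∉ Bsub) ⊎ (v ∉ Asub × v ∈ Bsub)
    split v _ with spine v in Av
    ... | true = inj₁ (Equivalence.from ∈A Av , λ v∈B → true≢false (Equivalence.to ∈B v∈B) (cong not Av))
    ... | false = inj₂ ((λ v∈A → true≢false (Equivalence.to ∈A v∈A) Av) , Equivalence.from ∈B (cong not Av))
    edges : ∀ e → e ∈ Ep H → (φ (s e) ∈ Asub × φ (t e) ∈ Bsub) ⊎ (φ (s e) ∈ Bsub × φ (t e) ∈ Asub)
    edges e e∈ with xor-true {tooth (φ (s e))} (cross-tooth e (trans (sym (lookup-cross e)) ([]=⇒lookup e∈)))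
    ... | inj₁ (Bs , Bt) = inj₂ (Equivalence.from ∈B Bs , Equivalence.from ∈A (trans (sym (Boolₚ.not-involutive _)) (cong not Bt)))
    ... | inj₂ (Bs , Bt) = inj₁ (Equivalence.from ∈A (trans (sym (Boolₚ.not-involutive _)) (cong not Bs)) , Equivalence.from ∈B Bt)

  proper-H : Proper H
  proper-H = bipartition⇒proper H Asub Bsub bip-H

  T′ = contractT s t T φ

  skeleton-join : ∀ {x F} → Join G (S △ at x) F → Join H ((lookup T′ △ at (φ r)) △ at (φ x)) (F ⊓ cross)
  skeleton-join {x} (_ , ∂F) = join-≗ H (project-T r x) (join-project ∂F)

  ⊓cross-cut : ∀ F v → F ⊓ cut v ≗ (F ⊓ cross) ⊓ cut v
  ⊓cross-cut F v e with cut v e in cut-e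
  ... | false = trans (Boolₚ.∧-zeroʳ (F e)) (sym (Boolₚ.∧-zeroʳ (F e ∧ cross e)))
  ... | true rewrite cut⇒cross v e cut-e = cong (_∧ true) (sym (Boolₚ.∧-identityʳ (F e)))

  ⊓cross⊑ : ∀ F → (F ⊓ cross) ⊑ cross
  ⊓cross⊑ F e eq = proj₂ (∧-true {F e} eq)

  skeleton-size : ∀ {a F} → p a ≡ M → Min G (S △ at a) F → # (F ⊓ cross) ≡ # tooth
  skeleton-size {F = F} pa Fmin = cross-exact (F ⊓ cross) (⊓cross⊑ F)
    λ v Bv → trans (sym (#-cong (⊓cross-cut F v))) (one-cut pa Fmin v Bv)

  T′-odd : ∀ {F} → Join H (lookup T′) F → F ⊑ cross × (∀ v → tooth v ≡ true → ⨁ (F ⊓ cut v) ≡ true)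
  T′-odd {F} (F⊑ , ∂F) = (λ e Fe → trans (sym (lookup-cross e)) (F⊑ e Fe)) , λ v Bv → begin
    ⨁ (F ⊓ cut v)                          ≡⟨ ∂F v ⟩
    lookup T′ v                            ≡⟨ lookup-contractT v ⟩
    project (lookup T) v                   ≡⟨ xor-cancel (project (lookup T)) (at (φ r)) v ⟩
    (project (lookup T) v xor at (φ r) v) xor at (φ r) v ≡⟨ cong (_xor at (φ r) v) (project-△at (lookup T) r v) ⟨
    project S v xor at (φ r) v             ≡⟨ cong₂ _xor_ (project-S-tooth v Bv) (tooth≢ Bv refl) ⟩
    true                                   ∎
    where open ≡-Reasoning

  -- Every join of `T′` meets each tooth oddly and so has at least as many edges as there are teeth;
  -- the trace of `J r` attains this number.
  skeleton-min : Min H (lookup T′) (J r ⊓ cross)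
  skeleton-min = join-≗ H (λ v → sym (xor-cancel (lookup T′) (at (φ r)) v)) (skeleton-join (proj₁ (Jmin r)))
    , λ F′ j′ → ℕₚ.≤-trans (ℕₚ.≤-reflexive (skeleton-size refl (Jmin r))) (cross-lower F′ (proj₁ (T′-odd j′)) (proj₂ (T′-odd j′)))

  T′⊆ : T′ ⊆ Vp H
  T′⊆ _ = ∈⊤

  comb : IsComb H T′ Asub Bsub
  comb = bip-H , once
    where
    once : ∀ F → IsMinJoin H T′ F → ∀ v → v ∈ Bsub → ∣ F ∩ δ H ⁅ v ⁆ ∣ ≡ 1
    once F isMin v v∈B = trans (∣∩δ∣ F v (proj₁ (proj₁ Fmin)))
      (cross-tight (lookup F) (proj₁ odd-F) (proj₂ odd-F) (ℕₚ.≤-trans (proj₂ Fmin _ (proj₁ skeleton-min)) (ℕₚ.≤-reflexive (skeleton-size refl (Jmin r))))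
        v (Equivalence.to ∈B v∈B))
      where
      Fmin = isMinJoin⇒min H proper-H T′ F T′⊆ isMin
      odd-F = T′-odd (proj₁ Fmin)

  -- Joins of `G` are projected. For a tooth the inner end of a boundary edge is used: adding that
  -- edge to its join gives a minimum join for the top vertex `outside`, whose trace has one edge
  -- per tooth, and the original trace is contained in it.
  skeleton-primal : Primal H T′ (φ r)
  skeleton-primal = mkPrimal H proper-H T′ T′⊆ (φ r) (lookup-⊤ (φ r)) skeleton-min λ v _ → joins v
    where
    Target : Fin k → Set
    Target v = ∃ λ J′ → Join H ((lookup T′ △ at (φ r)) △ at v) J′ × # J′ ≤ # (J r ⊓ cross)
    joins : ∀ v → Target v
    joins v with tooth v in Bv
    ... | false = subst Target (φ-rep v) (J (rep v) ⊓ cross , skeleton-join (proj₁ (Jmin (rep v)))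
          , ℕₚ.≤-reflexive (trans (skeleton-size top (Jmin (rep v))) (sym (skeleton-size refl (Jmin r)))))
      where
      top : p (rep v) ≡ M
      top = spine⇒p (rep v) (trans (cong spine (φ-rep v)) (trans (sym (Boolₚ.not-involutive _)) (cong not Bv)))
    ... | true = subst Target vertex-in (J vertex ⊓ cross , skeleton-join (proj₁ (Jmin vertex))
          , ℕₚ.≤-trans (#-mono smaller) (ℕₚ.≤-reflexive (trans (skeleton-size (proj₂ levels) extended) (sym (skeleton-size refl (Jmin r))))))
      where
      open Root (rootOf v Bv)
      deep = class-p Bv vertex-in
      levels = boundary-levels edge-link deep (λ φ≡ → outside-out (trans φ≡ vertex-in))
      edge∉ : J vertex edge ≡ false
      edge∉ = even-cut deep (Jmin vertex) edge-link refl (λ φ≡ → outside-out (trans φ≡ vertex-in))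
      extended : Min G (S △ at outside) (J vertex △ at edge)
      extended = join-≗ G (λ y → truthTable 3 (λ s a b → (s xor a) xor (a xor b)) (λ s a b → s xor b) refl (S y) (at vertex y) (at outside y))
          (join-△ G (proj₁ (Jmin vertex)) (join-link G (lookup-⊤ edge) edge-link))
        , λ F j → ℕₚ.≤-trans (ℕₚ.≤-reflexive (trans (#-add (J vertex) edge edge∉) (trans (sym (proj₁ levels)) (sym (proj₂ levels)))))
            (proj₂ (Jmin outside) F j)
      smaller : (J vertex ⊓ cross) ⊑ ((J vertex △ at edge) ⊓ cross)
      smaller e eq with ∧-true {J vertex e} eq
      ... | Je , cross-e = cong₂ _∧_ (cong₂ _xor_ Je (at-≢ λ { refl → true≢false Je edge∉ })) cross-e

  synthesis : Synthesis n m s t T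
  synthesis = record
    { k = k ; φ = φ ; φ-surj = surjective ; A = Asub ; B = Bsub ; comb = comb
    ; spine-single = λ { a a∈A x y refl φy → class-top (sym φy) (trans (cong p (class-top φy (spine⇒p x (Equivalence.to ∈A a∈A)))) (spine⇒p x (Equivalence.to ∈A a∈A))) }
    ; root = root
    ; Av = λ v → proj₁ (sides v) ; Bv = λ v → proj₁ (proj₂ (sides v))
    ; root-in = λ v v∈ → root-class v (Equivalence.to ∈B v∈)
    ; tooth-bip = λ v v∈ → proj₁ (proj₂ (proj₂ (sides v)) (Equivalence.to ∈B v∈))
    ; root-A = λ v v∈ → proj₂ (proj₂ (proj₂ (sides v)) (Equivalence.to ∈B v∈))
    ; tooth-primal = λ v v∈ → Tooth.primal-K v (Equivalence.to ∈B v∈)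
    ; boundary = λ v v∈ → Tooth.boundary v (Equivalence.to ∈B v∈)
    }
    where
    Sides : Fin k → Subset n → Subset n → Set
    Sides v X Y = tooth v ≡ true → IsBipartition (toothG s t T φ v) X Y × root v ∈ X
    bip-swap : IsBipartition G B₀ A₀
    bip-swap = proj₁ (proj₂ bip) , proj₁ bip
      , (λ x x∈ → [ (λ (p , q) → inj₂ (q , p)) , (λ (p , q) → inj₁ (q , p)) ]′ (proj₁ (proj₂ (proj₂ bip)) x x∈))
      , λ e e∈ → [ inj₂ , inj₁ ]′ (proj₂ (proj₂ (proj₂ bip)) e e∈)
    sides : ∀ v → ∃ λ X → ∃ λ Y → Sides v X Y
    -- The root may have either colour in `G`; the sides are exchanged when necessary so that it
    -- falls on the first.
    sides v with proj₁ (proj₂ (proj₂ bip)) (root v) ∈⊤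
    ... | inj₁ (r∈A , _) = A₀ ∩ fibre s t T φ v , B₀ ∩ fibre s t T φ v , λ Bv →
          Tooth.proper-side v Bv A₀ B₀ bip , x∈p∩q⁺ (r∈A , lookup⇒[]= (root v) _ (ToothGraft.root∈K v (root v) (root-class v Bv)))
    ... | inj₂ (_ , r∈B) = B₀ ∩ fibre s t T φ v , A₀ ∩ fibre s t T φ v , λ Bv →
          Tooth.proper-side v Bv B₀ A₀ bip-swap , x∈p∩q⁺ (r∈B , lookup⇒[]= (root v) _ (ToothGraft.root∈K v (root v) (root-class v Bv)))

-- From a synthesis to a primal graft: skeleton joins

module Backward {n m : ℕ} (s t : Fin m → Fin n) (T : Subset n) (r : Fin n) (proper₀ : Proper (mkGraph n m s t))
  (syn : Synthesis n m s t T) where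

  open Synthesis syn
  open Contraction s t T φ

  module _ (r∈A : φ r ∈ A) (skeleton : Primal H (contractT s t T φ) (φ r)) where

    T′ = contractT s t T φ

    T′⊆ : T′ ⊆ Vp H
    T′⊆ _ = ∈⊤

    opaque

      proper-H : Proper H
      proper-H = bipartition⇒proper H A B (proj₁ comb)

      colour-H : Proper.colour proper-H ≡ lookup A
      colour-H = refl

      peak-H : Peak H (lookup T′ △ at (φ r)) (φ r)
      peak-H = primal⇒peak H proper-H T′ T′⊆ (φ r) skeleton

    S : Mask n
    S = lookup T △ at r

    inA inB : Mask k
    inA = lookup A
    inB = lookup B

    A-or-B : ∀ v → (inA v ≡ true × inB v ≡ false) ⊎ (inA v ≡ false × inB v ≡ true)
    A-or-B v with proj₁ (proj₂ (proj₂ (proj₁ comb))) v ∈⊤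
    ... | inj₁ (v∈A , v∉B) = inj₁ ([]=⇒lookup v∈A , ¬true⇒false (λ eq → v∉B (lookup⇒[]= v B eq)))
    ... | inj₂ (v∉A , v∈B) = inj₂ (¬true⇒false (λ eq → v∉A (lookup⇒[]= v A eq)) , []=⇒lookup v∈B)

    A⇒¬B : ∀ {v} → inA v ≡ true → inB v ≡ false
    A⇒¬B {v} Av with A-or-B v
    ... | inj₁ (_ , ¬Bv) = ¬Bv
    ... | inj₂ (¬Av , _) = contradiction ¬Av (true≢false Av)

    B⇒¬A : ∀ {v} → inB v ≡ true → inA v ≡ false
    B⇒¬A {v} Bv with A-or-B v
    ... | inj₁ (_ , ¬Bv) = contradiction ¬Bv (true≢false Bv)
    ... | inj₂ (¬Av , _) = ¬Av

    rA : inA (φ r) ≡ true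
    rA = []=⇒lookup r∈A

    root∉ : ∀ {v} → inB v ≡ true → at (φ r) v ≡ false
    root∉ Bv = at-≢ λ { refl → true≢false Bv (A⇒¬B rA) }

    cross-B : ∀ e → cross e ≡ true → inB (φ (s e)) xor inB (φ (t e)) ≡ true
    cross-B e eq with proj₂ (proj₂ (proj₂ (proj₁ comb))) e (lookup⇒[]= e (Ep H) (trans (lookup-cross e) eq))
    ... | inj₁ (s∈A , t∈B) = cong₂ _xor_ (A⇒¬B ([]=⇒lookup s∈A)) ([]=⇒lookup t∈B)
    ... | inj₂ (s∈B , t∈A) = cong₂ _xor_ ([]=⇒lookup s∈B) (A⇒¬B ([]=⇒lookup t∈A))

    open Count inB cross-B

    singleton : ∀ {x y} → inA (φ y) ≡ true → φ x ≡ φ y → x ≡ y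
    singleton {x} {y} Ay φx = spine-single (φ y) (lookup⇒[]= (φ y) A Ay) x y φx refl

    uncrossed : ∀ e → cross e ≡ false → φ (s e) ≡ φ (t e)
    uncrossed e eq with φ (s e) ≟ φ (t e)
    ... | yes φs≡φt = φs≡φt
    uncrossed e () | no _

    -- Spine classes are singletons, so an uncrossed edge there would be a loop.
    inner-B : ∀ e → cross e ≡ false → inB (φ (s e)) ≡ true
    inner-B e eq with A-or-B (φ (s e))
    ... | inj₂ (_ , Bs) = Bs
    ... | inj₁ (As , _) = contradiction (sym (singleton As (sym (uncrossed e eq)))) (loopless G proper₀ e (lookup-⊤ e))

    inner⇒uncrossed : ∀ v e → inner v e ≡ true → cross e ≡ false
    inner⇒uncrossed v e eq with ∧-true {class v (s e)} eq
    ... | s∈ , t∈ = cong not (class-refl (trans (at-true s∈) (sym (at-true t∈))))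

    cross-uncut : ∀ F v e → (F ⊓ (not ∘ cross)) e ≡ true → cut v e ≡ false
    cross-uncut F v e eq = ¬true⇒false λ cut-e → true≢false (proj₂ (∧-true {F e} eq)) (cong not (cut⇒cross v e cut-e))

    F₀ : Subset m
    F₀ = proj₁ (proj₂ skeleton)

    F₀-min : Min H (lookup T′) (lookup F₀)
    F₀-min = isMinJoin⇒min H proper-H T′ F₀ T′⊆ (proj₁ (proj₂ (proj₂ skeleton)))

    F₀-cut : ∀ v → inB v ≡ true → # (lookup F₀ ⊓ cut v) ≡ 1
    F₀-cut v Bv = trans (sym (∣∩δ∣ F₀ v (proj₁ (proj₁ F₀-min))))
      (proj₂ comb F₀ (proj₁ (proj₂ (proj₂ skeleton))) v (lookup⇒[]= v B Bv))

    -- The comb condition puts one edge, an odd number, at `v`.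
    skeleton-T′ : ∀ v → inB v ≡ true → lookup T′ v ≡ true
    skeleton-T′ v Bv = begin
      lookup T′ v                     ≡⟨ proj₂ (proj₁ F₀-min) v ⟨
      ⨁ (lookup F₀ ⊓ cut v)           ≡⟨ odd-# (lookup F₀ ⊓ cut v) ⟨
      odd (# (lookup F₀ ⊓ cut v))     ≡⟨ cong odd (F₀-cut v Bv) ⟩
      true                            ∎
      where open ≡-Reasoning

    module PH = Peak peak-H
    module MH = Move H proper-H (lookup T′ △ at (φ r)) PH.potential

    JH-min : ∀ w → Min H ((lookup T′ △ at (φ r)) △ at w) (PH.J w)
    JH-min w = PH.J-min (lookup-⊤ w)

    JH⊑ : ∀ w → PH.J w ⊑ cross
    JH⊑ w e eq = trans (sym (lookup-cross e)) (proj₁ (proj₁ (JH-min w)) e eq)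

    JH-cut : ∀ w v → inB v ≡ true → ⨁ (PH.J w ⊓ cut v) ≡ not (at w v)
    JH-cut w v Bv = trans (proj₂ (proj₁ (JH-min w)) v) (cong (_xor at w v) (cong₂ _xor_ (skeleton-T′ v Bv) (root∉ Bv)))

    skeleton-size : PH.p (φ r) ≡ # inB
    skeleton-size = trans (min-size H (JH-min (φ r)) (min-≗ H (xor-cancel (lookup T′) (at (φ r))) F₀-min))
      (cross-exact (lookup F₀) (λ e eq → trans (sym (lookup-cross e)) (proj₁ (proj₁ F₀-min) e eq)) F₀-cut)

    -- The vertices of B other than w; for w ∈ B, parity shows that J w has at most # B − 1 edges.
    others : Fin k → Mask k
    others w v = inB v ∧ not (at w v)

    JH-size : ∀ w → PH.p w ≤ # (others w)
    JH-size w with A-or-B w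
    ... | inj₁ (_ , ¬Bw) = ℕₚ.≤-trans (PH.p≤ (lookup-⊤ w)) (ℕₚ.≤-reflexive (trans skeleton-size (#-cong λ v → sym (same v))))
      where
      same : ∀ v → others w v ≡ inB v
      same v with w ≟ v
      ... | yes refl = trans (Boolₚ.∧-zeroʳ (inB v)) (sym ¬Bw)
      ... | no _ = Boolₚ.∧-identityʳ (inB v)
    ... | inj₂ (¬Aw , Bw) = s≤s⁻¹ (ℕₚ.≤-trans (ℕₚ.≤∧≢⇒< (PH.p≤ (lookup-⊤ w)) differ)
        (ℕₚ.≤-reflexive (trans skeleton-size (trans (#-remove inB w Bw) (cong suc (#-cong same))))))
      where
      same : ∀ v → (inB △ at w) v ≡ others w v
      same v with w ≟ v
      ... | yes refl = trans (cong (_xor true) Bw) (sym (Boolₚ.∧-zeroʳ (inB v)))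
      ... | no _ = trans (Boolₚ.xor-identityʳ (inB v)) (sym (Boolₚ.∧-identityʳ (inB v)))
      differ : PH.p w ≢ PH.p (φ r)
      differ eq = true≢false
        (trans (MH.p-colour (lookup-⊤ w) (lookup-⊤ (φ r))) (trans (cong (λ c → c w xor c (φ r)) colour-H) (cong₂ _xor_ ¬Aw rA)))
        (trans (cong (λ c → odd c xor odd (PH.p (φ r))) eq) (Boolₚ.xor-same (odd (PH.p (φ r)))))

    -- Parity forces an edge of `J w` in the cut of every tooth other than `w`, and `JH-size` allows
    -- no more in total, so the bound holds with equality termwise. A skeleton join thus enters each
    -- tooth once, except the tooth `w`, which it avoids.
    JH-cut-size : ∀ w v → inB v ≡ true → # (PH.J w ⊓ cut v) ≡ b2n (not (at w v))
    JH-cut-size w v Bv = sym (trans (cong (λ b → b2n (b ∧ not (at w v))) (sym Bv)) (trans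
      (∑-tight (λ u → b2n (others w u)) (λ u → # (λ e → inB u ∧ (PH.J w e ∧ cut u e))) lower
        (subst₂ _≤_ (#-cuts (PH.J w) (JH⊑ w)) (#-def (others w)) (JH-size w)) v)
      (#-cong (λ e → cong (_∧ (PH.J w e ∧ cut v e)) Bv))))
      where
      lower : ∀ u → b2n (others w u) ≤ # (λ e → inB u ∧ (PH.J w e ∧ cut u e))
      lower u with inB u in Bu | at w u in wu
      ... | false | _ = z≤n
      ... | true | true = z≤n
      ... | true | false = #-odd⇒1≤ (PH.J w ⊓ cut u) (trans (JH-cut w u Bu) (cong not wu))

    -- Joins inside a tooth

    module ToothPeak (v : Fin k) (Bv : inB v ≡ true) where

      v∈B : v ∈ B
      v∈B = lookup⇒[]= v B Bv

      ρ = root v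

      φρ : φ ρ ≡ v
      φρ = root-in v v∈B

      open ToothGraft v ρ φρ public

      Sv = lookup Tv △ at ρ

      opaque

        proper-K : Proper K
        proper-K = bipartition⇒proper K (Av v) (Synthesis.Bv syn v) (tooth-bip v v∈B)

        peak : Peak K Sv ρ
        peak = primal⇒peak K proper-K Tv Tv⊆ ρ (tooth-primal v v∈B)

      open Peak peak public
      open Top K proper-K Sv peak using (odd-top) public

      Jmin : ∀ {x} → φ x ≡ v → Min K (Sv △ at x) (J x)
      Jmin φx = J-min (Equivalence.from ∈K φx)

      inA⇒p : ∀ {x} → InA K Tv ρ x → φ x ≡ v × p x ≡ p ρ
      inA⇒p {x} x∈A@(x∈K , _) = φx , inA⇒# K proper-K Tv Tv⊆ ρ root∈K x∈A
          (min-≗ K (λ y → sym (xor-cancel (lookup Tv) (at ρ) y)) (Jmin φρ)) (Jmin φx)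
        where φx = Equivalence.to ∈K ([]=⇒lookup x∈K)

      -- The synthesis attaches outside edges only to A(root), which is the top level of the tooth's
      -- potential.
      boundary-top : ∀ {e u w} → Link G e u w → φ u ≡ v → φ w ≢ v → p u ≡ p ρ
      boundary-top {e} {u} {w} e-link φu φw = go e-link (Equivalence.to (boundary v v∈B e) (lookup⇒[]= e _ (trans (lookup-δ v e) (cut-e e-link))))
        where
        w∉ : class v w ≡ false
        w∉ = at-≢ φw
        cut-e : ∀ {e} → Link G e u w → cut v e ≡ true
        cut-e (inj₁ (refl , refl)) = cong₂ _xor_ (class-refl φu) w∉
        cut-e (inj₂ (refl , refl)) = cong₂ _xor_ w∉ (class-refl φu)
        u∉A : φ u ∉ A
        u∉A u∈A = true≢false ([]=⇒lookup u∈A) (trans (cong inA φu) (B⇒¬A Bv))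
        go : ∀ {e} → Link G e u w → (φ (s e) ∈ A × InA K Tv ρ (t e)) ⊎ (φ (t e) ∈ A × InA K Tv ρ (s e)) → p u ≡ p ρ
        go (inj₁ (refl , refl)) (inj₁ (u∈A , _)) = contradiction u∈A u∉A
        go (inj₁ (refl , refl)) (inj₂ (_ , u∈)) = proj₂ (inA⇒p u∈)
        go (inj₂ (refl , refl)) (inj₁ (_ , u∈)) = proj₂ (inA⇒p u∈)
        go (inj₂ (refl , refl)) (inj₂ (u∈A , _)) = contradiction u∈A u∉A

      -- For crossed `F`, these are the extra terminals that the crossing edges impose on the part
      -- of a join inside the tooth.
      attached : Mask m → Mask n
      attached F = class v ⊓ ∂ G F

      attached-edge : ∀ F → F ⊑ cross → ∀ y → attached F y ≡ true
        → ∃ λ e → ∃ λ z → (F ⊓ cut v) e ≡ true × Link G e y z × φ y ≡ v × φ z ≢ v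
      attached-edge F F⊑ y eq with ∧-true {class v y} eq
      ... | y∈ , ∂y with ∂-true⇒link G proper₀ F y ∂y
      ...   | e , Fe , z , e-link = e , z , cong₂ _∧_ Fe (cut-e e-link) , e-link , φy , φz
        where
        φy = at-true y∈
        link-cross : ∀ {e} → Link G e y z → cross e ≡ true → φ z ≢ φ y
        link-cross {e} (inj₁ (refl , refl)) ce φz = true≢false ce (cong not (class-refl (sym φz)))
        link-cross {e} (inj₂ (refl , refl)) ce φz = true≢false ce (cong not (class-refl φz))
        φz : φ z ≢ v
        φz φz = link-cross e-link (F⊑ e Fe) (trans φz (sym φy))
        cut-e : ∀ {e} → Link G e y z → cut v e ≡ true
        cut-e (inj₁ (refl , refl)) = cong₂ _xor_ y∈ (at-≢ φz)
        cut-e (inj₂ (refl , refl)) = cong₂ _xor_ (at-≢ φz) y∈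

      attached-top : ∀ F → F ⊑ cross → ∀ y → attached F y ≡ true → y ∈V Vp K × p y ≡ p ρ
      attached-top F F⊑ y eq with attached-edge F F⊑ y eq
      ... | e , z , _ , e-link , φy , φz = Equivalence.from ∈K φy , boundary-top e-link φy φz

      -- Inside the tooth `F` has the terminals `Sv` changed by the ends of its crossing edges.
      -- These form an odd set of top vertices, so `odd-top` applies however often `F` crosses the
      -- boundary.
      tooth-lower : ∀ F → Join G (lookup T) F → p ρ ≤ # (F ⊓ inner v)
      tooth-lower F (_ , ∂F) = odd-top (attached (F ⊓ cross)) (attached-top (F ⊓ cross) F⊑cross) odd-attached (F ⊓ inner v)
        ((λ e eq → trans (lookup-inner v e) (proj₂ (∧-true {F e} eq))) , ∂-inner-part)
        where
        open ≡-Reasoning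
        F⊑cross : (F ⊓ cross) ⊑ cross
        F⊑cross e eq = proj₂ (∧-true {F e} eq)
        odd-attached : ⨁ (attached (F ⊓ cross)) ≡ true
        odd-attached = begin
          project (∂ G (F ⊓ cross)) v       ≡⟨ cut-project (F ⊓ cross) v ⟨
          ⨁ ((F ⊓ cross) ⊓ cut v)           ≡⟨ proj₂ (join-project ∂F) v ⟩
          project (lookup T) v              ≡⟨ lookup-contractT v ⟨
          lookup T′ v                       ≡⟨ skeleton-T′ v Bv ⟩
          true                              ∎
        -- `∂-inner` needs a mask that avoids the cut; dropping the crossed edges does not affect
        -- the inner part.
        Fn = F ⊓ (not ∘ cross)
        same-inner : F ⊓ inner v ≗ Fn ⊓ inner v
        same-inner e with inner v e in ie
        ... | false = trans (Boolₚ.∧-zeroʳ (F e)) (sym (Boolₚ.∧-zeroʳ (Fn e)))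
        ... | true rewrite inner⇒uncrossed v e ie = cong (_∧ true) (sym (Boolₚ.∧-identityʳ (F e)))
        ∂-inner-part : ∂ G (F ⊓ inner v) ≗ Sv △ attached (F ⊓ cross)
        ∂-inner-part y = begin
          ∂ G (F ⊓ inner v) y                           ≡⟨ ∂-cong G same-inner y ⟩
          ∂ G (Fn ⊓ inner v) y                          ≡⟨ ∂-inner Fn v (cross-uncut F v) y ⟩
          class v y ∧ ∂ G Fn y                          ≡⟨ cong (class v y ∧_) (∂-cong G (λ e → truthTable 2 (λ f c → f ∧ not c) (λ f c → f xor (f ∧ c)) refl (F e) (cross e)) y) ⟩
          class v y ∧ ∂ G (F △ (F ⊓ cross)) y           ≡⟨ cong (class v y ∧_) (trans (∂-△ G F (F ⊓ cross) y) (cong (_xor ∂ G (F ⊓ cross) y) (∂F y))) ⟩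
          class v y ∧ (lookup T y xor ∂ G (F ⊓ cross) y) ≡⟨ Boolₚ.∧-distribˡ-xor (class v y) (lookup T y) (∂ G (F ⊓ cross) y) ⟩
          (class v y ∧ lookup T y) xor attached (F ⊓ cross) y ≡⟨ cong (_xor attached (F ⊓ cross) y) (Sv≗ y) ⟨
          Sv y xor attached (F ⊓ cross) y               ∎

      -- The terminals are those that the inner part must have so that, together with the skeleton
      -- join for `φ x`, it produces S △ {x} throughout the tooth.
      Fill : Fin n → Mask m → Set
      Fill x F = Join K (class v ⊓ ((S △ at x) △ ∂ G (PH.J (φ x)))) F × # F ≤ p ρ

      -- If `x` is in the tooth, the skeleton join avoids the tooth and `J x` fits. Otherwise it
      -- enters by exactly one edge, and `J z` fits for the end `z` of that edge. In both cases
      -- maximality at the root bounds the size.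
      fill : ∀ x → ∃ (Fill x)
      fill x with at (φ x) v in φx
      ... | true = J x , join-≗ K D≗ (proj₁ (Jmin (at-true φx))) , p≤ (Equivalence.from ∈K (at-true φx))
        where
        no-cut : ∀ e → (PH.J (φ x) ⊓ cut v) e ≡ false
        no-cut = #-zero⁻¹ _ (trans (JH-cut-size (φ x) v Bv) (cong (b2n ∘ not) φx))
        unattached : ∀ y → attached (PH.J (φ x)) y ≡ false
        unattached y = ¬true⇒false λ eq → true≢false (proj₁ (proj₂ (proj₂ (attached-edge (PH.J (φ x)) (JH⊑ (φ x)) y eq)))) (no-cut _)
        D≗ : Sv △ at x ≗ class v ⊓ ((S △ at x) △ ∂ G (PH.J (φ x)))
        D≗ y = begin
          Sv y xor at x y                                          ≡⟨ cong₂ _xor_ (Sv≗ y) only ⟩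
          (class v y ∧ lookup T y) xor (class v y ∧ at x y)        ≡⟨ truthTable 3 (λ c t′ a → (c ∧ t′) xor (c ∧ a)) (λ c t′ a → (c ∧ ((t′ xor false) xor a)) xor false) refl (class v y) (lookup T y) (at x y) ⟩
          (class v y ∧ ((lookup T y xor false) xor at x y)) xor false ≡⟨ cong₂ _xor_ (no-root y) (sym (unattached y)) ⟩
          (class v y ∧ (S y xor at x y)) xor (class v y ∧ ∂ G (PH.J (φ x)) y) ≡⟨ Boolₚ.∧-distribˡ-xor (class v y) (S y xor at x y) _ ⟨
          class v y ∧ ((S y xor at x y) xor ∂ G (PH.J (φ x)) y)    ∎
          where
          open ≡-Reasoning
          only : at x y ≡ class v y ∧ at x y
          only with x ≟ y
          ... | yes refl = sym (trans (Boolₚ.∧-identityʳ (class v x)) φx)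
          ... | no _ = sym (Boolₚ.∧-zeroʳ (class v y))
          no-root : ∀ y → class v y ∧ ((lookup T y xor false) xor at x y) ≡ class v y ∧ (S y xor at x y)
          no-root y with class v y in y∈
          ... | false = refl
          ... | true = cong (λ b → (lookup T y xor b) xor at x y) (sym (at-≢ λ { refl → true≢false y∈ (root∉ Bv) }))
      ... | false with ⊕-true⇒∃ (attached (PH.J (φ x))) (trans (sym (cut-project (PH.J (φ x)) v)) (trans (JH-cut (φ x) v Bv) (cong not φx)))
      ...   | z , z∈ = J z , join-≗ K D≗ (proj₁ (Jmin φz)) , p≤ (Equivalence.from ∈K φz)
        where
        F = PH.J (φ x)
        z-edge = attached-edge F (JH⊑ (φ x)) z z∈
        φz : φ z ≡ v
        φz = proj₁ (proj₂ (proj₂ (proj₂ (proj₂ z-edge))))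
        one : # (F ⊓ cut v) ≡ 1
        one = trans (JH-cut-size (φ x) v Bv) (cong (b2n ∘ not) φx)
        same-end : ∀ {e y y′ w w′} → Link G e y w → Link G e y′ w′ → φ y ≡ v → φ y′ ≡ v → φ w ≢ v → φ w′ ≢ v → y ≡ y′
        same-end (inj₁ (refl , refl)) (inj₁ (refl , refl)) _ _ _ _ = refl
        same-end (inj₁ (refl , refl)) (inj₂ (refl , refl)) _ φy′ φw _ = contradiction φy′ φw
        same-end (inj₂ (refl , refl)) (inj₁ (refl , refl)) _ φy′ φw _ = contradiction φy′ φw
        same-end (inj₂ (refl , refl)) (inj₂ (refl , refl)) _ _ _ _ = refl
        unique : ∀ y → attached F y ≡ true → z ≡ y
        unique y y∈ with attached-edge F (JH⊑ (φ x)) y y∈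
        ... | e , w , Fe , e-link , φy , φw with z-edge
        ...   | e′ , w′ , Fe′ , e-link′ , φz′ , φw′ with #-1⇒unique (F ⊓ cut v) one e′ e Fe′ Fe
        ...     | refl = same-end e-link′ e-link φz′ φy φw′ φw
        attached≗ : ∀ y → at z y ≡ attached F y
        attached≗ y with z ≟ y
        ... | yes refl = sym z∈
        ... | no z≢y = sym (¬true⇒false λ eq → z≢y (unique y eq))
        D≗ : Sv △ at z ≗ class v ⊓ ((S △ at x) △ ∂ G F)
        D≗ y = begin
          Sv y xor at z y                                          ≡⟨ cong₂ _xor_ (Sv≗ y) (attached≗ y) ⟩
          (class v y ∧ lookup T y) xor attached F y                ≡⟨ cong (_xor attached F y) (no-root y) ⟩
          (class v y ∧ (S y xor at x y)) xor (class v y ∧ ∂ G F y) ≡⟨ Boolₚ.∧-distribˡ-xor (class v y) (S y xor at x y) (∂ G F y) ⟨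
          class v y ∧ ((S y xor at x y) xor ∂ G F y)               ∎
          where
          open ≡-Reasoning
          no-root : ∀ y → class v y ∧ lookup T y ≡ class v y ∧ (S y xor at x y)
          no-root y with class v y in y∈
          ... | false = refl
          ... | true = sym (trans (cong₂ (λ a b → (lookup T y xor a) xor b) (at-≢ λ { refl → true≢false y∈ (root∉ Bv) })
                  (at-≢ λ { refl → true≢false y∈ φx })) (trans (Boolₚ.xor-identityʳ _) (Boolₚ.xor-identityʳ _)))

    -- Lower bound and gluing

    toothSize : Fin k → ℕ
    toothSize v with inB v Bool.≟ true
    ... | yes Bv = ToothPeak.p v Bv (root v)
    ... | no _ = 0

    -- One crossing edge per tooth plus a minimum join of each tooth graft; it bounds joins of T
    -- from below and glued joins from above.
    total : ℕ
    total = # inB + ∑ toothSize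

    total-lower : ∀ F → Join G (lookup T) F → total ≤ # F
    total-lower F j@(_ , ∂F) = ℕₚ.≤-trans (ℕₚ.+-mono-≤ skeleton-part (∑-mono _ _ tooth-part)) (ℕₚ.≤-reflexive (sym (#-total inner-B F)))
      where
      skeleton-part : # inB ≤ # (F ⊓ cross)
      skeleton-part = cross-lower (F ⊓ cross) (λ e eq → proj₂ (∧-true {F e} eq))
        λ v Bv → trans (proj₂ (join-project ∂F) v) (trans (sym (lookup-contractT v)) (skeleton-T′ v Bv))
      tooth-part : ∀ v → toothSize v ≤ # (λ e → inB v ∧ (F e ∧ inner v e))
      tooth-part v with inB v Bool.≟ true
      ... | yes Bv = ℕₚ.≤-trans (ToothPeak.tooth-lower v Bv F j) (ℕₚ.≤-reflexive (#-cong λ e → cong (_∧ (F e ∧ inner v e)) (sym Bv)))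
      ... | no _ = z≤n

    project-single : ∀ f {y} → inA (φ y) ≡ true → project f (φ y) ≡ f y
    project-single f {y} Ay = trans (⨁-cong (λ z → cong (_∧ f z) (same z))) (⊕-at y f)
      where
      same : ∀ z → class (φ y) z ≡ at y z
      same z with y ≟ z
      ... | yes refl = at-refl (φ y)
      ... | no y≢z = at-≢ λ φz → y≢z (sym (singleton Ay φz))

    module Glue (x : Fin n) where

      F* = PH.J (φ x)

      piece : Fin k → Mask m
      piece v with inB v Bool.≟ true
      ... | yes Bv = proj₁ (ToothPeak.fill v Bv x)
      ... | no _ = λ _ → false

      piece-inner : ∀ v → piece v ⊑ inner v
      piece-inner v e eq with inB v Bool.≟ true
      ... | yes Bv = trans (sym (lookup-inner v e)) (proj₁ (proj₁ (proj₂ (ToothPeak.fill v Bv x))) e eq)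

      piece-∂ : ∀ v → inB v ≡ true → ∂ G (piece v) ≗ class v ⊓ ((S △ at x) △ ∂ G F*)
      piece-∂ v Bv with inB v Bool.≟ true
      ... | yes Bv′ = proj₂ (proj₁ (proj₂ (ToothPeak.fill v Bv′ x)))
      ... | no ¬Bv = contradiction Bv ¬Bv

      piece-size : ∀ v → # (piece v) ≤ toothSize v
      piece-size v with inB v Bool.≟ true
      ... | yes Bv = proj₂ (proj₂ (ToothPeak.fill v Bv x))
      ... | no _ = ℕₚ.≤-reflexive (#-zero (λ (_ : Fin m) → false) (λ _ → refl))

      -- The class of an uncrossed edge can be read off at its source, so the disjoint union of the
      -- pieces needs no sum over the teeth.
      pieces : Mask m
      pieces e = piece (φ (s e)) e ∧ not (cross e)

      pieces-uncut : ∀ v e → pieces e ≡ true → cut v e ≡ false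
      pieces-uncut v e eq = cross-uncut (piece (φ (s e))) v e eq

      pieces-inner : ∀ v → pieces ⊓ inner v ≗ piece v
      pieces-inner v e with inner v e in ie
      ... | false = trans (Boolₚ.∧-zeroʳ (pieces e)) (sym (¬true⇒false λ eq → true≢false (piece-inner v e eq) ie))
      ... | true = trans (Boolₚ.∧-identityʳ (pieces e)) (trans
              (cong₂ (λ w c → piece w e ∧ not c) (at-true (proj₁ (∧-true {class v (s e)} ie))) (inner⇒uncrossed v e ie))
              (Boolₚ.∧-identityʳ (piece v e)))

      ∂-pieces : ∀ y → ∂ G pieces y ≡ ∂ G (piece (φ y)) y
      ∂-pieces y = trans (cong (_∧ ∂ G pieces y) (sym (at-refl (φ y)))) (trans (sym (∂-inner pieces (φ y) (pieces-uncut (φ y)) y)) (∂-cong G (pieces-inner (φ y)) y))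

      glued : Mask m
      glued = F* △ pieces

      -- At a vertex of a tooth the piece was chosen to correct the boundary of `F*`. A spine class
      -- is a single vertex, so there `F*` has the same boundary in `G` as in `H`, and no piece
      -- reaches it.
      glued-∂ : ∀ y → ∂ G glued y ≡ S y xor at x y
      glued-∂ y = trans (∂-△ G F* pieces y) (trans (cong (∂ G F* y xor_) (∂-pieces y)) (at-y (A-or-B (φ y))))
        where
        open ≡-Reasoning
        at-y : (inA (φ y) ≡ true × inB (φ y) ≡ false) ⊎ (inA (φ y) ≡ false × inB (φ y) ≡ true)
          → ∂ G F* y xor ∂ G (piece (φ y)) y ≡ S y xor at x y
        at-y (inj₂ (_ , By)) = trans (cong (∂ G F* y xor_) (trans (piece-∂ (φ y) By y) (cong (_∧ ((S y xor at x y) xor ∂ G F* y)) (at-refl (φ y)))))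
          (truthTable 2 (λ d f → f xor (d xor f)) (λ d f → d) refl (S y xor at x y) (∂ G F* y))
        at-y (inj₁ (Ay , ¬By)) = begin
          ∂ G F* y xor ∂ G (piece (φ y)) y        ≡⟨ cong (∂ G F* y xor_) (⊕-false _ no-piece) ⟩
          ∂ G F* y xor false                      ≡⟨ Boolₚ.xor-identityʳ (∂ G F* y) ⟩
          ∂ G F* y                                ≡⟨ project-single (∂ G F*) Ay ⟨
          project (∂ G F*) (φ y)                  ≡⟨ cut-project F* (φ y) ⟨
          ∂ H F* (φ y)                            ≡⟨ proj₂ (proj₁ (JH-min (φ x))) (φ y) ⟩
          ((lookup T′ △ at (φ r)) △ at (φ x)) (φ y) ≡⟨ project-T r x (φ y) ⟨
          project (S △ at x) (φ y)                ≡⟨ project-single (S △ at x) Ay ⟩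
          S y xor at x y                          ∎
          where
          no-piece : ∀ e → piece (φ y) e ∧ (at (s e) y xor at (t e) y) ≡ false
          no-piece e with piece (φ y) e in pe
          ... | false = refl
          ... | true = contradiction pe (λ eq → true≢false (trans (cong inB (sym (at-true (proj₁ (∧-true {class (φ y) (s e)} (piece-inner (φ y) e eq))))))
                  (inner-B e (inner⇒uncrossed (φ y) e (piece-inner (φ y) e eq)))) ¬By)

      glued-join : Join G (S △ at x) glued
      glued-join = (λ e _ → lookup-⊤ e) , glued-∂

      glued-size : # glued ≤ total
      glued-size = ℕₚ.≤-trans (ℕₚ.≤-reflexive (#-total inner-B glued)) (ℕₚ.+-mono-≤
          (ℕₚ.≤-trans (#-mono cross-part) (ℕₚ.≤-trans (PH.p≤ (lookup-⊤ (φ x))) (ℕₚ.≤-reflexive skeleton-size)))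
          (∑-mono _ _ λ v → ℕₚ.≤-trans (#-mono (inner-part v)) (piece-size v)))
        where
        cross-part : (glued ⊓ cross) ⊑ F*
        cross-part e eq with ∧-true {glued e} eq
        ... | ge , ce with xor-true {F* e} ge
        ...   | inj₁ (Fe , _) = Fe
        ...   | inj₂ (_ , pe) = contradiction (cong not ce) (true≢false (proj₂ (∧-true {piece (φ (s e)) e} pe)))
        inner-part : ∀ v → (λ e → inB v ∧ (glued e ∧ inner v e)) ⊑ piece v
        inner-part v e eq with ∧-true {glued e} (proj₂ (∧-true {inB v} eq))
        ... | ge , ie with xor-true {F* e} ge
        ...   | inj₁ (Fe , _) = contradiction (inner⇒uncrossed v e ie) (true≢false (JH⊑ (φ x) e Fe))
        ...   | inj₂ (_ , pe) = trans (sym (pieces-inner v e)) (cong₂ _∧_ pe ie)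

    -- Since S △ {r} = T, the glued join for `r` is a join of T; it attains `total` and is minimum.
    -- The other glued joins do not exceed it, which is λ ≤ 0.
    primal : Primal G T r
    primal = mkPrimal G proper₀ T (λ _ → ∈⊤) r (lookup-⊤ r)
        (root-join , λ F j → ℕₚ.≤-trans (Glue.glued-size r) (total-lower F j))
        λ x _ → Glue.glued x , Glue.glued-join x , ℕₚ.≤-trans (Glue.glued-size x) (total-lower (Glue.glued r) root-join)
      where
      root-join : Join G (lookup T) (Glue.glued r)
      root-join = join-≗ G (λ v → sym (xor-cancel (lookup T) (at r) v)) (Glue.glued-join r)

open Synthesis using (A; φ)

theorem8p1 : (n m : ℕ) (s t : Fin m → Fin n) (T : Subset n) (r : Fin n)
    → IsBipartite (mkGraph n m s t)
    → (Primal (mkGraph n m s t) T r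
       ⇔ Σ (Synthesis n m s t T) λ S
           → φ S r ∈ A S
           × Primal (contractG s t T (φ S)) (contractT s t T (φ S)) (φ S r))
theorem8p1 n m s t T r (A₀ , B₀ , bip) = mk⇔ decompose compose
  where
  decompose : Primal (mkGraph n m s t) T r → Σ (Synthesis n m s t T) λ S
    → φ S r ∈ A S × Primal (contractG s t T (φ S)) (contractT s t T (φ S)) (φ S r)
  decompose primal = synthesis , ∈A′ refl , skeleton-primal
    where open Forward s t T r A₀ B₀ bip primal
  compose : (Σ (Synthesis n m s t T) λ S
    → φ S r ∈ A S × Primal (contractG s t T (φ S)) (contractT s t T (φ S)) (φ S r)) → Primal (mkGraph n m s t) T r
  compose (syn , r∈A , skeleton) =
    Backward.primal s t T r (bipartition⇒proper (mkGraph n m s t) A₀ B₀ bip) syn r∈A skeleton
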